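{- For $\alpha=(a,1,1,1,1,1)$, the graph $\mathcal{F}_\alpha$ has no Hamilton cycle for any $a\geq 1$, but it has a Hamilton path for $a=2$ and for every $a\geq 4$.
   Context: Let $N=a+5$ and label the points of a convex $N$-gon $1,\ldots,N$ counterclockwise; color the first $a$ points red, and then the remaining five points blue, red, blue, red, blue. The associahedron $\mathcal{G}_N$ has as nodes all triangulations of the convex $N$-gon, two adjacent if they differ in a flip (removing a diagonal shared by two triangles and replacing it by the other diagonal of the resulting quadrilateral). A triangulation is colorful if no triangle has all three points of the same color; $\mathcal{F}_\alpha$ is the subgraph of $\mathcal{G}_N$ induced by the colorful triangulations. -}

module Defs where

open import Data.Nat using (ℕ; zero; suc; _+_; _∸_; _<_; _≤_; _<ᵇ_)
open import Data.Fin using (Fin; toℕ)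
open import Data.Bool using (Bool; true; false; if_then_else_)
open import Data.Vec using (Vec; lookup)
open import Data.List using (List; []; _∷_; length; _∷ʳ_)
open import Data.List.Membership.Propositional using (_∈_)
open import Data.List.Relation.Unary.Linked using (Linked)
open import Data.List.Relation.Unary.Unique.Propositional using (Unique)
open import Data.Product using (Σ; ∃; _×_; _,_)
open import Data.Sum using (_⊎_)
open import Relation.Nullary using (¬_)
open import Relation.Binary.PropositionalEquality using (_≡_; _≢_)
open import Function.Bundles using (_⇔_)

-- Colours.  Points of the N-gon (N = a + 5) are 1,…,N in the paper;
-- here point p is represented by i : Fin N with toℕ i = p - 1,
-- and the labels increase counterclockwise.

data Color : Set where
  red blue : Color

-- colour of the point with 0-based index n for α = (a,1,1,1,1,1):
-- first a points red, then blue, red, blue, red, blue.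
tailColor : ℕ → Color
tailColor 1 = red
tailColor 3 = red
tailColor _ = blue

color : (a : ℕ) → ℕ → Color
color a n = if n <ᵇ a then red else tailColor (n ∸ a)

module Polygon (N : ℕ) where

  Side : Fin N → Fin N → Set
  Side i j = (toℕ j ≡ suc (toℕ i)) ⊎ (toℕ i ≡ suc (toℕ j))
           ⊎ ((toℕ i ≡ 0) × (suc (toℕ j) ≡ N))
           ⊎ ((toℕ j ≡ 0) × (suc (toℕ i) ≡ N))

  Diagonal : Fin N → Fin N → Set
  Diagonal i j = (i ≢ j) × ¬ Side i j

  Between : Fin N → Fin N → Fin N → Set
  Between i j x = ((toℕ i < toℕ x) × (toℕ x < toℕ j))
                ⊎ ((toℕ j < toℕ x) × (toℕ x < toℕ i))

  -- segments ij and kl cross in their interiors (convex position):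
  -- k, l are distinct from i, j and exactly one of them lies
  -- strictly between i and j.
  Cross : Fin N → Fin N → Fin N → Fin N → Set
  Cross i j k l = (k ≢ i) × (k ≢ j) × (l ≢ i) × (l ≢ j)
                × ((Between i j k × ¬ Between i j l)
                   ⊎ (¬ Between i j k × Between i j l))

  -- A set of diagonals, encoded as a Boolean adjacency matrix
  -- (so that propositional equality is equality of diagonal sets).
  Mat : Set
  Mat = Vec (Vec Bool N) N

  E : Mat → Fin N → Fin N → Set
  E M i j = lookup (lookup M i) j ≡ true

  record Triangulation (M : Mat) : Set where
    field
      symmetric   : ∀ i j → E M i j → E M j i
      diagonals   : ∀ i j → E M i j → Diagonal i j
      noncrossing : ∀ i j k l → E M i j → E M k l → ¬ Cross i j k l
      maximal     : ∀ i j → Diagonal i j → ¬ E M i j →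
                    ∃ λ k → ∃ λ l → E M k l × Cross i j k l

  Edge : Mat → Fin N → Fin N → Set
  Edge M i j = Side i j ⊎ E M i j

  Triangle : Mat → Fin N → Fin N → Fin N → Set
  Triangle M i j k = (i ≢ j) × (j ≢ k) × (i ≢ k)
                   × Edge M i j × Edge M j k × Edge M i k

  SamePair : Fin N → Fin N → Fin N → Fin N → Set
  SamePair x y i j = ((x ≡ i) × (y ≡ j)) ⊎ ((x ≡ j) × (y ≡ i))

  Flip : Mat → Mat → Set
  Flip M M' = ∃ λ i → ∃ λ j → ∃ λ k → ∃ λ l →
      E M i j × Triangle M i j k × Triangle M i j l × (k ≢ l)
    × (∀ x y → E M' x y ⇔ ((E M x y × ¬ SamePair x y i j) ⊎ SamePair x y k l))

module Colorful (a : ℕ) where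

  N : ℕ
  N = a + 5

  open Polygon N public

  col : Fin N → Color
  col i = color a (toℕ i)

  Colorful : Mat → Set
  Colorful M = ∀ i j k → Triangle M i j k →
               ¬ ((col i ≡ col j) × (col j ≡ col k))

  Node : Mat → Set
  Node M = Triangulation M × Colorful M

  IsHamPath : List Mat → Set
  IsHamPath L = Linked Flip L × Unique L × (∀ M → M ∈ L ⇔ Node M)

  HasHamPath : Set
  HasHamPath = ∃ IsHamPath

  HasHamCycle : Set
  HasHamCycle = ∃ λ x → ∃ λ xs →
      Linked Flip ((x ∷ xs) ∷ʳ x) × Unique (x ∷ xs)
    × (∀ M → M ∈ (x ∷ xs) ⇔ Node M) × (3 ≤ length (x ∷ xs))

{-# OPTIONS --safe #-}
-- Write A, p, B, q, C for the last five points.  A colourful triangulation is either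
-- a "hub", which contains one of the diagonals AC, pq, Aq, pC, or one of the four members
-- of a "cell" (i , j) with j ≤ i < a.
--
-- No Hamilton cycle: flips between cell members change the parity of the number of
-- diagonals joining a red point among the first a ones to p, B or q, and a flip between
-- a cell member and a hub only occurs if this number is 2.  Hence weights +1 (even),
-- −1 (odd) and 0 (hubs) have a nonnegative sum over the ends of every flip.  Their total
-- is 0, since the members of a cell cancel, so in a Hamilton cycle all these sums vanish.
-- Then the cycle never passes from a hub to a cell member, which is absurd.
--
-- Hamilton path for a ≥ 4: run through all hubs and then enter the cells at (1 , 1).
-- The rows i ≤ 3 are handled by hand, and each further pair of rows is traversed by going
-- along both rows through three members of each cell and coming back through the fourth.
-- For odd a a single row remains, which is traversed cell by cell.
module Submission where

open import Defs
open import Data.Bool using (Bool; true; false; not) renaming (T to True)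
open import Data.Bool.Properties using () renaming (_≟_ to _≟ᵇ_)
open import Data.Empty using (⊥; ⊥-elim)
open import Data.Fin using (Fin; toℕ; fromℕ<; opposite; #_)
open import Data.Fin.Properties using (all?; toℕ-injective; toℕ-fromℕ<; toℕ<n; opposite-prop; opposite-involutive) renaming (_≟_ to _≟ᶠ_)
open import Data.List using (List; []; _∷_; _++_; _∷ʳ_; length; map)
open import Data.List.Properties using (length-++; map-++)
import Data.List.Membership.DecPropositional as DecMembership
open import Data.List.Membership.Propositional using (_∈_; _∉_)
open import Data.List.Membership.Propositional.Properties using (∈-++⁺ˡ; ∈-++⁺ʳ; ∈-++⁻; ∈-lookup; ∈-∃++; ∈-map⁺; ∈-map⁻)
open import Data.List.Relation.Binary.Permutation.Propositional using (_↭_; ↭-refl; ↭-sym; ↭-trans; prep; ↭⇒↭ₛ)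
open import Data.List.Relation.Binary.Permutation.Propositional.Properties using (shift; ∈-resp-↭; map⁺; ↭-length; ↭-reverse; ∷↭∷ʳ)
import Data.List.Relation.Binary.Permutation.Setoid.Properties as Permₛ
open import Data.List.Relation.Unary.All as All using (All; []; _∷_)
open import Data.List.Relation.Unary.AllPairs using ([]; _∷_)
open import Data.List.Relation.Unary.Any using (here; there)
import Data.List.Relation.Unary.All.Properties as Allₚ
open import Data.List.Relation.Unary.Linked as Linked using (Linked; []; [-]; _∷_)
open import Data.List.Relation.Unary.Unique.Propositional using (Unique)
import Data.List.Relation.Unary.Unique.Propositional.Properties as Uniqueₚ
import Data.List.Relation.Unary.Linked.Properties as Linkedₚ
open import Data.Nat
open import Data.Nat.ListAction using (sum)
open import Data.Nat.ListAction.Properties using (sum-++; sum-↭)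
open import Data.Nat.Properties
open import Data.Nat.Tactic.RingSolver using (solve-∀)
open import Data.Product using (∃; ∃₂; _×_; _,_; proj₁; proj₂)
open import Data.Sum using (_⊎_; inj₁; inj₂)
open import Data.Unit using (⊤)
open import Data.Vec using (lookup; tabulate)
open import Data.Vec.Properties using (lookup∘tabulate; tabulate∘lookup; tabulate-cong)
open import Function using (_∘_; id; case_of_; it)
open import Function.Bundles using (_⇔_; mk⇔; Equivalence)
open import Relation.Binary.Definitions using (tri<; tri≈; tri>)
open import Relation.Binary.PropositionalEquality using (_≡_; _≢_; refl; sym; trans; cong; cong₂; subst; subst₂; ≢-sym; setoid)
open import Relation.Nullary using (¬_; Dec; yes; no; does; contradiction)
open import Relation.Nullary.Decidable using (_×-dec_; _⊎-dec_; ¬?; map′; _→-dec_; dec-true; dec-false)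

-- Excluding a cycle needs a statement about every flip, yet the flips are never enumerated. A flip
-- trades one chord for another, so a sum of weights over all chords changes by the difference of
-- two weights, and everything reduces to a rule about the four corners of one quadrilateral. As
-- colours and weights do not tell the red points of the long run apart, this rule is a finite
-- check.
--
-- The Hamilton path needs only a supply of flips, given as tree rotations. Its shape is dictated by
-- where rows and columns can be changed: a cell offers a step in `j` only while the ear AB is
-- closed and a step in `i` only while the ear BC is closed; a hub offers a step in `i` only in the
-- presence of AC, and passes between Aq and pC only in the presence of both AC and pq. Each group
-- of four codes is a 4-cycle that must be left in the right place, which creates the dependence on
-- parity. That a path repeats nothing is not checked vertex by vertex: a list that covers all codes
-- and is no longer than their enumeration has no repetition.

-- Duplicate-free lists up to permutation

module _ {A : Set} where

  remove-∈ : ∀ {x : A} {xs} → x ∈ xs → ∃ λ ys → xs ↭ x ∷ ys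
  remove-∈ x∈xs with ys , zs , refl ← ∈-∃++ x∈xs = ys ++ zs , shift _ ys zs

  ⊆-remove : ∀ {y} {ys xs xs′ : List A} → Unique (y ∷ ys) → (∀ {z} → z ∈ y ∷ ys → z ∈ xs) →
             xs ↭ y ∷ xs′ → ∀ {z} → z ∈ ys → z ∈ xs′
  ⊆-remove u ys⊆xs σ z∈ with ∈-resp-↭ σ (ys⊆xs (there z∈))
  ... | here refl = contradiction z∈ (Uniqueₚ.Unique[x∷xs]⇒x∉xs u)
  ... | there z∈′ = z∈′

  -- The length bound stands in for the converse inclusion: removing the head of `ys` from `xs`
  -- shortens both lists by one, so `xs` is exhausted together with `ys`.
  unique-⊆-↭ : ∀ {ys xs : List A} → Unique ys → (∀ {z} → z ∈ ys → z ∈ xs) →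
               length xs ≤ length ys → ys ↭ xs
  unique-⊆-↭ {[]} {[]} _ _ _ = ↭-refl
  unique-⊆-↭ {y ∷ ys} u@(_ ∷ u′) ys⊆xs len with remove-∈ (ys⊆xs (here refl))
  ... | xs′ , σ = ↭-trans (prep y (unique-⊆-↭ u′ (⊆-remove u ys⊆xs σ)
          (s≤s⁻¹ (subst (_≤ suc (length ys)) (↭-length σ) len)))) (↭-sym σ)

  unique-⊆-length : ∀ {ys xs : List A} → Unique ys → (∀ {z} → z ∈ ys → z ∈ xs) →
                    length ys ≤ length xs
  unique-⊆-length {[]} _ _ = z≤n
  unique-⊆-length {y ∷ ys} u@(_ ∷ u′) ys⊆xs with remove-∈ (ys⊆xs (here refl))
  ... | xs′ , σ = subst (suc (length ys) ≤_) (sym (↭-length σ))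
          (s≤s (unique-⊆-length u′ (⊆-remove u ys⊆xs σ)))

  unique-↭ : ∀ {ys xs : List A} → Unique ys → Unique xs →
             (∀ {z} → z ∈ ys → z ∈ xs) → (∀ {z} → z ∈ xs → z ∈ ys) → ys ↭ xs
  unique-↭ uy ux ys⊆xs xs⊆ys = unique-⊆-↭ uy ys⊆xs (unique-⊆-length ux xs⊆ys)

-- Triangulations of a convex polygon as binary trees

data Tree : Set where
  leaf : Tree
  node : Tree → Tree → Tree

size : Tree → ℕ
size leaf = 1
size (node s r) = size s + size r

0<size : ∀ t → 0 < size t
0<size leaf = s≤s z≤n
0<size (node s r) = ≤-trans (0<size s) (m≤m+n (size s) (size r))

-- A tree rooted at x triangulates the polygon with vertices x, …, x + size t;
-- its leaves are the sides (y , 1 + y) and its root is the side (x , x + size t).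
data Chord : Tree → ℕ → ℕ → ℕ → Set where
  top : ∀ {t x} → Chord t x x (x + size t)
  inl : ∀ {s r x u v} → Chord s x u v → Chord (node s r) x u v
  inr : ∀ {s r x u v} → Chord r (x + size s) u v → Chord (node s r) x u v

end : ∀ x s r → (x + size s) + size r ≡ x + size (node s r)
end x s r = +-assoc x (size s) (size r)

top′ : ∀ {t x v} → x + size t ≡ v → Chord t x x v
top′ refl = top

chord-≥ : ∀ {t x u v} → Chord t x u v → x ≤ u
chord-≥ top = ≤-refl
chord-≥ (inl c) = chord-≥ c
chord-≥ (inr c) = ≤-trans (m≤m+n _ _) (chord-≥ c)

chord-< : ∀ {t x u v} → Chord t x u v → u < v
chord-< {t} {x} top = m<m+n x (0<size t)
chord-< (inl c) = chord-< c
chord-< (inr c) = chord-< c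

chord-≤ : ∀ {t x u v} → Chord t x u v → v ≤ x + size t
chord-≤ top = ≤-refl
chord-≤ {node s r} {x} (inl c) =
  ≤-trans (chord-≤ c) (≤-trans (m≤m+n _ (size r)) (≤-reflexive (end x s r)))
chord-≤ {node s r} {x} (inr c) = ≤-trans (chord-≤ c) (≤-reflexive (end x s r))

mid< : ∀ x s r → x + size s < x + size (node s r)
mid< x s r = subst (x + size s <_) (end x s r) (m<m+n _ (0<size r))

narrow-left : ∀ {s r x u v} → Chord (node s r) x u v → v ≤ x + size s → Chord s x u v
narrow-left {s} {r} {x} top v≤ = contradiction (mid< x s r) (≤⇒≯ v≤)
narrow-left (inl c) v≤ = c
narrow-left (inr c) v≤ = contradiction (chord-< c) (≤⇒≯ (≤-trans v≤ (chord-≥ c)))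

narrow-right : ∀ {s r x u v} → Chord (node s r) x u v → x + size s ≤ u → Chord r (x + size s) u v
narrow-right {s} {r} {x} top ≤u = contradiction (m<m+n x (0<size s)) (≤⇒≯ ≤u)
narrow-right (inl c) ≤u = contradiction (chord-< c) (≤⇒≯ (≤-trans (chord-≤ c) ≤u))
narrow-right (inr c) ≤u = c

tree-noncrossing : ∀ {t x u v p q} → Chord t x u v → Chord t x p q →
                   u < p → p < v → v < q → ⊥
tree-noncrossing top d u<p p<v v<q = ≤⇒≯ (chord-≤ d) v<q
tree-noncrossing (inl c) top u<p p<v v<q = ≤⇒≯ (chord-≥ c) u<p
tree-noncrossing (inl c) (inl d) u<p p<v v<q = tree-noncrossing c d u<p p<v v<q
tree-noncrossing (inl c) (inr d) u<p p<v v<q = ≤⇒≯ (≤-trans (chord-≤ c) (chord-≥ d)) p<v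
tree-noncrossing (inr c) top u<p p<v v<q = ≤⇒≯ (≤-trans (m≤m+n _ _) (chord-≥ c)) u<p
tree-noncrossing (inr c) (inl d) u<p p<v v<q =
  ≤⇒≯ (≤-trans (chord-≤ d) (chord-≥ c)) (<-trans (<-trans u<p p<v) v<q)
tree-noncrossing (inr c) (inr d) u<p p<v v<q = tree-noncrossing c d u<p p<v v<q

Crossing : ℕ → ℕ → ℕ → ℕ → Set
Crossing u v p q = (u < p × p < v × v < q) ⊎ (p < u × u < q × q < v)

chord? : ∀ t x u v → Dec (Chord t x u v)
chord? t x u v with u ≟ x | v ≟ x + size t
chord? t x u v | yes refl | yes refl = yes top
chord? leaf x u v | no u≢ | _ = no λ { top → u≢ refl }
chord? leaf x u v | yes _ | no v≢ = no λ { top → v≢ refl }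
chord? (node s r) x u v | no u≢ | _ with chord? s x u v | chord? r (x + size s) u v
... | yes c | _ = yes (inl c)
... | no _ | yes c = yes (inr c)
... | no ¬l | no ¬r = no λ { top → u≢ refl ; (inl c) → ¬l c ; (inr c) → ¬r c }
chord? (node s r) x u v | yes _ | no v≢ with chord? s x u v | chord? r (x + size s) u v
... | yes c | _ = yes (inl c)
... | no _ | yes c = yes (inr c)
... | no ¬l | no ¬r = no λ { top → v≢ refl ; (inl c) → ¬l c ; (inr c) → ¬r c }

-- A pair on one side of the apex of the root triangle is left to that subtree. A pair that
-- straddles the apex crosses one of the two legs of the root triangle, unless it is the root
-- itself.
tree-maximal : ∀ t {x u v} → x ≤ u → u < v → v ≤ x + size t →
               Chord t x u v ⊎ ∃₂ λ p q → Chord t x p q × Crossing u v p q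
tree-maximal leaf {x} {u} {v} x≤u u<v v≤ =
  inj₁ (subst₂ (Chord leaf x) x≡u x+1≡v top)
  where
  x≡u : x ≡ u
  x≡u = ≤-antisym x≤u (s≤s⁻¹ (≤-trans u<v (subst (v ≤_) (+-comm x 1) v≤)))
  x+1≡v : x + 1 ≡ v
  x+1≡v = ≤-antisym (subst (_≤ v) (+-comm 1 x) (≤-trans (s≤s x≤u) u<v)) v≤
tree-maximal (node s r) {x} {u} {v} x≤u u<v v≤ with v ≤? x + size s
... | yes v≤m with tree-maximal s x≤u u<v v≤m
...   | inj₁ c = inj₁ (inl c)
...   | inj₂ (p , q , c , cr) = inj₂ (p , q , inl c , cr)
tree-maximal (node s r) {x} {u} {v} x≤u u<v v≤ | no v≰m with x + size s ≤? u
... | yes m≤u with tree-maximal r m≤u u<v (subst (v ≤_) (sym (end x s r)) v≤)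
...   | inj₁ c = inj₁ (inr c)
...   | inj₂ (p , q , c , cr) = inj₂ (p , q , inr c , cr)
tree-maximal (node s r) {x} {u} {v} x≤u u<v v≤ | no v≰m | no m≰u with u ≟ x | v ≟ x + size (node s r)
... | yes refl | yes refl = inj₁ top
... | no u≢x | _ = inj₂ (x , x + size s , inl top , inj₂ (≤∧≢⇒< x≤u (≢-sym u≢x) , ≰⇒> m≰u , ≰⇒> v≰m))
... | yes refl | no v≢ =
  inj₂ (x + size s , x + size (node s r) , inr (top′ (end x s r)) ,
        inj₁ (≰⇒> m≰u , ≰⇒> v≰m , ≤∧≢⇒< v≤ v≢))

side-chord : ∀ t {x u} → x ≤ u → u < x + size t → Chord t x u (suc u)
side-chord t {u = u} x≤u u< with tree-maximal t x≤u (n<1+n u) u<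
... | inj₁ c = c
... | inj₂ (p , q , c , inj₁ (u<p , p<v , _)) = contradiction u<p (≤⇒≯ (s≤s⁻¹ p<v))
... | inj₂ (p , q , c , inj₂ (_ , u<q , q<v)) = contradiction u<q (≤⇒≯ (s≤s⁻¹ q<v))

Triangles : (ℕ → ℕ → ℕ → Set) → ℕ → Tree → Set
Triangles P x leaf = ⊤
Triangles P x (node s r) =
  P x (x + size s) (x + size (node s r)) × Triangles P x s × Triangles P (x + size s) r

triangles-intro : ∀ {P} t {x} →
  (∀ {u v w} → Chord t x u v → Chord t x v w → Chord t x u w → P u v w) → Triangles P x t
triangles-intro leaf f = _
triangles-intro (node s r) {x} f =
  f (inl top) (inr (top′ (end x s r))) top ,
  triangles-intro s (λ a b c → f (inl a) (inl b) (inl c)) ,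
  triangles-intro r (λ a b c → f (inr a) (inr b) (inr c))

-- `Triangles` speaks only of the triangles at the nodes of the tree, and there are no others: if
-- the longest chord is the root, the middle corner is squeezed onto the apex from both sides;
-- otherwise the whole triangle lies in the subtree of its longest chord.
triangles-elim : ∀ {P} t {x u v w} → Triangles P x t →
  Chord t x u v → Chord t x v w → Chord t x u w → P u v w
triangles-elim leaf _ top d e = contradiction (chord-≤ d) (<⇒≱ (chord-< d))
triangles-elim {P} (node s r) {x} (p , _ , _) c d top with c | d
... | top | _ = contradiction (chord-≤ d) (<⇒≱ (chord-< d))
... | inr c′ | _ = contradiction (chord-≥ c′) (<⇒≱ (m<m+n x (0<size s)))
... | inl c′ | top = contradiction (chord-< c′) (<-irrefl refl)
... | inl c′ | inl d′ = contradiction (chord-≤ d′) (<⇒≱ (mid< x s r))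
... | inl c′ | inr d′ =
  subst (λ v → P x v (x + size (node s r))) (≤-antisym (chord-≥ d′) (chord-≤ c′)) p
triangles-elim (node s r) (_ , ps , _) c d (inl e) =
  triangles-elim s ps (narrow-left c (≤-trans (<⇒≤ (chord-< d)) (chord-≤ e)))
    (narrow-left d (chord-≤ e)) e
triangles-elim (node s r) (_ , _ , pr) c d (inr e) =
  triangles-elim r pr (narrow-right c (chord-≥ e))
    (narrow-right d (≤-trans (chord-≥ e) (<⇒≤ (chord-< c)))) e

-- If the apexes of the two root triangles differed, a leg of one would cross a leg of the other,
-- and both are chords of `t′`. Once they agree, the inclusion restricts to the subtrees.
chords-injective : ∀ t t′ {x} → size t ≡ size t′ →
  (∀ {u v} → Chord t x u v → Chord t′ x u v) → t ≡ t′
chords-injective leaf leaf _ _ = refl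
chords-injective leaf (node s r) eq _ =
  contradiction (subst (2 ≤_) (sym eq) (+-mono-≤ (0<size s) (0<size r))) λ { (s≤s ()) }
chords-injective (node s r) leaf eq _ =
  contradiction (subst (2 ≤_) eq (+-mono-≤ (0<size s) (0<size r))) λ { (s≤s ()) }
chords-injective (node s r) (node s′ r′) {x} eq f = cong₂ node s≡ r≡
  where
  sizes : size s ≡ size s′
  sizes with <-cmp (size s) (size s′)
  ... | tri≈ _ e _ = e
  ... | tri< s<s′ _ _ = ⊥-elim (tree-noncrossing {node s′ r′} {x}
          (inl top) (subst (Chord _ x _) (cong (x +_) eq) (f (inr (top′ (end x s r)))))
          (m<m+n x (0<size s)) (+-monoʳ-< x s<s′) (mid< x s′ r′))
  ... | tri> _ _ s′<s = ⊥-elim (tree-noncrossing {node s′ r′} {x}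
          (f (inl top)) (inr (top′ (end x s′ r′)))
          (m<m+n x (0<size s′)) (+-monoʳ-< x s′<s)
          (subst (x + size s <_) (cong (x +_) eq) (mid< x s r)))
  r-sizes : size r ≡ size r′
  r-sizes = +-cancelˡ-≡ (size s) _ _ (trans eq (cong (_+ size r′) (sym sizes)))
  s≡ : s ≡ s′
  s≡ = chords-injective s s′ sizes λ c →
         narrow-left (f (inl c)) (≤-trans (chord-≤ c) (≤-reflexive (cong (x +_) sizes)))
  r≡ : r ≡ r′
  r≡ = chords-injective r r′ r-sizes λ {u} {v} c →
         subst (λ m → Chord r′ m u v) (cong (x +_) (sym sizes))
           (narrow-right (f (inr c))
             (≤-trans (≤-reflexive (cong (x +_) (sym sizes))) (chord-≥ c)))

-- Maximal noncrossing relations are the chord sets of trees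

-- Interface between matrices and trees: sides count as chords, and every pair is written in
-- increasing order.
record Planar (N : ℕ) (R : ℕ → ℕ → Set) : Set where
  field
    ordered     : ∀ {u v} → R u v → u < v
    bounded     : ∀ {u v} → R u v → v < N
    sides       : ∀ {u} → suc u < N → R u (suc u)
    closing     : ∀ {v} → 0 < v → suc v ≡ N → R 0 v
    noncrossing : ∀ {u v p q} → R u v → R p q → u < p → p < v → v < q → ⊥
    maximal     : ∀ {u v} → u < v → v < N → R u v ⊎ ∃₂ λ p q → R p q × Crossing u v p q

tree-planar : ∀ {N} t → suc (size t) ≡ N → Planar N (Chord t 0)
tree-planar t refl = record
  { ordered = chord-<
  ; bounded = s≤s ∘ chord-≤
  ; sides = λ u< → side-chord t z≤n (s≤s⁻¹ u<)
  ; closing = λ { _ refl → top }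
  ; noncrossing = tree-noncrossing
  ; maximal = λ u<v v<N → tree-maximal t z≤n u<v (s≤s⁻¹ v<N)
  }

module _ {N R} (P : Planar N R) where
  open Planar P

  -- The apex of the triangle below (x , z) is the last y < z joined to x:
  -- a chord crossing (y , z) would have to end in x and hence improve y.
  apex-from : ∀ k {x y z} → z ≤ y + k → R x z → R x y → y < z →
              ∃ λ m → x < m × m < z × R x m × R m z
  apex-from zero {y = y} z≤ xz xy y<z =
    contradiction y<z (≤⇒≯ (subst (_ ≤_) (+-identityʳ y) z≤))
  apex-from (suc k) {x} {y} {z} z≤ xz xy y<z with maximal y<z (bounded xz)
  ... | inj₁ yz = y , ordered xy , y<z , xy , yz
  ... | inj₂ (p , q , pq , inj₁ (y<p , p<z , z<q)) =
    ⊥-elim (noncrossing xz pq (<-trans (ordered xy) y<p) p<z z<q)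
  ... | inj₂ (p , q , pq , inj₂ (p<y , y<q , q<z)) with <-cmp p x
  ...   | tri< p<x _ _ = ⊥-elim (noncrossing pq xz p<x (<-trans (ordered xy) y<q) q<z)
  ...   | tri> _ _ x<p = ⊥-elim (noncrossing xy pq x<p p<y y<q)
  ...   | tri≈ _ refl _ =
    apex-from k (≤-trans z≤ (≤-trans (≤-reflexive (+-suc y k)) (+-monoˡ-≤ k y<q))) xz pq q<z

  apex : ∀ {x z} → R x z → suc x < z → ∃ λ m → x < m × m < z × R x m × R m z
  apex {x} {z} xz x<z =
    apex-from z (m≤n+m z (suc x)) xz (sides (<-trans x<z (bounded xz))) x<z

  -- Splitting at the apex is not structural, so `k` bounds the width of the chord.
  subtree : ∀ k {x z} → z ≤ x + k → R x z →
            ∃ λ t → x + size t ≡ z × (∀ {u v} → Chord t x u v → R u v)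
  subtree zero {x} z≤ xz = contradiction (ordered xz) (≤⇒≯ (subst (_ ≤_) (+-identityʳ x) z≤))
  subtree (suc k) {x} {z} z≤ xz with suc x <? z
  ... | no x≮z = leaf , x+1≡z , λ { top → subst (R x) (sym x+1≡z) xz }
    where
    x+1≡z : x + 1 ≡ z
    x+1≡z = trans (+-comm x 1) (≤-antisym (ordered xz) (≮⇒≥ x≮z))
  ... | yes x<z with apex xz x<z
  ...   | m , x<m , m<z , xm , mz
    with subtree k (s≤s⁻¹ (≤-trans m<z (subst (z ≤_) (+-suc x k) z≤))) xm
       | subtree k (≤-trans z≤ (≤-trans (≤-reflexive (+-suc x k)) (+-monoˡ-≤ k x<m))) mz
  ...     | s , refl , s⊆ | r , refl , r⊆ = node s r , sym (end x s r) , chords⊆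
    where
    chords⊆ : ∀ {u v} → Chord (node s r) x u v → R u v
    chords⊆ top = subst (R x) (end x s r) xz
    chords⊆ (inl c) = s⊆ c
    chords⊆ (inr c) = r⊆ c

  -- Only one inclusion has to be built. A pair of `R` missing from the tree would cross a chord of
  -- the tree by `tree-maximal`, and that chord lies in `R` too.
  planar-tree : 2 ≤ N → ∃ λ t → suc (size t) ≡ N × (∀ {u v} → Chord t 0 u v → R u v)
                                × (∀ {u v} → R u v → Chord t 0 u v)
  planar-tree 2≤N with subtree N (pred[n]≤n {N}) root
    where
    root : R 0 (pred N)
    root = closing (pred-mono-≤ 2≤N) (suc-pred N {{>-nonZero (≤-trans (s≤s z≤n) 2≤N)}})
  ... | t , eq , t⊆R = t , size≡ , t⊆R , R⊆t
    where
    size≡ : suc (size t) ≡ N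
    size≡ = trans (cong suc eq) (suc-pred N {{>-nonZero (≤-trans (s≤s z≤n) 2≤N)}})
    R⊆t : ∀ {u v} → R u v → Chord t 0 u v
    R⊆t {u} {v} uv with tree-maximal t z≤n (ordered uv) (s≤s⁻¹ (subst (v <_) (sym size≡) (bounded uv)))
    ... | inj₁ c = c
    ... | inj₂ (p , q , c , inj₁ (u<p , p<v , v<q)) = ⊥-elim (noncrossing uv (t⊆R c) u<p p<v v<q)
    ... | inj₂ (p , q , c , inj₂ (p<u , u<q , q<v)) = ⊥-elim (noncrossing (t⊆R c) uv p<u u<q q<v)

-- Triangulation matrices and trees

-- The reflection of labels, stated as a sum rather than by subtraction, so that each fact about it
-- serves in both directions.
Coordinate : ℕ → ℕ → ℕ → Set
Coordinate N m p = m + suc p ≡ N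

module _ {N : ℕ} where

  coordinate-< : ∀ {a b p q} → Coordinate N a p → Coordinate N b q → a < b → q < p
  coordinate-< {a} {b} {p} {q} ap bq a<b = ≰⇒> λ p≤q →
    <-irrefl (trans ap (sym bq)) (+-mono-<-≤ a<b (s≤s p≤q))

  coordinate-suc : ∀ {a b p q} → Coordinate N a p → Coordinate N b q → b ≡ suc a → p ≡ suc q
  coordinate-suc {a} {p = p} {q} ap bq refl =
    suc-injective (+-cancelˡ-≡ a (suc p) (suc (suc q)) (trans ap (trans (sym bq) (sym (+-suc a (suc q))))))

  coordinate-last : ∀ {a p} → Coordinate N a p → suc a ≡ N → p ≡ 0
  coordinate-last {a} {p} ap refl = m+n≡0⇒n≡0 0 (+-cancelˡ-≡ (suc a) p 0
    (trans (sym (+-suc a p)) (trans ap (sym (+-identityʳ (suc a))))))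

from-does : ∀ {A : Set} (d : Dec A) → does d ≡ true → A
from-does (yes a) _ = a

module Geometry {N : ℕ} (2≤N : 2 ≤ N) where
  open Polygon N

  -- Positions are counted backwards from the last vertex, so that the five
  -- vertices after the a red ones get the positions 4, 3, 2, 1, 0 for every a.
  pos : Fin N → ℕ
  pos i = toℕ (opposite i)

  pos-coordinate : ∀ i → Coordinate N (toℕ i) (pos i)
  pos-coordinate i = trans (+-suc (toℕ i) (pos i))
    (trans (cong (suc (toℕ i) +_) (opposite-prop i)) (m+[n∸m]≡n (toℕ<n i)))

  coordinate-pos : ∀ i → Coordinate N (pos i) (toℕ i)
  coordinate-pos i = trans (+-suc (pos i) (toℕ i)) (trans (+-comm (suc (pos i)) (toℕ i)) (pos-coordinate i))

  pos<N : ∀ i → pos i < N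
  pos<N i = toℕ<n (opposite i)

  pos-injective : ∀ {i j} → pos i ≡ pos j → i ≡ j
  pos-injective {i} {j} eq = trans (sym (opposite-involutive i))
    (trans (cong opposite (toℕ-injective eq)) (opposite-involutive j))

  vertex : ∀ {p} → p < N → ∃ λ i → pos i ≡ p
  vertex p<N = opposite (fromℕ< p<N) ,
    trans (cong toℕ (opposite-involutive (fromℕ< p<N))) (toℕ-fromℕ< p<N)

  SideP : ℕ → ℕ → Set
  SideP p q = (q ≡ suc p) ⊎ (p ≡ suc q) ⊎ ((p ≡ 0) × (suc q ≡ N)) ⊎ ((q ≡ 0) × (suc p ≡ N))

  reflect-side : ∀ {a b p q} → Coordinate N a p → Coordinate N b q → SideP a b → SideP p q
  reflect-side ap bq (inj₁ e) = inj₂ (inj₁ (coordinate-suc ap bq e))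
  reflect-side ap bq (inj₂ (inj₁ e)) = inj₁ (coordinate-suc bq ap e)
  reflect-side ap bq (inj₂ (inj₂ (inj₁ (refl , e)))) = inj₂ (inj₂ (inj₂ (coordinate-last bq e , ap)))
  reflect-side ap bq (inj₂ (inj₂ (inj₂ (refl , e)))) = inj₂ (inj₂ (inj₁ (coordinate-last ap e , bq)))

  side-pos : ∀ {i j} → Side i j → SideP (pos i) (pos j)
  side-pos = reflect-side (pos-coordinate _) (pos-coordinate _)

  pos-side : ∀ {i j} → SideP (pos i) (pos j) → Side i j
  pos-side = reflect-side (coordinate-pos _) (coordinate-pos _)

  side-sym : ∀ {i j} → Side i j → Side j i
  side-sym (inj₁ e) = inj₂ (inj₁ e)
  side-sym (inj₂ (inj₁ e)) = inj₁ e
  side-sym (inj₂ (inj₂ (inj₁ e))) = inj₂ (inj₂ (inj₂ e))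
  side-sym (inj₂ (inj₂ (inj₂ e))) = inj₂ (inj₂ (inj₁ e))

  side? : ∀ i j → Dec (Side i j)
  side? i j = (toℕ j ≟ suc (toℕ i)) ⊎-dec (toℕ i ≟ suc (toℕ j))
    ⊎-dec ((toℕ i ≟ 0) ×-dec (suc (toℕ j) ≟ N)) ⊎-dec ((toℕ j ≟ 0) ×-dec (suc (toℕ i) ≟ N))

  side-uncrossed : ∀ {u v p q} → p < N → q < N → u < v → p < q → SideP u v → ¬ Crossing u v p q
  side-uncrossed _ _ _ _ (inj₁ refl) (inj₁ (u<p , p<v , _)) = ≤⇒≯ (s≤s⁻¹ p<v) u<p
  side-uncrossed _ _ _ _ (inj₁ refl) (inj₂ (_ , u<q , q<v)) = ≤⇒≯ (s≤s⁻¹ q<v) u<q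
  side-uncrossed _ _ u<v _ (inj₂ (inj₁ refl)) _ = <-asym u<v (n<1+n _)
  side-uncrossed _ q<N _ _ (inj₂ (inj₂ (inj₁ (refl , refl)))) (inj₁ (_ , _ , v<q)) = ≤⇒≯ (s≤s⁻¹ q<N) v<q
  side-uncrossed _ _ _ _ (inj₂ (inj₂ (inj₁ (refl , refl)))) (inj₂ (() , _))
  side-uncrossed _ _ () _ (inj₂ (inj₂ (inj₂ (refl , _)))) _

  crossing-sym : ∀ {u v p q} → Crossing u v p q → Crossing p q u v
  crossing-sym (inj₁ c) = inj₂ c
  crossing-sym (inj₂ c) = inj₁ c

  BetweenP : ℕ → ℕ → ℕ → Set
  BetweenP p q x = (p < x × x < q) ⊎ (q < x × x < p)

  reflect-between : ∀ {a b c p q x} → Coordinate N a p → Coordinate N b q → Coordinate N c x →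
                    BetweenP a b c → BetweenP p q x
  reflect-between ap bq cx (inj₁ (l , r)) = inj₂ (coordinate-< cx bq r , coordinate-< ap cx l)
  reflect-between ap bq cx (inj₂ (l , r)) = inj₁ (coordinate-< cx ap r , coordinate-< bq cx l)

  between-pos : ∀ {i j x} → Between i j x → BetweenP (pos i) (pos j) (pos x)
  between-pos = reflect-between (pos-coordinate _) (pos-coordinate _) (pos-coordinate _)

  pos-between : ∀ {i j x} → BetweenP (pos i) (pos j) (pos x) → Between i j x
  pos-between = reflect-between (coordinate-pos _) (coordinate-pos _) (coordinate-pos _)

  pos-≢ : ∀ {i j} → i ≢ j → pos i ≢ pos j
  pos-≢ i≢j = i≢j ∘ pos-injective

  private
    between′ : ∀ {i j x} → pos i < pos j → Between i j x → pos i < pos x × pos x < pos j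
    between′ i<j b with between-pos b
    ... | inj₁ c = c
    ... | inj₂ (j<x , x<i) = contradiction (<-trans j<x x<i) (<-asym i<j)

  cross-crossing : ∀ {i j k l} → pos i < pos j → pos k < pos l → Cross i j k l →
                   Crossing (pos i) (pos j) (pos k) (pos l)
  cross-crossing i<j k<l (k≢i , k≢j , l≢i , l≢j , inj₁ (bk , ¬bl)) with between′ i<j bk
  ... | i<k , k<j = inj₁ (i<k , k<j , ≤∧≢⇒<
    (≮⇒≥ λ l<j → ¬bl (pos-between (inj₁ (<-trans i<k k<l , l<j)))) (pos-≢ (≢-sym l≢j)))
  cross-crossing i<j k<l (k≢i , k≢j , l≢i , l≢j , inj₂ (¬bk , bl)) with between′ i<j bl
  ... | i<l , l<j = inj₂ (≤∧≢⇒<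
    (≮⇒≥ λ i<k → ¬bk (pos-between (inj₁ (i<k , <-trans k<l l<j)))) (pos-≢ k≢i) , i<l , l<j)

  crossing-cross : ∀ {i j k l} → Crossing (pos i) (pos j) (pos k) (pos l) → Cross i j k l
  crossing-cross {i} {j} {k} {l} (inj₁ (i<k , k<j , j<l)) =
    (λ { refl → <-irrefl refl i<k }) , (λ { refl → <-irrefl refl k<j }) ,
    (λ { refl → <-asym i<j j<l }) , (λ { refl → <-irrefl refl j<l }) ,
    inj₁ (pos-between (inj₁ (i<k , k<j)) , λ b → <-asym j<l (proj₂ (between′ i<j b)))
    where i<j = <-trans i<k k<j
  crossing-cross {i} {j} {k} {l} (inj₂ (k<i , i<l , l<j)) =
    (λ { refl → <-irrefl refl k<i }) , (λ { refl → <-asym i<j k<i }) ,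
    (λ { refl → <-irrefl refl i<l }) , (λ { refl → <-irrefl refl l<j }) ,
    inj₂ ((λ b → <-asym k<i (proj₁ (between′ i<j b))) , pos-between (inj₁ (i<l , l<j)))
    where i<j = <-trans i<l l<j

  cross-flipˡ : ∀ {i j k l} → Cross i j k l → Cross j i k l
  cross-flipˡ (k≢i , k≢j , l≢i , l≢j , c) = k≢j , k≢i , l≢j , l≢i , flip c
    where
    swap : ∀ {i j x} → Between i j x → Between j i x
    swap (inj₁ b) = inj₂ b
    swap (inj₂ b) = inj₁ b
    flip : ∀ {i j k l} → (Between i j k × ¬ Between i j l) ⊎ (¬ Between i j k × Between i j l) →
           (Between j i k × ¬ Between j i l) ⊎ (¬ Between j i k × Between j i l)
    flip (inj₁ (b , ¬b)) = inj₁ (swap b , ¬b ∘ swap)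
    flip (inj₂ (¬b , b)) = inj₂ (¬b ∘ swap , swap b)

  cross-flipʳ : ∀ {i j k l} → Cross i j k l → Cross i j l k
  cross-flipʳ (k≢i , k≢j , l≢i , l≢j , inj₁ (b , ¬b)) = l≢i , l≢j , k≢i , k≢j , inj₂ (¬b , b)
  cross-flipʳ (k≢i , k≢j , l≢i , l≢j , inj₂ (¬b , b)) = l≢i , l≢j , k≢i , k≢j , inj₁ (b , ¬b)

  compare-pos : ∀ {i j} → i ≢ j → pos i < pos j ⊎ pos j < pos i
  compare-pos {i} {j} i≢j with <-cmp (pos i) (pos j)
  ... | tri< i<j _ _ = inj₁ i<j
  ... | tri≈ _ e _ = contradiction (pos-injective e) i≢j
  ... | tri> _ _ j<i = inj₂ j<i

  EdgeP : Mat → ℕ → ℕ → Set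
  EdgeP M u v = ∃₂ λ i j → pos i ≡ u × pos j ≡ v × u < v × Edge M i j

  triangulation-planar : ∀ {M} → Triangulation M → Planar N (EdgeP M)
  triangulation-planar {M} T = record
    { ordered = λ { (_ , _ , _ , _ , u<v , _) → u<v }
    ; bounded = λ { (_ , j , _ , refl , _) → pos<N j }
    ; sides = sides
    ; closing = closing
    ; noncrossing = noncr
    ; maximal = maxim
    }
    where
    open Triangulation T
    sides : ∀ {u} → suc u < N → EdgeP M u (suc u)
    sides u<N with vertex (<-trans (n<1+n _) u<N) | vertex u<N
    ... | i , refl | j , e = i , j , refl , e , n<1+n _ , inj₁ (pos-side (inj₁ e))
    closing : ∀ {v} → 0 < v → suc v ≡ N → EdgeP M 0 v
    closing 0<v v+1≡N with vertex (≤-trans (s≤s z≤n) 2≤N) | vertex (≤-reflexive v+1≡N)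
    ... | i , e | j , refl = i , j , e , refl , 0<v , inj₁ (pos-side (inj₂ (inj₂ (inj₁ (e , v+1≡N)))))
    noncr : ∀ {u v p q} → EdgeP M u v → EdgeP M p q → u < p → p < v → v < q → ⊥
    noncr (i , j , refl , refl , i<j , inj₁ s) (k , l , refl , refl , k<l , _) a b c =
      side-uncrossed (pos<N k) (pos<N l) i<j k<l (side-pos s) (inj₁ (a , b , c))
    noncr (i , j , refl , refl , i<j , _) (k , l , refl , refl , k<l , inj₁ s) a b c =
      side-uncrossed (pos<N i) (pos<N j) k<l i<j (side-pos s) (inj₂ (a , b , c))
    noncr (i , j , refl , refl , i<j , inj₂ e) (k , l , refl , refl , k<l , inj₂ e′) a b c =
      noncrossing i j k l e e′ (crossing-cross (inj₁ (a , b , c)))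
    maxim : ∀ {u v} → u < v → v < N →
            EdgeP M u v ⊎ ∃₂ λ p q → EdgeP M p q × Crossing u v p q
    maxim u<v v<N with vertex (<-trans u<v v<N) | vertex v<N
    -- Sides and diagonals of `M` are decidable, which turns the negative hypothesis of `maximal`
    -- into a disjunction.
    ... | i , refl | j , refl with side? i j | lookup (lookup M i) j ≟ᵇ true
    ...   | yes s | _ = inj₁ (i , j , refl , refl , u<v , inj₁ s)
    ...   | no _ | yes e = inj₁ (i , j , refl , refl , u<v , inj₂ e)
    ...   | no ¬s | no ¬e with maximal i j ((λ { refl → <-irrefl refl u<v }) , ¬s) ¬e
    ...     | k , l , e , c with compare-pos (proj₁ (diagonals k l e))
    ...       | inj₁ k<l = inj₂ (pos k , pos l , (k , l , refl , refl , k<l , inj₂ e) ,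
                                 cross-crossing u<v k<l c)
    ...       | inj₂ l<k = inj₂ (pos l , pos k , (l , k , refl , refl , l<k , inj₂ (symmetric k l e)) ,
                                 cross-crossing u<v l<k (cross-flipʳ c))

  Link : Tree → Fin N → Fin N → Set
  Link t i j = Chord t 0 (pos i) (pos j) ⊎ Chord t 0 (pos j) (pos i)

  link-sym : ∀ {t i j} → Link t i j → Link t j i
  link-sym (inj₁ c) = inj₂ c
  link-sym (inj₂ c) = inj₁ c

  link-chord : ∀ {t i j} → Link t i j → pos i < pos j → Chord t 0 (pos i) (pos j)
  link-chord (inj₁ c) _ = c
  link-chord (inj₂ c) i<j = contradiction (chord-< c) (<-asym i<j)

  link-≢ : ∀ {t i j} → Link t i j → i ≢ j
  link-≢ (inj₁ c) refl = <-irrefl refl (chord-< c)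
  link-≢ (inj₂ c) refl = <-irrefl refl (chord-< c)

  diagonal? : ∀ t i j → Dec (Link t i j × ¬ Side i j)
  diagonal? t i j =
    (chord? t 0 (pos i) (pos j) ⊎-dec chord? t 0 (pos j) (pos i)) ×-dec ¬? (side? i j)

  matOf : Tree → Mat
  matOf t = tabulate λ i → tabulate λ j → does (diagonal? t i j)

  lookup-matOf : ∀ t i j → lookup (lookup (matOf t) i) j ≡ does (diagonal? t i j)
  lookup-matOf t i j = trans (cong (λ row → lookup row j) (lookup∘tabulate _ i)) (lookup∘tabulate _ j)

  E-link : ∀ {t i j} → E (matOf t) i j → Link t i j × ¬ Side i j
  E-link {t} {i} {j} e = from-does (diagonal? t i j) (trans (sym (lookup-matOf t i j)) e)

  link-E : ∀ {t i j} → Link t i j → ¬ Side i j → E (matOf t) i j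
  link-E {t} {i} {j} d ¬s = trans (lookup-matOf t i j) (dec-true (diagonal? t i j) (d , ¬s))

  matOf-unique : ∀ {M t} → (∀ {i j} → E M i j → Link t i j × ¬ Side i j) →
                 (∀ {i j} → Link t i j → ¬ Side i j → E M i j) → M ≡ matOf t
  matOf-unique {M} {t} to from = trans (sym (tabulate∘lookup M)) (tabulate-cong λ i →
    trans (sym (tabulate∘lookup (lookup M i))) (tabulate-cong λ j → entry i j))
    where
    entry : ∀ i j → lookup (lookup M i) j ≡ does (diagonal? t i j)
    entry i j with lookup (lookup M i) j in eq
    ... | true = sym (dec-true (diagonal? t i j) (to eq))
    ... | false = sym (dec-false (diagonal? t i j) λ { (d , ¬s) →
                    contradiction (trans (sym eq) (from d ¬s)) λ () })

  module _ {t : Tree} (size≡ : suc (size t) ≡ N) where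

    side-link : ∀ {i j} → Side i j → Link t i j
    side-link {i} {j} s with side-pos s
    ... | inj₁ e = inj₁ (subst (Chord t 0 (pos i)) (sym e)
                     (Planar.sides (tree-planar t size≡) (subst (_< N) e (pos<N j))))
    ... | inj₂ (inj₁ e) = inj₂ (subst (Chord t 0 (pos j)) (sym e)
                     (Planar.sides (tree-planar t size≡) (subst (_< N) e (pos<N i))))
    ... | inj₂ (inj₂ (inj₁ (e , e′))) = inj₁ (subst (λ p → Chord t 0 p (pos j)) (sym e)
                     (top′ (suc-injective (trans size≡ (sym e′)))))
    ... | inj₂ (inj₂ (inj₂ (e , e′))) = inj₂ (subst (λ p → Chord t 0 p (pos i)) (sym e)
                     (top′ (suc-injective (trans size≡ (sym e′)))))

    edge-link : ∀ {i j} → Edge (matOf t) i j → Link t i j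
    edge-link (inj₁ s) = side-link s
    edge-link (inj₂ e) = proj₁ (E-link e)

    link-edge : ∀ {i j} → Link t i j → Edge (matOf t) i j
    link-edge {i} {j} d with side? i j
    ... | yes s = inj₁ s
    ... | no ¬s = inj₂ (link-E d ¬s)

    matOf-triangulation : Triangulation (matOf t)
    matOf-triangulation = record
      { symmetric = λ i j e → let (d , ¬s) = E-link e in link-E (link-sym d) (¬s ∘ side-sym)
      ; diagonals = λ i j e → let (d , ¬s) = E-link e in link-≢ d , ¬s
      ; noncrossing = λ i j k l e e′ → links-noncrossing (proj₁ (E-link e)) (proj₁ (E-link e′))
      ; maximal = λ { i j (i≢j , ¬s) ¬e → maxim i j i≢j ¬s ¬e }
      }
      where
      chords-noncrossing : ∀ {i j k l} → Chord t 0 (pos i) (pos j) → Chord t 0 (pos k) (pos l) →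
                           ¬ Cross i j k l
      chords-noncrossing c d cr with cross-crossing (chord-< c) (chord-< d) cr
      ... | inj₁ (a , b , e) = tree-noncrossing c d a b e
      ... | inj₂ (a , b , e) = tree-noncrossing d c a b e
      links-noncrossing : ∀ {i j k l} → Link t i j → Link t k l → ¬ Cross i j k l
      links-noncrossing (inj₁ c) (inj₁ d) = chords-noncrossing c d
      links-noncrossing (inj₂ c) (inj₁ d) = chords-noncrossing c d ∘ cross-flipˡ
      links-noncrossing (inj₁ c) (inj₂ d) = chords-noncrossing c d ∘ cross-flipʳ
      links-noncrossing (inj₂ c) (inj₂ d) = chords-noncrossing c d ∘ cross-flipˡ ∘ cross-flipʳ
      oriented : ∀ i j → pos i < pos j → ¬ Side i j → ¬ E (matOf t) i j →
                 ∃ λ k → ∃ λ l → E (matOf t) k l × Cross i j k l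
      oriented i j i<j ¬s ¬e with Planar.maximal (tree-planar t size≡) i<j (pos<N j)
      ... | inj₁ c = contradiction (link-E (inj₁ c) ¬s) ¬e
      ... | inj₂ (p , q , c , cr)
        with q<N ← Planar.bounded (tree-planar t size≡) c
        with vertex (<-trans (chord-< c) q<N) | vertex q<N
      ...   | k , refl | l , refl = k , l , link-E (inj₁ c) (λ s →
                side-uncrossed (pos<N i) (pos<N j) (chord-< c) i<j (side-pos s) (crossing-sym cr)) ,
                crossing-cross cr
      maxim : ∀ i j → i ≢ j → ¬ Side i j → ¬ E (matOf t) i j →
              ∃ λ k → ∃ λ l → E (matOf t) k l × Cross i j k l
      maxim i j i≢j ¬s ¬e with compare-pos i≢j
      ... | inj₁ i<j = oriented i j i<j ¬s ¬e
      ... | inj₂ j<i with oriented j i j<i (¬s ∘ side-sym)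
                       (λ e → ¬e (let (d , ¬s′) = E-link e in link-E (link-sym d) (¬s′ ∘ side-sym)))
      ...   | k , l , e , c = k , l , e , cross-flipˡ c

  triangulation-tree : ∀ {M} → Triangulation M → ∃ λ t → suc (size t) ≡ N × M ≡ matOf t
  triangulation-tree {M} T with planar-tree (triangulation-planar T) 2≤N
  ... | t , size≡ , t⊆M , M⊆t = t , size≡ , matOf-unique to from
    where
    open Triangulation T
    to : ∀ {i j} → E M i j → Link t i j × ¬ Side i j
    to {i} {j} e with diagonals i j e
    ... | i≢j , ¬s with compare-pos i≢j
    ...   | inj₁ i<j = inj₁ (M⊆t (i , j , refl , refl , i<j , inj₂ e)) , ¬s
    ...   | inj₂ j<i = inj₂ (M⊆t (j , i , refl , refl , j<i , inj₂ (symmetric i j e))) , ¬s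
    from′ : ∀ {i j} → Chord t 0 (pos i) (pos j) → ¬ Side i j → E M i j
    from′ c ¬s with t⊆M c
    ... | i′ , j′ , ei , ej , _ , edge with pos-injective ei | pos-injective ej
    from′ c ¬s | _ , _ , _ , _ , _ , inj₁ s | refl | refl = contradiction s ¬s
    from′ c ¬s | _ , _ , _ , _ , _ , inj₂ e | refl | refl = e
    from : ∀ {i j} → Link t i j → ¬ Side i j → E M i j
    from (inj₁ c) ¬s = from′ c ¬s
    from {i} {j} (inj₂ c) ¬s = symmetric j i (from′ c (¬s ∘ side-sym))

  matOf-injective : ∀ {t t′} → suc (size t) ≡ N → suc (size t′) ≡ N → matOf t ≡ matOf t′ → t ≡ t′
  matOf-injective {t} {t′} size≡ size′≡ eq =
    chords-injective t t′ (suc-injective (trans size≡ (sym size′≡))) chords⊆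
    where
    chords⊆ : ∀ {u v} → Chord t 0 u v → Chord t′ 0 u v
    chords⊆ {u} {v} c
      with v<N ← Planar.bounded (tree-planar t size≡) c
      with vertex (<-trans (chord-< c) v<N) | vertex v<N
    ... | i , refl | j , refl =
      link-chord (edge-link size′≡ (subst (λ M → Edge M i j) eq (link-edge size≡ (inj₁ c)))) (chord-< c)

-- Flips as exchanges of chords of trees

-- A flip seen on positions `x < u < y < v`. It is directed: the removed diagonal is the one at the
-- least corner, and a flip the other way is a `Quad` with the trees interchanged.
record Quad (o : ℕ) (t t′ : Tree) : Set where
  field
    {x u y v} : ℕ
    x<u : x < u
    u<y : u < y
    y<v : y < v
    xu : Chord t o x u
    uy : Chord t o u y
    yv : Chord t o y v
    xv : Chord t o x v
    xy : Chord t o x y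
    uv : Chord t′ o u v
    forward  : ∀ {p q} → Chord t o p q → (p ≡ x × q ≡ y) ⊎ Chord t′ o p q
    backward : ∀ {p q} → Chord t′ o p q → (p ≡ u × q ≡ v) ⊎ Chord t o p q

  xy∉ : ¬ Chord t′ o x y
  xy∉ c = tree-noncrossing c uv x<u u<y y<v

  uv∉ : ¬ Chord t o u v
  uv∉ c = tree-noncrossing xy c x<u u<y y<v

  private
    keep : ∀ {p q} → Chord t o p q → p ≢ x ⊎ q ≢ y → Chord t′ o p q
    keep c ne with forward c
    ... | inj₂ d = d
    keep c (inj₁ p≢) | inj₁ (p≡ , _) = contradiction p≡ p≢
    keep c (inj₂ q≢) | inj₁ (_ , q≡) = contradiction q≡ q≢

  xu′ : Chord t′ o x u
  xu′ = keep xu (inj₂ (<⇒≢ u<y))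
  uy′ : Chord t′ o u y
  uy′ = keep uy (inj₁ (≢-sym (<⇒≢ x<u)))
  yv′ : Chord t′ o y v
  yv′ = keep yv (inj₁ (≢-sym (<⇒≢ (<-trans x<u u<y))))
  xv′ : Chord t′ o x v
  xv′ = keep xv (inj₂ (≢-sym (<⇒≢ y<v)))

data Rot : Tree → Tree → Set where
  assoc : ∀ {a b c} → Rot (node (node a b) c) (node a (node b c))
  left  : ∀ {s s′ r} → Rot s s′ → Rot (node s r) (node s′ r)
  right : ∀ {s r r′} → Rot r r′ → Rot (node s r) (node s r′)

rot-size : ∀ {t t′} → Rot t t′ → size t ≡ size t′
rot-size (assoc {a} {b} {c}) = +-assoc (size a) (size b) (size c)
rot-size (left {r = r} ρ) = cong (_+ size r) (rot-size ρ)
rot-size (right {s = s} ρ) = cong (size s +_) (rot-size ρ)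

move : ∀ {t o o′ p q} → o ≡ o′ → Chord t o p q → Chord t o′ p q
move refl c = c

-- The corners are the starting positions of the three subtrees that `assoc` regroups and the end of
-- the last one.
rot-quad : ∀ {t t′ o} → Rot t t′ → Quad o t t′
rot-quad {o = o} ρ@(assoc {a} {b} {c}) = record
  { x<u = m<m+n o (0<size a)
  ; u<y = mid< o a b
  ; y<v = mid< o (node a b) c
  ; xu = inl (inl top)
  ; uy = inl (inr (top′ (end o a b)))
  ; yv = inr (top′ (end o (node a b) c))
  ; xv = top
  ; xy = inl top
  ; uv = inr (top′ (trans (end o a (node b c)) (cong (o +_) (sym (rot-size ρ)))))
  ; forward = λ
    { top → inj₂ (top′ (cong (o +_) (sym (rot-size ρ))))
    ; (inl top) → inj₁ (refl , refl)
    ; (inl (inl d)) → inj₂ (inl d)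
    ; (inl (inr d)) → inj₂ (inr (inl d))
    ; (inr d) → inj₂ (inr (inr (move (sym (end o a b)) d)))
    }
  ; backward = λ
    { top → inj₂ (top′ (cong (o +_) (rot-size ρ)))
    ; (inl d) → inj₂ (inl (inl d))
    ; (inr top) → inj₁ (refl , trans (end o a (node b c)) (cong (o +_) (sym (rot-size ρ))))
    ; (inr (inl d)) → inj₂ (inl (inr d))
    ; (inr (inr d)) → inj₂ (inr (move (end o a b) d))
    }
  }
rot-quad {o = o} (left {s} {s′} {r} ρ) = record
  { x<u = x<u ; u<y = u<y ; y<v = y<v
  ; xu = inl xu ; uy = inl uy ; yv = inl yv ; xv = inl xv ; xy = inl xy ; uv = inl uv
  ; forward = λ
    { top → inj₂ (top′ (cong (o +_) (sym sizes)))
    ; (inl d) → case forward d of λ { (inj₁ e) → inj₁ e ; (inj₂ d′) → inj₂ (inl d′) }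
    ; (inr d) → inj₂ (inr (move (cong (o +_) (rot-size ρ)) d))
    }
  ; backward = λ
    { top → inj₂ (top′ (cong (o +_) sizes))
    ; (inl d) → case backward d of λ { (inj₁ e) → inj₁ e ; (inj₂ d′) → inj₂ (inl d′) }
    ; (inr d) → inj₂ (inr (move (cong (o +_) (sym (rot-size ρ))) d))
    }
  }
  where
  open Quad (rot-quad {o = o} ρ)
  sizes = rot-size (left {r = r} ρ)
rot-quad {o = o} (right {s} {r} {r′} ρ) = record
  { x<u = x<u ; u<y = u<y ; y<v = y<v
  ; xu = inr xu ; uy = inr uy ; yv = inr yv ; xv = inr xv ; xy = inr xy ; uv = inr uv
  ; forward = λ
    { top → inj₂ (top′ (cong (o +_) (sym sizes)))
    ; (inl d) → inj₂ (inl d)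
    ; (inr d) → case forward d of λ { (inj₁ e) → inj₁ e ; (inj₂ d′) → inj₂ (inr d′) }
    }
  ; backward = λ
    { top → inj₂ (top′ (cong (o +_) sizes))
    ; (inl d) → inj₂ (inl d)
    ; (inr d) → case backward d of λ { (inj₁ e) → inj₁ e ; (inj₂ d′) → inj₂ (inr d′) }
    }
  }
  where
  open Quad (rot-quad {o = o + size s} ρ)
  sizes = rot-size (right {s = s} ρ)

-- Translation between `Flip` and `Quad`

module Flips {N : ℕ} (2≤N : 2 ≤ N) where
  open Polygon N
  open Geometry 2≤N

  -- A `Quad` without order: points in place of positions, symmetric in `i`, `j` and in `k`, `l`, as
  -- `Flip` is stated.
  record Exchange (t t′ : Tree) (i j k l : Fin N) : Set where
    field
      ij : Link t i j
      ik : Link t i k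
      jk : Link t j k
      il : Link t i l
      jl : Link t j l
      kl : Link t′ k l
      ij∉ : ¬ Link t′ i j
      forward  : ∀ {p q} → Link t p q → SamePair p q i j ⊎ Link t′ p q
      backward : ∀ {p q} → Link t′ p q → SamePair p q k l ⊎ Link t p q

  exchange-swapˡ : ∀ {t t′ i j k l} → Exchange t t′ i j k l → Exchange t t′ j i k l
  exchange-swapˡ X = record
    { ij = link-sym ij ; ik = jk ; jk = ik ; il = jl ; jl = il ; kl = kl ; ij∉ = ij∉ ∘ link-sym
    ; forward = λ d → case forward d of λ
        { (inj₁ (inj₁ e)) → inj₁ (inj₂ e) ; (inj₁ (inj₂ e)) → inj₁ (inj₁ e) ; (inj₂ d′) → inj₂ d′ }
    ; backward = backward
    }
    where open Exchange X

  exchange-swapʳ : ∀ {t t′ i j k l} → Exchange t t′ i j k l → Exchange t t′ i j l k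
  exchange-swapʳ X = record
    { ij = ij ; ik = il ; jk = jl ; il = ik ; jl = jk ; kl = link-sym kl ; ij∉ = ij∉
    ; forward = forward
    ; backward = λ d → case backward d of λ
        { (inj₁ (inj₁ e)) → inj₁ (inj₂ e) ; (inj₁ (inj₂ e)) → inj₁ (inj₁ e) ; (inj₂ d′) → inj₂ d′ }
    }
    where open Exchange X

  exchange-flip : ∀ {t t′ i j k l} → suc (size t) ≡ N → suc (size t′) ≡ N →
                  Exchange t t′ i j k l → ¬ Link t k l → Flip (matOf t) (matOf t′)
  exchange-flip {t} {t′} {i} {j} {k} {l} size≡ size′≡ X kl∉ =
    i , j , k , l , link-E ij ¬side-ij ,
    (link-≢ ij , link-≢ jk , link-≢ ik , link-edge size≡ ij , link-edge size≡ jk , link-edge size≡ ik) ,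
    (link-≢ ij , link-≢ jl , link-≢ il , link-edge size≡ ij , link-edge size≡ jl , link-edge size≡ il) ,
    link-≢ kl , λ x y → mk⇔ to from
    where
    open Exchange X
    ¬side-ij : ¬ Side i j
    ¬side-ij = ij∉ ∘ side-link size′≡
    ¬side-kl : ¬ Side k l
    ¬side-kl = kl∉ ∘ side-link size≡
    to : ∀ {x y} → E (matOf t′) x y → (E (matOf t) x y × ¬ SamePair x y i j) ⊎ SamePair x y k l
    to e with E-link e
    ... | d , ¬s with backward d
    ...   | inj₁ same = inj₂ same
    ...   | inj₂ d′ = inj₁ (link-E d′ ¬s , λ
              { (inj₁ (refl , refl)) → ij∉ d ; (inj₂ (refl , refl)) → ij∉ (link-sym d) })
    from : ∀ {x y} → (E (matOf t) x y × ¬ SamePair x y i j) ⊎ SamePair x y k l → E (matOf t′) x y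
    from (inj₁ (e , ≢ij)) with E-link e
    ... | d , ¬s with forward d
    ...   | inj₁ same = contradiction same ≢ij
    ...   | inj₂ d′ = link-E d′ ¬s
    from (inj₂ (inj₁ (refl , refl))) = link-E kl ¬side-kl
    from (inj₂ (inj₂ (refl , refl))) = link-E (link-sym kl) (¬side-kl ∘ side-sym)

  link-chords : ∀ {t t′ i j} → (∀ {p q} → Chord t 0 p q → (p ≡ pos i × q ≡ pos j) ⊎ Chord t′ 0 p q) →
                ∀ {x y} → Link t x y → SamePair x y i j ⊎ Link t′ x y
  link-chords f (inj₁ c) with f c
  ... | inj₁ (e , e′) = inj₁ (inj₁ (pos-injective e , pos-injective e′))
  ... | inj₂ d = inj₂ (inj₁ d)
  link-chords f (inj₂ c) with f c
  ... | inj₁ (e , e′) = inj₁ (inj₂ (pos-injective e′ , pos-injective e))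
  ... | inj₂ d = inj₂ (inj₂ d)

  quad-flips : ∀ {t t′} → suc (size t) ≡ N → suc (size t′) ≡ N → Quad 0 t t′ →
               Flip (matOf t) (matOf t′) × Flip (matOf t′) (matOf t)
  quad-flips {t} {t′} size≡ size′≡ Q
    with v<N ← Planar.bounded (tree-planar t size≡) (Quad.xv Q)
    with y<N ← <-trans (Quad.y<v Q) v<N
    with u<N ← <-trans (Quad.u<y Q) y<N
    with vertex (<-trans (Quad.x<u Q) u<N) | vertex u<N | vertex y<N | vertex v<N
  ... | i , refl | k , refl | j , refl | l , refl =
    exchange-flip size≡ size′≡ record
      { ij = inj₁ xy ; ik = inj₁ xu ; jk = inj₂ uy ; il = inj₁ xv ; jl = inj₁ yv ; kl = inj₁ uv
      ; ij∉ = ij∉ ; forward = link-chords forward ; backward = link-chords backward } kl∉ ,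
    exchange-flip size′≡ size≡ record
      { ij = inj₁ uv ; ik = inj₂ xu′ ; jk = inj₂ xv′ ; il = inj₁ uy′ ; jl = inj₂ yv′ ; kl = inj₁ xy
      ; ij∉ = kl∉ ; forward = link-chords backward ; backward = link-chords forward } ij∉
    where
    open Quad Q
    ij∉ : ¬ Link t′ i j
    ij∉ d = xy∉ (link-chord d (<-trans x<u u<y))
    kl∉ : ¬ Link t k l
    kl∉ d = uv∉ (link-chord d (<-trans u<y y<v))

  flip-exchange : ∀ {t t′} → suc (size t) ≡ N → suc (size t′) ≡ N → Flip (matOf t) (matOf t′) →
                  ∃₂ λ i j → ∃₂ λ k l → Exchange t t′ i j k l
  flip-exchange {t} {t′} size≡ size′≡
    (i , j , k , l , eij , (i≢j , j≢k , i≢k , _ , jk , ik) , (_ , j≢l , i≢l , _ , jl , il) , k≢l , iff) =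
    i , j , k , l , record
      { ij = proj₁ (E-link eij)
      ; ik = edge-link size≡ ik ; jk = edge-link size≡ jk
      ; il = edge-link size≡ il ; jl = edge-link size≡ jl
      ; kl = proj₁ (E-link e′kl) ; ij∉ = ij∉
      ; forward = forward ; backward = backward }
    where
    M→M′ = λ {x} {y} → Equivalence.from (iff x y)
    M′→M = λ {x} {y} → Equivalence.to (iff x y)
    e′kl : E (matOf t′) k l
    e′kl = M→M′ (inj₂ (inj₁ (refl , refl)))
    ij∉ : ¬ Link t′ i j
    ij∉ d with M′→M (link-E d (proj₂ (E-link eij)))
    ... | inj₁ (_ , ≢ij) = ≢ij (inj₁ (refl , refl))
    ... | inj₂ (inj₁ (i≡k , _)) = i≢k i≡k
    ... | inj₂ (inj₂ (i≡l , _)) = i≢l i≡l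
    same? : ∀ x y i j → Dec (SamePair x y i j)
    same? x y i j = ((x ≟ᶠ i) ×-dec (y ≟ᶠ j)) ⊎-dec ((x ≟ᶠ j) ×-dec (y ≟ᶠ i))
    forward : ∀ {p q} → Link t p q → SamePair p q i j ⊎ Link t′ p q
    forward {p} {q} d with same? p q i j | side? p q
    ... | yes same | _ = inj₁ same
    ... | no _ | yes s = inj₂ (side-link size′≡ s)
    ... | no ≢ij | no ¬s = inj₂ (proj₁ (E-link (M→M′ (inj₁ (link-E d ¬s , ≢ij)))))
    backward : ∀ {p q} → Link t′ p q → SamePair p q k l ⊎ Link t p q
    backward {p} {q} d with side? p q
    ... | yes s = inj₂ (side-link size≡ s)
    ... | no ¬s with M′→M (link-E d ¬s)
    ...   | inj₁ (e , _) = inj₂ (proj₁ (E-link e))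
    ...   | inj₂ same = inj₁ same

  chord-links : ∀ {t t′ i j} → pos i < pos j → (∀ {x y} → Link t x y → SamePair x y i j ⊎ Link t′ x y) →
                suc (size t) ≡ N →
                ∀ {p q} → Chord t 0 p q → (p ≡ pos i × q ≡ pos j) ⊎ Chord t′ 0 p q
  chord-links {t} i<j f size≡ c
    with q<N ← Planar.bounded (tree-planar t size≡) c
    with vertex (<-trans (chord-< c) q<N) | vertex q<N
  ... | x , refl | y , refl with f (inj₁ c)
  ...   | inj₂ d = inj₂ (link-chord d (chord-< c))
  ...   | inj₁ (inj₁ (refl , refl)) = inj₁ (refl , refl)
  ...   | inj₁ (inj₂ (refl , refl)) = contradiction (chord-< c) (<-asym i<j)

  -- Since `ij` is absent from `t′`, maximality yields a chord of `t′` crossing it. The only chord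
  -- of `t′` that is not already in `t` is `kl`, so `kl` is that chord; the two ways of crossing
  -- give the two directions.
  oriented-quad : ∀ {t t′ i j k l} → suc (size t) ≡ N → suc (size t′) ≡ N →
                  pos i < pos j → pos k < pos l → Exchange t t′ i j k l → Quad 0 t t′ ⊎ Quad 0 t′ t
  oriented-quad {t} {t′} {i} {j} {k} {l} size≡ size′≡ i<j k<l X = quad crossing
    where
    module X = Exchange X
    ij : Chord t 0 (pos i) (pos j)
    ij = link-chord X.ij i<j
    forward : ∀ {p q} → Chord t 0 p q → (p ≡ pos i × q ≡ pos j) ⊎ Chord t′ 0 p q
    forward = chord-links i<j X.forward size≡
    backward : ∀ {p q} → Chord t′ 0 p q → (p ≡ pos k × q ≡ pos l) ⊎ Chord t 0 p q
    backward = chord-links k<l X.backward size′≡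
    crossing : Crossing (pos i) (pos j) (pos k) (pos l)
    crossing with Planar.maximal (tree-planar t′ size′≡) i<j (pos<N j)
    ... | inj₁ c = contradiction (inj₁ c) X.ij∉
    ... | inj₂ (p , q , c , cr) with backward c
    ...   | inj₁ (refl , refl) = cr
    crossing | inj₂ (p , q , c , inj₁ (a , b , e)) | inj₂ d = ⊥-elim (tree-noncrossing ij d a b e)
    crossing | inj₂ (p , q , c , inj₂ (a , b , e)) | inj₂ d = ⊥-elim (tree-noncrossing d ij a b e)
    keep : ∀ {p q} → p ≢ pos i ⊎ q ≢ pos j → Chord t 0 p q → Chord t′ 0 p q
    keep ne c with forward c
    ... | inj₂ d = d
    keep (inj₁ p≢) c | inj₁ (e , _) = contradiction e p≢
    keep (inj₂ q≢) c | inj₁ (_ , e) = contradiction e q≢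
    quad : Crossing (pos i) (pos j) (pos k) (pos l) → Quad 0 t t′ ⊎ Quad 0 t′ t
    quad (inj₁ (i<k , k<j , j<l)) = inj₁ record
      { x<u = i<k ; u<y = k<j ; y<v = j<l
      ; xu = link-chord X.ik i<k ; uy = link-chord (link-sym X.jk) k<j
      ; yv = link-chord X.jl j<l ; xv = link-chord X.il (<-trans i<j j<l)
      ; xy = ij ; uv = link-chord X.kl k<l
      ; forward = forward ; backward = backward }
    -- Now `t′` is the source, so the four sides of the quadrilateral have to be carried over to it.
    quad (inj₂ (k<i , i<l , l<j)) = inj₂ record
      { x<u = k<i ; u<y = i<l ; y<v = l<j
      ; xu = keep (inj₁ (<⇒≢ k<i)) (link-chord (link-sym X.ik) k<i)
      ; uy = keep (inj₂ (<⇒≢ l<j)) (link-chord X.il i<l)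
      ; yv = keep (inj₁ (≢-sym (<⇒≢ i<l))) (link-chord (link-sym X.jl) l<j)
      ; xv = keep (inj₁ (<⇒≢ k<i)) (link-chord (link-sym X.jk) (<-trans k<l l<j))
      ; xy = link-chord X.kl k<l ; uv = ij
      ; forward = backward ; backward = forward }

  flip-quad : ∀ {t t′} → suc (size t) ≡ N → suc (size t′) ≡ N → Flip (matOf t) (matOf t′) →
              Quad 0 t t′ ⊎ Quad 0 t′ t
  flip-quad {t} {t′} size≡ size′≡ F with flip-exchange size≡ size′≡ F
  ... | i , j , k , l , X with compare-pos (link-≢ (Exchange.ij X)) | compare-pos (link-≢ (Exchange.kl X))
  ... | inj₁ i<j | inj₁ k<l = oriented-quad size≡ size′≡ i<j k<l X
  ... | inj₁ i<j | inj₂ l<k = oriented-quad size≡ size′≡ i<j l<k (exchange-swapʳ X)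
  ... | inj₂ j<i | inj₁ k<l = oriented-quad size≡ size′≡ j<i k<l (exchange-swapˡ X)
  ... | inj₂ j<i | inj₂ l<k = oriented-quad size≡ size′≡ j<i l<k (exchange-swapʳ (exchange-swapˡ X))

-- Colours by position

hue : ℕ → Color
hue 0 = blue
hue 1 = red
hue 2 = blue
hue 3 = red
hue 4 = blue
hue _ = red

hue-red : ∀ {p} → 5 ≤ p → hue p ≡ red
hue-red (s≤s (s≤s (s≤s (s≤s (s≤s _))))) = refl

NonMono : ℕ → ℕ → ℕ → Set
NonMono u v w = ¬ (hue u ≡ hue v × hue v ≡ hue w)

-- Dropping the first red point lowers `a` and the label alike and leaves the position unchanged;
-- only `a = 0` and the first red point itself need inspection.
color-hue : ∀ a n p → Coordinate (a + 5) n p → color a n ≡ hue p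
color-hue zero 0 4 refl = refl
color-hue zero 1 3 refl = refl
color-hue zero 2 2 refl = refl
color-hue zero 3 1 refl = refl
color-hue zero 4 0 refl = refl
color-hue zero (suc (suc (suc (suc (suc n))))) p e =
  contradiction (sym (trans (sym (+-suc n p)) (+-cancelˡ-≡ 5 _ _ e))) λ ()
color-hue (suc a) zero p refl = sym (hue-red (m≤n+m 5 a))
color-hue (suc a) (suc n) p e = color-hue a n p (suc-injective e)

module Colouring (a : ℕ) where
  open Colorful a

  2≤N : 2 ≤ N
  2≤N = ≤-trans (s≤s (s≤s z≤n)) (m≤n+m 5 a)

  open Geometry 2≤N public
  open Flips 2≤N public

  col-hue : ∀ i → col i ≡ hue (pos i)
  col-hue i = color-hue a (toℕ i) (pos i) (pos-coordinate i)

  module _ {t : Tree} (size≡ : suc (size t) ≡ N) where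

    colorful-triangles : Colorful (matOf t) → Triangles NonMono 0 t
    colorful-triangles colorful = triangles-intro t go
      where
      go : ∀ {u v w} → Chord t 0 u v → Chord t 0 v w → Chord t 0 u w → NonMono u v w
      go {u} {v} {w} uv vw uw (e , e′)
        with w<N ← Planar.bounded (tree-planar t size≡) vw
        with v<N ← <-trans (chord-< vw) w<N
        with vertex (<-trans (chord-< uv) v<N) | vertex v<N | vertex w<N
      ... | i , refl | j , refl | k , refl = colorful i j k
        (link-≢ {t} (inj₁ uv) , link-≢ {t} (inj₁ vw) , link-≢ {t} (inj₁ uw) ,
         link-edge size≡ (inj₁ uv) , link-edge size≡ (inj₁ vw) , link-edge size≡ (inj₁ uw))
        (trans (col-hue i) (trans e (sym (col-hue j))) , trans (col-hue j) (trans e′ (sym (col-hue k))))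

    triangles-colorful : Triangles NonMono 0 t → Colorful (matOf t)
    triangles-colorful T i j k (i≢j , j≢k , i≢k , ij , jk , ik) (e , e′) =
      go (compare-pos i≢j) (compare-pos j≢k) (compare-pos i≢k)
      where
      elim : ∀ {i j k} → Edge (matOf t) i j → Edge (matOf t) j k → Edge (matOf t) i k →
             pos i < pos j → pos j < pos k → hue (pos i) ≡ hue (pos j) → hue (pos j) ≡ hue (pos k) → ⊥
      elim ij jk ik i<j j<k h h′ = triangles-elim t T
        (link-chord (edge-link size≡ ij) i<j) (link-chord (edge-link size≡ jk) j<k)
        (link-chord (edge-link size≡ ik) (<-trans i<j j<k)) (h , h′)
      swap : ∀ {i j} → Edge (matOf t) i j → Edge (matOf t) j i
      swap = link-edge size≡ ∘ link-sym ∘ edge-link size≡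
      h : hue (pos i) ≡ hue (pos j)
      h = trans (sym (col-hue i)) (trans e (col-hue j))
      h′ : hue (pos j) ≡ hue (pos k)
      h′ = trans (sym (col-hue j)) (trans e′ (col-hue k))
      go : pos i < pos j ⊎ pos j < pos i → pos j < pos k ⊎ pos k < pos j → pos i < pos k ⊎ pos k < pos i → ⊥
      go (inj₁ i<j) (inj₁ j<k) _ = elim ij jk ik i<j j<k h h′
      go (inj₁ i<j) (inj₂ k<j) (inj₁ i<k) = elim ik (swap jk) ij i<k k<j (trans h h′) (sym h′)
      go (inj₁ i<j) (inj₂ k<j) (inj₂ k<i) = elim (swap ik) ij (swap jk) k<i i<j (sym (trans h h′)) h
      go (inj₂ j<i) (inj₁ j<k) (inj₁ i<k) = elim (swap ij) ik jk j<i i<k (sym h) (trans h h′)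
      go (inj₂ j<i) (inj₁ j<k) (inj₂ k<i) = elim jk (swap ik) (swap ij) j<k k<i h′ (sym (trans h h′))
      go (inj₂ j<i) (inj₂ k<j) _ = elim (swap jk) (swap ij) (swap ik) k<j j<i (sym h′) (sym h)

    tree-node : Triangles NonMono 0 t → Node (matOf t)
    tree-node T = matOf-triangulation size≡ , triangles-colorful T

  node-tree : ∀ {M} → Node M →
              ∃ λ t → suc (size t) ≡ N × Triangles NonMono 0 t × M ≡ matOf t
  node-tree (T , C) =
    let (t , size≡ , M≡) = triangulation-tree T
    in t , size≡ , colorful-triangles size≡ (subst Colorful M≡ C) , M≡

-- The colourful triangulations

-- Adds `k` triangles fanned at the first vertex of `t`, which becomes joined to the `k` points
-- after its end.
comb : ℕ → Tree → Tree
comb zero t = t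
comb (suc k) t = node (comb k t) leaf

fan : ℕ → Tree
fan k = comb k leaf

ear : Bool → Tree → Tree
ear false t = node (node leaf leaf) t
ear true t = node leaf (node leaf t)

tri : Bool → Tree
tri false = node leaf (node leaf leaf)
tri true = node (node leaf leaf) leaf

-- Let A, p, B, q, C denote the positions 4, 3, 2, 1, 0.  The red vertex 5 + i
-- is the last one joined to the part {A, p, B, q, C}.  A cell has no diagonal
-- AC, pq, Aq or pC; its booleans record whether the ears BC and AB of q and p
-- are opened, that is replaced by the diagonals from q to 5 + i and from p to 5 + j.
data Code : Set where
  cell : (x y : Bool) (i j : ℕ) → Code
  hub  : (s r k : Bool) (i : ℕ) → Code

-- For a hub, `s` selects Aq (false) or pC (true); `r` tells whether AC has been replaced by the
-- diagonal from q or p, respectively, to `5 + i`; `k` selects the remaining short diagonal, AB or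
-- pq if `s` is false and pq or BC if `s` is true.
core : Code → Tree
core (cell x y i j) = ear x (comb (i ∸ j) (ear y (fan j)))
core (hub false false k i) = node (node leaf (tri k)) (fan i)
core (hub false true k i) = node leaf (node (tri k) (fan i))
core (hub true false k i) = node (node (tri k) leaf) (fan i)
core (hub true true k i) = node (tri k) (node leaf (fan i))

last : Code → ℕ
last (cell _ _ i _) = i
last (hub _ _ _ i) = i

tree : ℕ → Code → Tree
tree a c = comb (a ∸ suc (last c)) (core c)

Valid : ℕ → Code → Set
Valid a (cell x y i j) = j ≤ i × i < a
Valid a (hub s r k i) = i < a

valid-last : ∀ {a} c → Valid a c → last c < a
valid-last (cell _ _ _ _) (_ , i<a) = i<a
valid-last (hub _ _ _ _) i<a = i<a

size-comb : ∀ k t → size (comb k t) ≡ k + size t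
size-comb zero t = refl
size-comb (suc k) t = trans (+-comm (size (comb k t)) 1) (cong suc (size-comb k t))

size-fan : ∀ k → size (fan k) ≡ suc k
size-fan k = trans (size-comb k leaf) (+-comm k 1)

size-ear : ∀ x t → size (ear x t) ≡ 2 + size t
size-ear false t = refl
size-ear true t = refl

size-core : ∀ {a} c → Valid a c → size (core c) ≡ 5 + last c
size-core (cell x y i j) (j≤i , _) = trans (size-ear x _) (cong (2 +_)
  (trans (size-comb (i ∸ j) _) (trans (cong ((i ∸ j) +_) (trans (size-ear y _) (cong (2 +_) (size-fan j))))
    (trans (+-comm (i ∸ j) (3 + j)) (cong (3 +_) (m+[n∸m]≡n j≤i))))))
size-core (hub false false false i) _ = cong (4 +_) (size-fan i)
size-core (hub false false true i) _ = cong (4 +_) (size-fan i)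
size-core (hub false true false i) _ = cong (4 +_) (size-fan i)
size-core (hub false true true i) _ = cong (4 +_) (size-fan i)
size-core (hub true false false i) _ = cong (4 +_) (size-fan i)
size-core (hub true false true i) _ = cong (4 +_) (size-fan i)
size-core (hub true true false i) _ = cong (4 +_) (size-fan i)
size-core (hub true true true i) _ = cong (4 +_) (size-fan i)

size-tree : ∀ {a} c → Valid a c → suc (size (tree a c)) ≡ a + 5
size-tree {a} c v = trans (cong suc (trans (size-comb (a ∸ suc (last c)) (core c))
    (cong (a ∸ suc (last c) +_) (trans (size-core {a} c v) (+-comm 5 (last c))))))
  (trans (sym (+-suc _ _)) (trans (sym (+-assoc (a ∸ suc (last c)) (suc (last c)) 5))
    (cong (_+ 5) (m∸n+n≡m (valid-last c v)))))

beyond : ∀ v {X : Set} → 5 ≤ v → ¬ (X × blue ≡ hue v)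
beyond v 5≤v (_ , e) = case trans e (hue-red 5≤v) of λ ()

comb-triangles : ∀ k {o t} → hue o ≡ blue → 5 ≤ o + size t →
                 Triangles NonMono o t → Triangles NonMono o (comb k t)
comb-triangles zero _ _ T = T
comb-triangles (suc k) {o} {t} b 5≤ T =
  (λ (e , _) → case trans (sym b) (trans e (hue-red 5≤′)) of λ ()) ,
  comb-triangles k b 5≤ T , _
  where
  5≤′ : 5 ≤ o + size (comb k t)
  5≤′ = ≤-trans 5≤ (+-monoʳ-≤ o (≤-trans (m≤n+m (size t) k) (≤-reflexive (sym (size-comb k t)))))

fan-triangles : ∀ k → Triangles NonMono 4 (fan k)
fan-triangles k = comb-triangles k refl ≤-refl _

stem-triangles : ∀ y k j → Triangles NonMono 2 (comb k (ear y (fan j)))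
stem-triangles y k j = comb-triangles k refl
  (≤-trans (+-monoʳ-≤ 4 (0<size (fan j))) (≤-reflexive (cong (2 +_) (sym (size-ear y (fan j))))))
  (go y)
  where
  go : ∀ y → Triangles NonMono 2 (ear y (fan j))
  go false = beyond (4 + size (fan j)) (+-monoʳ-≤ 4 (0<size (fan j))) ,
             ((λ ()) ∘ proj₁ , _ , _) , fan-triangles j
  go true = (λ ()) ∘ proj₁ , _ , (λ ()) ∘ proj₁ , _ , fan-triangles j

core-triangles : ∀ c → Triangles NonMono 0 (core c)
core-triangles (cell false y i j) =
  beyond _ (+-monoʳ-≤ 2 3≤) , ((λ ()) ∘ proj₁ , _ , _) ,
  stem-triangles y (i ∸ j) j
  where
  3≤ : 3 ≤ size (comb (i ∸ j) (ear y (fan j)))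
  3≤ = subst (3 ≤_) (sym (size-comb (i ∸ j) _)) (≤-trans (subst (3 ≤_) (sym (size-ear y (fan j)))
         (+-monoʳ-≤ 2 (0<size (fan j)))) (m≤n+m _ (i ∸ j)))
core-triangles (cell true y i j) =
  (λ ()) ∘ proj₁ , _ , (λ ()) ∘ proj₁ , _ , stem-triangles y (i ∸ j) j
core-triangles (hub false false false i) = beyond (4 + size (fan i)) (+-monoʳ-≤ 4 (0<size (fan i))) ,
  ((λ ()) ∘ proj₁ , _ , (λ ()) ∘ proj₁ , _ , (λ ()) ∘ proj₁ , _ , _) , fan-triangles i
core-triangles (hub false false true i) = beyond (4 + size (fan i)) (+-monoʳ-≤ 4 (0<size (fan i))) ,
  ((λ ()) ∘ proj₁ , _ , (λ ()) ∘ proj₂ , ((λ ()) ∘ proj₁ , _ , _) , _) , fan-triangles i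
core-triangles (hub false true false i) = (λ ()) ∘ proj₁ , _ , beyond (4 + size (fan i)) (+-monoʳ-≤ 4 (0<size (fan i))) ,
  ((λ ()) ∘ proj₁ , _ , (λ ()) ∘ proj₁ , _ , _) , fan-triangles i
core-triangles (hub false true true i) = (λ ()) ∘ proj₁ , _ , beyond (4 + size (fan i)) (+-monoʳ-≤ 4 (0<size (fan i))) ,
  ((λ ()) ∘ proj₂ , ((λ ()) ∘ proj₁ , _ , _) , _) , fan-triangles i
core-triangles (hub true false false i) = beyond (4 + size (fan i)) (+-monoʳ-≤ 4 (0<size (fan i))) ,
  ((λ ()) ∘ proj₁ , ((λ ()) ∘ proj₁ , _ , (λ ()) ∘ proj₁ , _ , _) , _) , fan-triangles i
core-triangles (hub true false true i) = beyond (4 + size (fan i)) (+-monoʳ-≤ 4 (0<size (fan i))) ,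
  ((λ ()) ∘ proj₁ , ((λ ()) ∘ proj₂ , ((λ ()) ∘ proj₁ , _ , _) , _) , _) , fan-triangles i
core-triangles (hub true true false i) = (λ ()) ∘ proj₁ ,
  ((λ ()) ∘ proj₁ , _ , (λ ()) ∘ proj₁ , _ , _) , (λ ()) ∘ proj₁ , _ , fan-triangles i
core-triangles (hub true true true i) = (λ ()) ∘ proj₁ ,
  ((λ ()) ∘ proj₂ , ((λ ()) ∘ proj₁ , _ , _) , _) , (λ ()) ∘ proj₁ , _ , fan-triangles i

tree-triangles : ∀ {a} c → Valid a c → Triangles NonMono 0 (tree a c)
tree-triangles {a} c v = comb-triangles (a ∸ suc (last c)) refl
  (subst (5 ≤_) (sym (size-core {a} c v)) (m≤m+n 5 _)) (core-triangles c)

red-apex : ∀ o p s r → hue o ≡ red → 5 ≤ p → p ≡ o + size s → ¬ Triangles NonMono o (node s r)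
red-apex o _ s r ho 5≤p refl (f , _) =
  f (trans ho (sym (hue-red 5≤p)) ,
     trans (hue-red 5≤p) (sym (hue-red (≤-trans 5≤p (+-monoʳ-≤ o (m≤m+n (size s) (size r)))))))

red-leaf : ∀ t {o} → 5 ≤ o → Triangles NonMono o t → t ≡ leaf
red-leaf leaf _ _ = refl
red-leaf (node s r) {o} 5≤ (f , _) = contradiction
  (trans (hue-red 5≤) (sym (hue-red 5≤m)) , trans (hue-red 5≤m) (sym (hue-red (≤-trans 5≤ (m≤m+n o _))))) f
  where
  5≤m : 5 ≤ o + size s
  5≤m = ≤-trans 5≤ (m≤m+n o (size s))

-- Seen from A every apex is red, so the right subtree spans red points only and must be a single
-- side.
fan-unique : ∀ t k → size t ≡ suc k → Triangles NonMono 4 t → t ≡ fan k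
fan-unique leaf zero _ _ = refl
fan-unique (node s r) k e (_ , S , R) with red-leaf r (+-monoʳ-≤ 4 (0<size s)) R
fan-unique (node s r) zero e (_ , S , R) | refl =
  contradiction (suc-injective (trans (+-comm 1 (size s)) e)) (≢-sym (<⇒≢ (0<size s)))
fan-unique (node s r) (suc k) e (_ , S , R) | refl =
  cong (λ s → node s leaf) (fan-unique s k (suc-injective (trans (+-comm 1 (size s)) e)) S)

opened-ear-unique : ∀ t k → size t ≡ 2 + k → Triangles NonMono 3 t → t ≡ node leaf (fan k)
opened-ear-unique (node leaf r) k e (_ , _ , R) =
  cong (node leaf) (fan-unique r k (suc-injective e) R)
opened-ear-unique (node s@(node s₁ s₂) r) k e T =
  ⊥-elim (red-apex 3 _ s r refl (+-monoʳ-≤ 3 (+-mono-≤ (0<size s₁) (0<size s₂))) refl T)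

-- The size of a left subtree locates the apex. Up to size four the subtree itself matters and is
-- listed; from five on the apex is red wherever the tree starts, and the bound suffices.
data SizeView : Tree → Set where
  one    : SizeView leaf
  two    : SizeView (node leaf leaf)
  three  : ∀ k → SizeView (tri k)
  fourˡ  : ∀ k → SizeView (node leaf (tri k))
  fourᵐ  : SizeView (node (node leaf leaf) (node leaf leaf))
  fourʳ  : ∀ k → SizeView (node (tri k) leaf)
  five≤  : ∀ {t} → 5 ≤ size t → SizeView t

size≥ : ∀ {t} → SizeView t → ℕ
size≥ one = 1
size≥ two = 2
size≥ (three _) = 3
size≥ (fourˡ _) = 4
size≥ fourᵐ = 4
size≥ (fourʳ _) = 4
size≥ (five≤ _) = 5

size≥-correct : ∀ {t} (v : SizeView t) → size≥ v ≤ size t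
size≥-correct one = ≤-refl
size≥-correct two = ≤-refl
size≥-correct (three false) = ≤-refl
size≥-correct (three true) = ≤-refl
size≥-correct (fourˡ false) = ≤-refl
size≥-correct (fourˡ true) = ≤-refl
size≥-correct fourᵐ = ≤-refl
size≥-correct (fourʳ false) = ≤-refl
size≥-correct (fourʳ true) = ≤-refl
size≥-correct (five≤ p) = p

large : ∀ {s r} (v : SizeView s) (w : SizeView r) → True (4 <ᵇ size≥ v + size≥ w) → SizeView (node s r)
large v w p = five≤ (≤-trans (<ᵇ⇒< 4 _ p) (+-mono-≤ (size≥-correct v) (size≥-correct w)))

large′ : ∀ {s r} (v : SizeView s) → True (3 <ᵇ size≥ v) → SizeView (node s r)
large′ {s} {r} v p = five≤ (≤-trans (≤-reflexive (+-comm 1 4))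
  (+-mono-≤ (≤-trans (<ᵇ⇒< 3 _ p) (size≥-correct v)) (0<size r)))

size-view : ∀ t → SizeView t
size-view leaf = one
size-view (node s r) with size-view s | size-view r
... | one | one = two
... | one | two = three false
... | one | three k = fourˡ k
... | one | w@(fourˡ _) = large one w _
... | one | w@fourᵐ = large one w _
... | one | w@(fourʳ _) = large one w _
... | one | w@(five≤ _) = large one w _
... | two | one = three true
... | two | two = fourᵐ
... | two | w@(three _) = large two w _
... | two | w@(fourˡ _) = large two w _
... | two | w@fourᵐ = large two w _
... | two | w@(fourʳ _) = large two w _
... | two | w@(five≤ _) = large two w _
... | three k | one = fourʳ k
... | v@(three _) | w@two = large v w _
... | v@(three _) | w@(three _) = large v w _
... | v@(three _) | w@(fourˡ _) = large v w _
... | v@(three _) | w@fourᵐ = large v w _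
... | v@(three _) | w@(fourʳ _) = large v w _
... | v@(three _) | w@(five≤ _) = large v w _
... | v@(fourˡ _) | _ = large′ v _
... | v@fourᵐ | _ = large′ v _
... | v@(fourʳ _) | _ = large′ v _
... | v@(five≤ _) | _ = large′ v _

Stem : ℕ → Tree → Set
Stem k t = ∃₂ λ y j → j ≤ k × t ≡ comb (k ∸ j) (ear y (fan j))

stem-extend : ∀ {k s} → Stem k s → Stem (suc k) (node s leaf)
stem-extend {k} (y , j , j≤k , refl) = y , j , m≤n⇒m≤1+n j≤k ,
  cong (λ n → comb n (ear y (fan j))) (sym (+-∸-assoc 1 j≤k))

stem-step : ∀ s r k → size s + size r ≡ 3 + k → 3 ≤ size s → (∀ k → size s ≡ 3 + k → Stem k s) →
            Triangles NonMono (2 + size s) r → Stem k (node s r)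
stem-step s r k e 3≤ IH R with red-leaf r (+-monoʳ-≤ 2 3≤) R
stem-step s r zero e 3≤ IH R | refl =
  contradiction 3≤ (<⇒≱ (≤-reflexive (trans (+-comm 1 (size s)) e)))
stem-step s r (suc k) e 3≤ IH R | refl =
  stem-extend (IH k (suc-injective (trans (+-comm 1 (size s)) e)))

-- Seen from B, the apex p means an opened ear and the apex A a closed one. A red apex leaves a
-- single side on the right and so contributes one more step of the comb.
stem-unique : ∀ t k → size t ≡ 3 + k → Triangles NonMono 2 t → Stem k t
stem-unique (node leaf r) k e (_ , _ , R) =
  true , k , ≤-refl , trans (cong (node leaf) (opened-ear-unique r k (suc-injective e) R))
    (cong (λ n → comb n (ear true (fan k))) (sym (n∸n≡0 k)))
stem-unique (node (node leaf leaf) r) k e (_ , _ , R) =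
  false , k , ≤-refl , trans (cong (node _) (fan-unique r k (+-cancelˡ-≡ 2 _ _ e) R))
    (cong (λ n → comb n (ear false (fan k))) (sym (n∸n≡0 k)))
stem-unique (node s@(node (node s₁ s₂) s₃) r) k e (_ , S , R) =
  stem-step s r k e (+-mono-≤ (+-mono-≤ (0<size s₁) (0<size s₂)) (0<size s₃))
    (λ k′ e′ → stem-unique s k′ e′ S) R
stem-unique (node s@(node leaf (node s₁ s₂)) r) k e (_ , S , R) =
  stem-step s r k e (s≤s (+-mono-≤ (0<size s₁) (0<size s₂))) (λ k′ e′ → stem-unique s k′ e′ S) R

tree-suc : ∀ {a} c → Valid a c → tree (suc a) c ≡ node (tree a c) leaf
tree-suc c v = cong (λ n → comb n (core c)) (+-∸-assoc 1 (valid-last c v))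

valid-suc : ∀ {a} c → Valid a c → Valid (suc a) c
valid-suc (cell x y i j) (j≤i , i<a) = j≤i , m≤n⇒m≤1+n i<a
valid-suc (hub s r k i) i<a = m≤n⇒m≤1+n i<a

Coded : ℕ → Tree → Set
Coded a t = ∃ λ c → Valid a c × t ≡ tree a c

core-coded : ∀ {k t} c → Valid (suc k) c → last c ≡ k → t ≡ core c → Coded (suc k) t
core-coded {k} c v refl refl = c , v , cong (λ n → comb n (core c)) (sym (n∸n≡0 k))

-- The tree `t` starts at the red point q and ends at a red point, so its apex is blue: B gives a
-- cell, A gives a hub.
opened-coded : ∀ t k → size t ≡ 4 + k → Triangles NonMono 1 t → Coded (suc k) (node leaf t)
opened-coded (node s r) k e T@(f , S , R) with size-view s
... | one with stem-unique r k (suc-injective e) R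
...   | y , j , j≤k , refl = core-coded (cell true y k j) (j≤k , ≤-refl) refl refl
opened-coded (node s r) k e T@(f , S , R) | two =
  contradiction (refl , sym (hue-red (subst (5 ≤_) (sym (cong suc e)) (m≤m+n 5 k)))) f
opened-coded (node s r) k e T@(f , S , R) | three false
  with fan-unique r k (+-cancelˡ-≡ 3 _ _ e) R
... | refl = core-coded (hub false true false k) ≤-refl refl refl
opened-coded (node s r) k e T@(f , S , R) | three true
  with fan-unique r k (+-cancelˡ-≡ 3 _ _ e) R
... | refl = core-coded (hub false true true k) ≤-refl refl refl
opened-coded (node s r) k e T | fourˡ false = ⊥-elim (red-apex 1 5 s r refl ≤-refl refl T)
opened-coded (node s r) k e T | fourˡ true = ⊥-elim (red-apex 1 5 s r refl ≤-refl refl T)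
opened-coded (node s r) k e T | fourᵐ = ⊥-elim (red-apex 1 5 s r refl ≤-refl refl T)
opened-coded (node s r) k e T | fourʳ false = ⊥-elim (red-apex 1 5 s r refl ≤-refl refl T)
opened-coded (node s r) k e T | fourʳ true = ⊥-elim (red-apex 1 5 s r refl ≤-refl refl T)
opened-coded (node s r) k e T | five≤ 5≤ = ⊥-elim (red-apex 1 _ s r refl (m≤n⇒m≤1+n 5≤) refl T)

-- The apex seen from C decides: q is left to `opened-coded`, B gives a cell with closed ear BC, p
-- and A give hubs. A red apex splits off the last point and leads to the recursion. The
-- triangulation containing the all-blue triangle ABC is the case `fourᵐ`.
tree-coded : ∀ t k → size t ≡ 5 + k → Triangles NonMono 0 t → Coded (suc k) t
tree-coded (node s r) k e (f , S , R) with size-view s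
tree-coded (node s r) k e (f , S , R) | one = opened-coded r k (suc-injective e) R
tree-coded (node s r) k e (f , S , R) | two with stem-unique r k (+-cancelˡ-≡ 2 _ _ e) R
... | y , j , j≤k , refl = core-coded (cell false y k j) (j≤k , ≤-refl) refl refl
tree-coded (node s r) k e (f , S , R) | three false with opened-ear-unique r k (+-cancelˡ-≡ 3 _ _ e) R
... | refl = core-coded (hub true true false k) ≤-refl refl refl
tree-coded (node s r) k e (f , S , R) | three true with opened-ear-unique r k (+-cancelˡ-≡ 3 _ _ e) R
... | refl = core-coded (hub true true true k) ≤-refl refl refl
tree-coded (node s r) k e (f , S , R) | fourˡ false with fan-unique r k (+-cancelˡ-≡ 4 _ _ e) R
... | refl = core-coded (hub false false false k) ≤-refl refl refl
tree-coded (node s r) k e (f , S , R) | fourˡ true with fan-unique r k (+-cancelˡ-≡ 4 _ _ e) R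
... | refl = core-coded (hub false false true k) ≤-refl refl refl
tree-coded (node s r) k e (f , (g , _) , R) | fourᵐ = contradiction (refl , refl) g
tree-coded (node s r) k e (f , S , R) | fourʳ false with fan-unique r k (+-cancelˡ-≡ 4 _ _ e) R
... | refl = core-coded (hub true false false k) ≤-refl refl refl
tree-coded (node s r) k e (f , S , R) | fourʳ true with fan-unique r k (+-cancelˡ-≡ 4 _ _ e) R
... | refl = core-coded (hub true false true k) ≤-refl refl refl
tree-coded (node s r) k e (f , S , R) | five≤ 5≤ with red-leaf r 5≤ R
tree-coded (node s r) zero e (f , S , R) | five≤ 5≤ | refl =
  contradiction 5≤ (<⇒≱ (≤-reflexive (trans (+-comm 1 (size s)) e)))
tree-coded (node s r) (suc k) e (f , S , R) | five≤ 5≤ | refl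
  with tree-coded s k (suc-injective (trans (+-comm 1 (size s)) e)) S
... | c , v , eq = c , valid-suc c v , trans (cong (λ s → node s leaf) eq) (sym (tree-suc c v))

node-injective : ∀ {s r s′ r′} → node s r ≡ node s′ r′ → s ≡ s′ × r ≡ r′
node-injective refl = refl , refl

fan-injective : ∀ {k k′} → fan k ≡ fan k′ → k ≡ k′
fan-injective {k} {k′} e = suc-injective (trans (sym (size-fan k)) (trans (cong size e) (size-fan k′)))

-- Reduced trees of size ≥ n are the starting points t of the combs comb k t.
Reduced : ℕ → Tree → Set
Reduced n t = ∀ {s} → t ≡ node s leaf → size s < n

comb-injective : ∀ n {t t′} k k′ → n ≤ size t → n ≤ size t′ → Reduced n t → Reduced n t′ →
                 comb k t ≡ comb k′ t′ → t ≡ t′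
comb-injective n zero zero _ _ _ _ e = e
comb-injective n {t′ = t′} zero (suc k′) _ n≤ ρ _ e = contradiction (ρ e)
  (≤⇒≯ (≤-trans n≤ (≤-trans (m≤n+m (size t′) k′) (≤-reflexive (sym (size-comb k′ t′))))))
comb-injective n {t} (suc k) zero n≤ _ _ ρ e = contradiction (ρ (sym e))
  (≤⇒≯ (≤-trans n≤ (≤-trans (m≤n+m (size t) k) (≤-reflexive (sym (size-comb k t))))))
comb-injective n (suc k) (suc k′) n≤ n≤′ ρ ρ′ e =
  comb-injective n k k′ n≤ n≤′ ρ ρ′ (proj₁ (node-injective e))

ear-reduced : ∀ y t → Reduced 3 (ear y t)
ear-reduced false t refl = ≤-refl
ear-reduced true t ()

core-reduced : ∀ c → Reduced 5 (core c)
core-reduced (cell false y i j) e = subst (λ s → size s < 5) (proj₁ (node-injective e)) (m≤m+n 3 2)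
core-reduced (cell true y i j) ()
core-reduced (hub false false false i) e = subst (λ s → size s < 5) (proj₁ (node-injective e)) ≤-refl
core-reduced (hub false false true i) e = subst (λ s → size s < 5) (proj₁ (node-injective e)) ≤-refl
core-reduced (hub false true k i) ()
core-reduced (hub true false false i) e = subst (λ s → size s < 5) (proj₁ (node-injective e)) ≤-refl
core-reduced (hub true false true i) e = subst (λ s → size s < 5) (proj₁ (node-injective e)) ≤-refl
core-reduced (hub true true false i) ()
core-reduced (hub true true true i) ()

data Shape : Set where
  cellˢ : Bool → Shape
  hubˢ  : (s r k : Bool) → Shape

shape : Code → Shape
shape (cell x _ _ _) = cellˢ x
shape (hub s r k _) = hubˢ s r k

-- The shape of a core can be read off its left subtree, or off the left
-- subtree of the right one if the former is a leaf.
shapeOf : Tree → Shape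
shapeOf (node leaf (node leaf _)) = cellˢ true
shapeOf (node leaf (node (node leaf _) _)) = hubˢ false true false
shapeOf (node leaf _) = hubˢ false true true
shapeOf (node (node leaf leaf) _) = cellˢ false
shapeOf (node (node leaf (node leaf leaf)) _) = hubˢ true true false
shapeOf (node (node leaf (node leaf _)) _) = hubˢ false false false
shapeOf (node (node leaf (node (node _ _) _)) _) = hubˢ false false true
shapeOf (node (node (node leaf leaf) leaf) _) = hubˢ true true true
shapeOf (node (node (node leaf _) leaf) _) = hubˢ true false false
shapeOf _ = hubˢ true false true

shape-core : ∀ c → shapeOf (core c) ≡ shape c
shape-core (cell false _ _ _) = refl
shape-core (cell true _ _ _) = refl
shape-core (hub false false false _) = refl
shape-core (hub false false true _) = refl
shape-core (hub false true false _) = refl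
shape-core (hub false true true _) = refl
shape-core (hub true false false _) = refl
shape-core (hub true false true _) = refl
shape-core (hub true true false _) = refl
shape-core (hub true true true _) = refl

last-≡ : ∀ {a} c c′ → Valid a c → Valid a c′ → core c ≡ core c′ → last c ≡ last c′
last-≡ {a} c c′ v v′ e = +-cancelˡ-≡ 5 _ _
  (trans (sym (size-core {a} c v)) (trans (cong size e) (size-core {a} c′ v′)))

ear-fan-injective : ∀ {j j′} y y′ → ear y (fan j) ≡ ear y′ (fan j′) → y ≡ y′ × j ≡ j′
ear-fan-injective false false e = refl , fan-injective (proj₂ (node-injective e))
ear-fan-injective true true e =
  refl , fan-injective (proj₂ (node-injective (proj₂ (node-injective e))))
ear-fan-injective {zero} false true ()
ear-fan-injective {suc j} false true ()
ear-fan-injective {j′ = zero} true false ()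
ear-fan-injective {j′ = suc j′} true false ()

3≤ear : ∀ y j → 3 ≤ size (ear y (fan j))
3≤ear y j = subst (3 ≤_) (sym (size-ear y (fan j))) (+-monoʳ-≤ 2 (0<size (fan j)))

stem-injective : ∀ {k k′ j j′} y y′ → comb k (ear y (fan j)) ≡ comb k′ (ear y′ (fan j′)) →
                 y ≡ y′ × j ≡ j′
stem-injective {k} {k′} {j} {j′} y y′ e = ear-fan-injective y y′
  (comb-injective 3 k k′ (3≤ear y j) (3≤ear y′ j′) (ear-reduced y _) (ear-reduced y′ _) e)

core-injective : ∀ {a} c c′ → Valid a c → Valid a c′ → core c ≡ core c′ → c ≡ c′
core-injective c c′ v v′ e with trans (sym (shape-core c)) (trans (cong shapeOf e) (shape-core c′))
                              | last-≡ c c′ v v′ e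
core-injective (cell false y i j) (cell _ y′ _ j′) _ _ e | refl | refl
  with refl , refl ← stem-injective y y′ (proj₂ (node-injective e)) = refl
core-injective (cell true y i j) (cell _ y′ _ j′) _ _ e | refl | refl
  with refl , refl ← stem-injective y y′ (proj₂ (node-injective (proj₂ (node-injective e)))) = refl
core-injective (hub s r k i) (hub _ _ _ _) _ _ _ | refl | refl = refl

tree-injective : ∀ {a} c c′ → Valid a c → Valid a c′ → tree a c ≡ tree a c′ → c ≡ c′
tree-injective {a} c c′ v v′ e = core-injective c c′ v v′
  (comb-injective 5 _ _ (5≤ c v) (5≤ c′ v′) (core-reduced c) (core-reduced c′) e)
  where
  5≤ : ∀ c → Valid a c → 5 ≤ size (core c)
  5≤ c v = subst (5 ≤_) (sym (size-core {a} c v)) (m≤m+n 5 _)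

size-coded : ∀ {a} → 1 ≤ a → ∀ t → suc (size t) ≡ a + 5 → Triangles NonMono 0 t → Coded a t
size-coded {suc k} _ t size≡ = tree-coded t k (trans (suc-injective size≡) (+-comm k 5))

module Decoding (a : ℕ) (1≤a : 1 ≤ a) where
  open Colorful a
  open Colouring a

  decode : Code → Mat
  decode c = matOf (tree a c)

  decode-node : ∀ {c} → Valid a c → Node (decode c)
  decode-node {c} v = tree-node (size-tree c v) (tree-triangles c v)

  decode-injective : ∀ {c c′} → Valid a c → Valid a c′ → decode c ≡ decode c′ → c ≡ c′
  decode-injective {c} {c′} v v′ e =
    tree-injective c c′ v v′ (matOf-injective (size-tree c v) (size-tree c′ v′) e)

  node-decode : ∀ {M} → Node M → ∃ λ c → Valid a c × M ≡ decode c
  node-decode nd =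
    let (t , size≡ , T , M≡) = node-tree nd
        (c , v , t≡) = size-coded 1≤a t size≡ T
    in c , v , trans M≡ (cong matOf t≡)

-- Enumeration

quartet : ℕ → ℕ → List Code
quartet i j = cell false false i j ∷ cell true false i j ∷ cell false true i j ∷ cell true true i j ∷ []

cells : ℕ → ℕ → List Code
cells i zero = []
cells i (suc j) = quartet i j ++ cells i j

hubs : ℕ → List Code
hubs i = hub false false false i ∷ hub false false true i ∷ hub false true false i ∷ hub false true true i
       ∷ hub true false false i ∷ hub true false true i ∷ hub true true false i ∷ hub true true true i ∷ []

layer : ℕ → List Code
layer i = cells i (suc i) ++ hubs i

codes : ℕ → List Code
codes zero = []
codes (suc i) = layer i ++ codes i

∈-quartet : ∀ x y i j → cell x y i j ∈ quartet i j
∈-quartet false false i j = here refl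
∈-quartet true false i j = there (here refl)
∈-quartet false true i j = there (there (here refl))
∈-quartet true true i j = there (there (there (here refl)))

∈-hubs : ∀ s r k i → hub s r k i ∈ hubs i
∈-hubs false false false i = here refl
∈-hubs false false true i = there (here refl)
∈-hubs false true false i = there (there (here refl))
∈-hubs false true true i = there (there (there (here refl)))
∈-hubs true false false i = there (there (there (there (here refl))))
∈-hubs true false true i = there (there (there (there (there (here refl)))))
∈-hubs true true false i = there (there (there (there (there (there (here refl))))))
∈-hubs true true true i = there (there (there (there (there (there (there (here refl)))))))

quartet-∈ : ∀ {c i j} → c ∈ quartet i j → ∃₂ λ x y → c ≡ cell x y i j
quartet-∈ (here refl) = false , false , refl
quartet-∈ (there (here refl)) = true , false , refl
quartet-∈ (there (there (here refl))) = false , true , refl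
quartet-∈ (there (there (there (here refl)))) = true , true , refl

∈-cells : ∀ x y i {j n} → j < n → cell x y i j ∈ cells i n
∈-cells x y i {j} {suc n} (s≤s j≤n) with m≤n⇒m<n∨m≡n j≤n
... | inj₁ j<n = ∈-++⁺ʳ (quartet i n) (∈-cells x y i j<n)
... | inj₂ refl = ∈-++⁺ˡ (∈-quartet x y i j)

cells-∈ : ∀ {c i} n → c ∈ cells i n → ∃₂ λ x y → ∃ λ j → j < n × c ≡ cell x y i j
cells-∈ {i = i} (suc n) c∈ with ∈-++⁻ (quartet i n) c∈
... | inj₁ c∈q = let (x , y , e) = quartet-∈ c∈q in x , y , n , ≤-refl , e
... | inj₂ c∈r = let (x , y , j , j<n , e) = cells-∈ n c∈r in x , y , j , m≤n⇒m≤1+n j<n , e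

hubs-∈ : ∀ {c i} → c ∈ hubs i → ∃₂ λ s r → ∃ λ k → c ≡ hub s r k i
hubs-∈ (here refl) = _ , _ , _ , refl
hubs-∈ (there (here refl)) = _ , _ , _ , refl
hubs-∈ (there (there (here refl))) = _ , _ , _ , refl
hubs-∈ (there (there (there (here refl)))) = _ , _ , _ , refl
hubs-∈ (there (there (there (there (here refl))))) = _ , _ , _ , refl
hubs-∈ (there (there (there (there (there (here refl)))))) = _ , _ , _ , refl
hubs-∈ (there (there (there (there (there (there (here refl))))))) = _ , _ , _ , refl
hubs-∈ (there (there (there (there (there (there (there (here refl)))))))) = _ , _ , _ , refl

layer-∈ : ∀ {c} i → c ∈ layer i → Valid (suc i) c × last c ≡ i
layer-∈ i c∈ with ∈-++⁻ (cells i (suc i)) c∈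
... | inj₁ c∈r with _ , _ , _ , s≤s j≤i , refl ← cells-∈ (suc i) c∈r = (j≤i , ≤-refl) , refl
... | inj₂ c∈h with _ , _ , _ , refl ← hubs-∈ c∈h = ≤-refl , refl

codes-valid : ∀ {c} a → c ∈ codes a → Valid a c
codes-valid (suc a) c∈ with ∈-++⁻ (layer a) c∈
... | inj₁ c∈l = proj₁ (layer-∈ a c∈l)
... | inj₂ c∈c = valid-suc _ (codes-valid a c∈c)

∈-layer : ∀ c → Valid (suc (last c)) c → c ∈ layer (last c)
∈-layer (cell x y i j) (j≤i , _) = ∈-++⁺ˡ (∈-cells x y i (s≤s j≤i))
∈-layer (hub s r k i) _ = ∈-++⁺ʳ (cells i (suc i)) (∈-hubs s r k i)

valid-restrict : ∀ {a} c → Valid (suc a) c → last c < a → Valid a c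
valid-restrict (cell _ _ _ _) (j≤i , _) i<a = j≤i , i<a
valid-restrict (hub _ _ _ _) _ i<a = i<a

valid-codes : ∀ a c → Valid a c → c ∈ codes a
valid-codes zero (cell _ _ _ _) (_ , ())
valid-codes (suc a) c v with m≤n⇒m<n∨m≡n (s≤s⁻¹ (valid-last c v))
... | inj₁ i<a = ∈-++⁺ʳ (layer a) (valid-codes a c (valid-restrict c v i<a))
... | inj₂ refl = ∈-++⁺ˡ (∈-layer c v)

quartet-unique : ∀ i j → Unique (quartet i j)
quartet-unique i j = ((λ ()) ∷ (λ ()) ∷ (λ ()) ∷ []) ∷ ((λ ()) ∷ (λ ()) ∷ []) ∷ ((λ ()) ∷ []) ∷ [] ∷ []

cells-unique : ∀ i n → Unique (cells i n)
cells-unique i zero = []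
cells-unique i (suc n) = Uniqueₚ.++⁺ (quartet-unique i n) (cells-unique i n) disjoint
  where
  disjoint : ∀ {c} → c ∈ quartet i n × c ∈ cells i n → ⊥
  disjoint (p , q) with _ , _ , refl ← quartet-∈ p | _ , _ , _ , n<n , refl ← cells-∈ n q = <-irrefl refl n<n

hubs-unique : ∀ i → Unique (hubs i)
hubs-unique i =
  ((λ ()) ∷ (λ ()) ∷ (λ ()) ∷ (λ ()) ∷ (λ ()) ∷ (λ ()) ∷ (λ ()) ∷ [])
  ∷ ((λ ()) ∷ (λ ()) ∷ (λ ()) ∷ (λ ()) ∷ (λ ()) ∷ (λ ()) ∷ [])
  ∷ ((λ ()) ∷ (λ ()) ∷ (λ ()) ∷ (λ ()) ∷ (λ ()) ∷ [])
  ∷ ((λ ()) ∷ (λ ()) ∷ (λ ()) ∷ (λ ()) ∷ [])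
  ∷ ((λ ()) ∷ (λ ()) ∷ (λ ()) ∷ [])
  ∷ ((λ ()) ∷ (λ ()) ∷ [])
  ∷ ((λ ()) ∷ [])
  ∷ [] ∷ []

layer-unique : ∀ i → Unique (layer i)
layer-unique i = Uniqueₚ.++⁺ (cells-unique i (suc i)) (hubs-unique i) disjoint
  where
  disjoint : ∀ {c} → c ∈ cells i (suc i) × c ∈ hubs i → ⊥
  disjoint (p , q) with _ , _ , _ , _ , refl ← cells-∈ (suc i) p | _ , _ , _ , () ← hubs-∈ q

codes-unique : ∀ a → Unique (codes a)
codes-unique zero = []
codes-unique (suc a) = Uniqueₚ.++⁺ (layer-unique a) (codes-unique a) disjoint
  where
  disjoint : ∀ {c} → c ∈ layer a × c ∈ codes a → ⊥
  disjoint {c} (p , q) with refl ← proj₂ (layer-∈ a p) = <-irrefl refl (valid-last c (codes-valid a q))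

-- Weights of chords

chords : ℕ → Tree → List (ℕ × ℕ)
chords x leaf = (x , x + 1) ∷ []
chords x (node s r) = (x , x + size (node s r)) ∷ chords x s ++ chords (x + size s) r

∈-chords : ∀ {t x u v} → Chord t x u v → (u , v) ∈ chords x t
∈-chords {leaf} top = here refl
∈-chords {node s r} top = here refl
∈-chords (inl c) = there (∈-++⁺ˡ (∈-chords c))
∈-chords {node s r} {x} (inr c) = there (∈-++⁺ʳ (chords x s) (∈-chords c))

chords-∈ : ∀ t {x u v} → (u , v) ∈ chords x t → Chord t x u v
chords-∈ leaf (here refl) = top
chords-∈ (node s r) (here refl) = top
chords-∈ (node s r) {x} (there c∈) with ∈-++⁻ (chords x s) c∈
... | inj₁ c∈s = inl (chords-∈ s c∈s)
... | inj₂ c∈r = inr (chords-∈ r c∈r)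

chords-unique : ∀ t x → Unique (chords x t)
chords-unique leaf x = [] ∷ []
chords-unique (node s r) x = Allₚ.¬Any⇒All¬ _ root∉ ∷
  Uniqueₚ.++⁺ (chords-unique s x) (chords-unique r (x + size s)) disjoint
  where
  root∉ : (x , x + size (node s r)) ∉ chords x s ++ chords (x + size s) r
  root∉ c∈ with ∈-++⁻ (chords x s) c∈
  ... | inj₁ c∈s = ≤⇒≯ (chord-≤ (chords-∈ s c∈s)) (mid< x s r)
  ... | inj₂ c∈r = ≤⇒≯ (chord-≥ (chords-∈ r c∈r)) (m<m+n x (0<size s))
  disjoint : ∀ {c} → c ∈ chords x s × c ∈ chords (x + size s) r → ⊥
  disjoint (p , q) = ≤⇒≯ (≤-trans (chord-≤ (chords-∈ s p)) (chord-≥ (chords-∈ r q)))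
                         (chord-< (chords-∈ s p))

module Weights (g : ℕ → ℕ → ℕ) where

  weight : ℕ → Tree → ℕ
  weight x leaf = g x (x + 1)
  weight x (node s r) = g x (x + size (node s r)) + (weight x s + weight (x + size s) r)

  weights : List (ℕ × ℕ) → ℕ
  weights cs = sum (map (λ (u , v) → g u v) cs)

  weights-chords : ∀ t x → weights (chords x t) ≡ weight x t
  weights-chords leaf x = +-identityʳ _
  weights-chords (node s r) x = cong (g x (x + size (node s r)) +_)
    (trans (cong sum (map-++ _ (chords x s) _)) (trans (sum-++ (map _ (chords x s)) _)
      (cong₂ _+_ (weights-chords s x) (weights-chords r (x + size s)))))

  -- After each tree is given the diagonal it lacks, both have the same chords. The additive form
  -- avoids truncated subtraction.
  exchange-weight : ∀ {t t′} (Q : Quad 0 t t′) → let open Quad Q in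
                    g u v + weight 0 t ≡ g x y + weight 0 t′
  exchange-weight {t} {t′} Q = trans (cong (g u v +_) (sym (weights-chords t 0)))
    (trans (sum-↭ (map⁺ _ σ)) (cong (g x y +_) (weights-chords t′ 0)))
    where
    open Quad Q
    to : ∀ {c} → c ∈ (u , v) ∷ chords 0 t → c ∈ (x , y) ∷ chords 0 t′
    to (here refl) = there (∈-chords uv)
    to (there c∈) with forward (chords-∈ t c∈)
    ... | inj₁ (refl , refl) = here refl
    ... | inj₂ c = there (∈-chords c)
    from : ∀ {c} → c ∈ (x , y) ∷ chords 0 t′ → c ∈ (u , v) ∷ chords 0 t
    from (here refl) = there (∈-chords xy)
    from (there c∈) with backward (chords-∈ t′ c∈)
    ... | inj₁ (refl , refl) = here refl
    ... | inj₂ c = there (∈-chords c)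
    σ : (u , v) ∷ chords 0 t ↭ (x , y) ∷ chords 0 t′
    σ = unique-↭ (Allₚ.¬Any⇒All¬ _ (uv∉ ∘ chords-∈ t) ∷ chords-unique t 0)
                 (Allₚ.¬Any⇒All¬ _ (xy∉ ∘ chords-∈ t′) ∷ chords-unique t′ 0) to from

  chord-weight : ∀ {t x u v} → Chord t x u v → g u v ≤ weight x t
  chord-weight {leaf} top = ≤-refl
  chord-weight {node s r} top = m≤m+n _ _
  chord-weight {node s r} {x} (inl c) =
    ≤-trans (chord-weight c) (≤-trans (m≤m+n (weight x s) _) (m≤n+m _ (g x (x + size (node s r)))))
  chord-weight {node s r} {x} (inr c) =
    ≤-trans (chord-weight c) (≤-trans (m≤n+m _ (weight x s)) (m≤n+m _ (g x (x + size (node s r)))))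

  module _ (g-high : ∀ {u v} → 4 ≤ u → g u v ≡ 0) where

    weight-high : ∀ t {x} → 4 ≤ x → weight x t ≡ 0
    weight-high leaf 4≤ = g-high 4≤
    weight-high (node s r) {x} 4≤ = cong₂ _+_ (g-high 4≤)
      (cong₂ _+_ (weight-high s 4≤) (weight-high r (≤-trans 4≤ (m≤m+n x (size s)))))

    weight-comb : ∀ {o κ t} k → (∀ {v} → 5 ≤ v → g o v ≡ κ) → 4 ≤ o + size t →
                  weight o (comb k t) ≡ k * κ + weight o t
    weight-comb zero _ _ = refl
    weight-comb {o} {κ} {t} (suc k) gκ 4≤ = trans (cong₂ _+_
      (gκ (≤-trans (s≤s 4≤′) (≤-trans (≤-reflexive (sym (+-suc o _)))
         (+-monoʳ-≤ o (≤-reflexive (+-comm 1 (size (comb k t))))))))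
      (trans (cong₂ _+_ (weight-comb k gκ 4≤) (g-high 4≤′)) (+-identityʳ _)))
      (sym (+-assoc κ (k * κ) (weight o t)))
      where
      4≤′ : 4 ≤ o + size (comb k t)
      4≤′ = ≤-trans 4≤ (+-monoʳ-≤ o (≤-trans (m≤n+m (size t) k) (≤-reflexive (sym (size-comb k t)))))

rung : ℕ → ℕ → ℕ
rung 1 (suc (suc (suc (suc (suc _))))) = 1
rung 2 (suc (suc (suc (suc (suc _))))) = 1
rung 3 (suc (suc (suc (suc (suc _))))) = 1
rung _ _ = 0

-- The weights of AC, pq, Aq, pC (3, 3, 2, 2) are such that two of them together exceed
-- a single one: a hub of total weight ≥ 5 is not adjacent to a cell, and one of total
-- weight 2 can only be reached from a cell by inserting Aq or pC.
spoke : ℕ → ℕ → ℕ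
spoke 0 3 = 2
spoke 0 4 = 3
spoke 1 3 = 3
spoke 1 4 = 2
spoke _ _ = 0

module Rung = Weights rung
module Spoke = Weights spoke

rung-high : ∀ {u v} → 4 ≤ u → rung u v ≡ 0
rung-high (s≤s (s≤s (s≤s (s≤s _)))) = refl

spoke-high : ∀ {u v} → 4 ≤ u → spoke u v ≡ 0
spoke-high (s≤s (s≤s (s≤s (s≤s _)))) = refl

rung-red : ∀ {v} → 5 ≤ v → rung 1 v ≡ 1 × rung 2 v ≡ 1 × rung 3 v ≡ 1
rung-red (s≤s (s≤s (s≤s (s≤s (s≤s _))))) = refl , refl , refl

spoke-red : ∀ u {v} → 5 ≤ v → spoke u v ≡ 0
spoke-red 0 (s≤s (s≤s (s≤s (s≤s (s≤s _))))) = refl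
spoke-red 1 (s≤s (s≤s (s≤s (s≤s (s≤s _))))) = refl
spoke-red (suc (suc _)) _ = refl

bit : Bool → ℕ
bit false = 0
bit true = 1

-- The number of chords counted by `rung` in a cell: B is joined to `5 + j`, ..., `5 + i`, and each
-- opened ear adds one chord from q or p.
level : Bool → Bool → ℕ → ℕ → ℕ
level x y i j = bit x + (bit y + suc (i ∸ j))

4≤ear : ∀ o x t → 2 ≤ o → 4 ≤ o + size (ear x t)
4≤ear o x t 2≤o = +-mono-≤ 2≤o (≤-trans (m≤m+n 2 (size t)) (≤-reflexive (sym (size-ear x t))))

5≤4+fan : ∀ i → 5 ≤ 4 + size (fan i)
5≤4+fan i = +-monoʳ-≤ 4 (0<size (fan i))

rung-weight-ear : ∀ y j → Rung.weight 2 (ear y (fan j)) ≡ suc (bit y)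
rung-weight-ear false j = cong₂ _+_ (proj₁ (proj₂ (rung-red (5≤4+fan j))))
  (Rung.weight-high rung-high (fan j) ≤-refl)
rung-weight-ear true j = cong₂ _+_ (proj₁ (proj₂ (rung-red (5≤4+fan j))))
  (cong₂ _+_ (proj₂ (proj₂ (rung-red (5≤4+fan j))))
    (Rung.weight-high rung-high (fan j) ≤-refl))

rung-weight-stem : ∀ y k j → Rung.weight 2 (comb k (ear y (fan j))) ≡ bit y + suc k
rung-weight-stem y k j = trans (Rung.weight-comb rung-high k (proj₁ ∘ proj₂ ∘ rung-red) (4≤ear 2 y _ ≤-refl))
  (trans (cong₂ _+_ (*-identityʳ k) (rung-weight-ear y j))
    (trans (+-comm k (suc (bit y))) (sym (+-suc (bit y) k))))

5≤size : ∀ {a} c → Valid a c → 5 ≤ size (core c)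
5≤size {a} c v = subst (5 ≤_) (sym (size-core {a} c v)) (m≤m+n 5 _)

rung-weight : ∀ {a} c → Valid a c → Rung.weight 0 (tree a c) ≡ Rung.weight 0 (core c)
rung-weight {a} c v = trans
  (Rung.weight-comb rung-high k (λ _ → refl) (≤-trans (n≤1+n 4) (5≤size {a} c v)))
  (cong (_+ Rung.weight 0 (core c)) (*-zeroʳ k))
  where k = a ∸ suc (last c)

spoke-weight : ∀ {a} c → Valid a c → Spoke.weight 0 (tree a c) ≡ Spoke.weight 0 (core c)
spoke-weight {a} c v = trans
  (Spoke.weight-comb spoke-high k (spoke-red 0) (≤-trans (n≤1+n 4) (5≤size {a} c v)))
  (cong (_+ Spoke.weight 0 (core c)) (*-zeroʳ k))
  where k = a ∸ suc (last c)

3≤stem : ∀ y k j → 3 ≤ size (comb k (ear y (fan j)))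
3≤stem y k j = ≤-trans (3≤ear y j) (≤-trans (m≤n+m _ k) (≤-reflexive (sym (size-comb k _))))

rung-weight-cell : ∀ x y i j → Rung.weight 0 (core (cell x y i j)) ≡ level x y i j
rung-weight-cell false y i j = rung-weight-stem y (i ∸ j) j
rung-weight-cell true y i j = cong₂ _+_
  (proj₁ (rung-red (+-monoʳ-≤ 2 (3≤stem y (i ∸ j) j)))) (rung-weight-stem y (i ∸ j) j)

spoke-weight-ear : ∀ y j → Spoke.weight 2 (ear y (fan j)) ≡ 0
spoke-weight-ear false j = Spoke.weight-high spoke-high (fan j) ≤-refl
spoke-weight-ear true j = Spoke.weight-high spoke-high (fan j) ≤-refl

spoke-weight-stem : ∀ y k j → Spoke.weight 2 (comb k (ear y (fan j))) ≡ 0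
spoke-weight-stem y k j = trans (Spoke.weight-comb spoke-high k (λ _ → refl) (4≤ear 2 y _ ≤-refl))
  (cong₂ _+_ (*-zeroʳ k) (spoke-weight-ear y j))

spoke-weight-cell : ∀ x y i j → Spoke.weight 0 (core (cell x y i j)) ≡ 0
spoke-weight-cell false y i j = cong₂ _+_ (spoke-red 0 (+-monoʳ-≤ 2 (3≤stem y (i ∸ j) j)))
  (spoke-weight-stem y (i ∸ j) j)
spoke-weight-cell true y i j = cong₂ _+_ (spoke-red 0 (+-monoʳ-≤ 2 (3≤stem y (i ∸ j) j)))
  (cong₂ _+_ (spoke-red 1 (+-monoʳ-≤ 2 (3≤stem y (i ∸ j) j))) (spoke-weight-stem y (i ∸ j) j))

-- Every hub contains Aq or pC, of weight 2, and all but two kinds also contain AC or pq, of weight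
-- 3 each. In the two exceptions the only rung is the one that starts at q or at p.
spoke-weight-hub : ∀ s r k i → let c = core (hub s r k i) in
  5 ≤ Spoke.weight 0 c ⊎ (Spoke.weight 0 c ≡ 2 × Rung.weight 0 c ≡ 1)
spoke-weight-hub false false false i = inj₁ (≤-trans (m≤m+n 5 _) (m≤n+m _ _))
spoke-weight-hub false false true i = inj₁ (≤-trans (m≤m+n 5 _) (m≤n+m _ _))
spoke-weight-hub true false false i = inj₁ (≤-trans (m≤m+n 5 _) (m≤n+m _ _))
spoke-weight-hub true false true i = inj₁ (≤-trans (m≤m+n 5 _) (m≤n+m _ _))
spoke-weight-hub false true true i = inj₁ (≤-trans (m≤m+n 5 _)
  (≤-trans (m≤n+m _ (spoke 1 (4 + size (fan i)))) (m≤n+m _ (spoke 0 (4 + size (fan i))))))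
spoke-weight-hub true true false i = inj₁ (≤-trans (m≤m+n 5 _) (m≤n+m _ (spoke 0 (4 + size (fan i)))))
spoke-weight-hub false true false i = inj₂
  ( cong₂ _+_ (spoke-red 0 (5≤4+fan i)) (cong₂ _+_ (spoke-red 1 (5≤4+fan i))
      (cong (2 +_) (Spoke.weight-high spoke-high (fan i) ≤-refl)))
  , cong₂ _+_ (proj₁ (rung-red (5≤4+fan i))) (Rung.weight-high rung-high (fan i) ≤-refl))
spoke-weight-hub true true true i = inj₂
  ( cong₂ _+_ (spoke-red 0 (5≤4+fan i)) (cong (2 +_) (Spoke.weight-high spoke-high (fan i) ≤-refl))
  , cong₂ _+_ (proj₂ (proj₂ (rung-red (5≤4+fan i)))) (Rung.weight-high rung-high (fan i) ≤-refl))

-- Flips of coloured quadrilaterals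

_≟ᶜ_ : (c d : Color) → Dec (c ≡ d)
red ≟ᶜ red = yes refl
red ≟ᶜ blue = no λ ()
blue ≟ᶜ red = no λ ()
blue ≟ᶜ blue = yes refl

-- What `cap` leaves of a strict inequality: two distinct red points of the long run both become 5.
Step : ℕ → ℕ → Set
Step u v = u < v ⊎ (u ≡ 5 × v ≡ 5)

-- The clauses serve flips from cell to cell, from cell to hub and from hub to cell. In the first,
-- `spoke x u ≡ 0` rules out the quadrilateral on AC and two red points, whose flip exchanges a
-- diagonal at C for one at A and hence no rung.
FlipRule : ℕ → ℕ → ℕ → ℕ → Set
FlipRule x u y v =
    (spoke x u ≡ 0 → spoke x y ≡ 0 → spoke u v ≡ 0 → rung x y + rung u v ≡ 1)
  × (spoke x y ≡ 0 → spoke u v ≡ 2 → rung x y ≡ 1 × rung u v ≡ 0)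
  × (spoke x y ≡ 2 → spoke u v ≡ 0 → rung x y ≡ 0 × rung u v ≡ 1)

ColouredFlipRule : ℕ → ℕ → ℕ → ℕ → Set
ColouredFlipRule x u y v = Step x u → Step u y → Step y v →
  NonMono x u y → NonMono x u v → NonMono x y v → NonMono u y v → FlipRule x u y v

coloured-flip-rule? : ∀ x u y v → Dec (ColouredFlipRule x u y v)
coloured-flip-rule? x u y v = step? x u →-dec step? u y →-dec step? y v →-dec
  nonMono? x u y →-dec nonMono? x u v →-dec nonMono? x y v →-dec nonMono? u y v →-dec
  ((spoke x u ≟ 0 →-dec spoke x y ≟ 0 →-dec spoke u v ≟ 0 →-dec rung x y + rung u v ≟ 1)
   ×-dec (spoke x y ≟ 0 →-dec spoke u v ≟ 2 →-dec (rung x y ≟ 1 ×-dec rung u v ≟ 0))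
   ×-dec (spoke x y ≟ 2 →-dec spoke u v ≟ 0 →-dec (rung x y ≟ 0 ×-dec rung u v ≟ 1)))
  where
  step? : ∀ u v → Dec (Step u v)
  step? u v = u <? v ⊎-dec (u ≟ 5 ×-dec v ≟ 5)
  nonMono? : ∀ u v w → Dec (NonMono u v w)
  nonMono? u v w = ¬? ((hue u ≟ᶜ hue v) ×-dec (hue v ≟ᶜ hue w))

-- Colours and weights do not distinguish the red vertices 5, 6, …, so the rule
-- only has to be checked for vertices up to 5.
abstract
  small-flip-rule : ∀ (x u y v : Fin 6) → ColouredFlipRule (toℕ x) (toℕ u) (toℕ y) (toℕ v)
  small-flip-rule = from-does (all? λ (x : Fin 6) → all? λ (u : Fin 6) → all? λ (y : Fin 6) → all? λ (v : Fin 6) →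
    coloured-flip-rule? (toℕ x) (toℕ u) (toℕ y) (toℕ v)) refl

cap : ℕ → Fin 6
cap 0 = # 0
cap 1 = # 1
cap 2 = # 2
cap 3 = # 3
cap 4 = # 4
cap _ = # 5

cap-hue : ∀ p → hue (toℕ (cap p)) ≡ hue p
cap-hue 0 = refl
cap-hue 1 = refl
cap-hue 2 = refl
cap-hue 3 = refl
cap-hue 4 = refl
cap-hue (suc (suc (suc (suc (suc n))))) = refl

cap-weights : ∀ u v → rung (toℕ (cap u)) (toℕ (cap v)) ≡ rung u v
                    × spoke (toℕ (cap u)) (toℕ (cap v)) ≡ spoke u v
cap-weights 0 0 = refl , refl
cap-weights 0 1 = refl , refl
cap-weights 0 2 = refl , refl
cap-weights 0 3 = refl , refl
cap-weights 0 4 = refl , refl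
cap-weights 0 (suc (suc (suc (suc (suc n))))) = refl , refl
cap-weights 1 0 = refl , refl
cap-weights 1 1 = refl , refl
cap-weights 1 2 = refl , refl
cap-weights 1 3 = refl , refl
cap-weights 1 4 = refl , refl
cap-weights 1 (suc (suc (suc (suc (suc n))))) = refl , refl
cap-weights 2 0 = refl , refl
cap-weights 2 1 = refl , refl
cap-weights 2 2 = refl , refl
cap-weights 2 3 = refl , refl
cap-weights 2 4 = refl , refl
cap-weights 2 (suc (suc (suc (suc (suc n))))) = refl , refl
cap-weights 3 0 = refl , refl
cap-weights 3 1 = refl , refl
cap-weights 3 2 = refl , refl
cap-weights 3 3 = refl , refl
cap-weights 3 4 = refl , refl
cap-weights 3 (suc (suc (suc (suc (suc n))))) = refl , refl
cap-weights 4 v = refl , refl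
cap-weights (suc (suc (suc (suc (suc n))))) v = refl , refl

cap-step : ∀ {u v} → u < v → Step (toℕ (cap u)) (toℕ (cap v))
cap-step {0} {1} _ = inj₁ (s≤s (z≤n))
cap-step {0} {2} _ = inj₁ (s≤s (z≤n))
cap-step {0} {3} _ = inj₁ (s≤s (z≤n))
cap-step {0} {4} _ = inj₁ (s≤s (z≤n))
cap-step {0} {(suc (suc (suc (suc (suc n)))))} _ = inj₁ (s≤s (z≤n))
cap-step {1} {2} _ = inj₁ (s≤s (s≤s (z≤n)))
cap-step {1} {3} _ = inj₁ (s≤s (s≤s (z≤n)))
cap-step {1} {4} _ = inj₁ (s≤s (s≤s (z≤n)))
cap-step {1} {(suc (suc (suc (suc (suc n)))))} _ = inj₁ (s≤s (s≤s (z≤n)))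
cap-step {2} {3} _ = inj₁ (s≤s (s≤s (s≤s (z≤n))))
cap-step {2} {4} _ = inj₁ (s≤s (s≤s (s≤s (z≤n))))
cap-step {2} {(suc (suc (suc (suc (suc n)))))} _ = inj₁ (s≤s (s≤s (s≤s (z≤n))))
cap-step {3} {4} _ = inj₁ (s≤s (s≤s (s≤s (s≤s (z≤n)))))
cap-step {3} {(suc (suc (suc (suc (suc n)))))} _ = inj₁ (s≤s (s≤s (s≤s (s≤s (z≤n)))))
cap-step {4} {(suc (suc (suc (suc (suc n)))))} _ = inj₁ (s≤s (s≤s (s≤s (s≤s (s≤s (z≤n))))))
cap-step {(suc (suc (suc (suc (suc n)))))} {(suc (suc (suc (suc (suc m)))))} _ = inj₂ (refl , refl)
cap-step {1} {1} (s≤s ())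
cap-step {2} {1} (s≤s ())
cap-step {2} {2} (s≤s (s≤s ()))
cap-step {3} {1} (s≤s ())
cap-step {3} {2} (s≤s (s≤s ()))
cap-step {3} {3} (s≤s (s≤s (s≤s ())))
cap-step {4} {1} (s≤s ())
cap-step {4} {2} (s≤s (s≤s ()))
cap-step {4} {3} (s≤s (s≤s (s≤s ())))
cap-step {4} {4} (s≤s (s≤s (s≤s (s≤s ()))))
cap-step {(suc (suc (suc (suc (suc n)))))} {1} (s≤s ())
cap-step {(suc (suc (suc (suc (suc n)))))} {2} (s≤s (s≤s ()))
cap-step {(suc (suc (suc (suc (suc n)))))} {3} (s≤s (s≤s (s≤s ())))
cap-step {(suc (suc (suc (suc (suc n)))))} {4} (s≤s (s≤s (s≤s (s≤s ()))))

flip-rule : ∀ {x u y v} → x < u → u < y → y < v →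
  NonMono x u y → NonMono x u v → NonMono x y v → NonMono u y v → FlipRule x u y v
flip-rule {x} {u} {y} {v} x<u u<y y<v n₁ n₂ n₃ n₄ = transport
  (proj₂ (cap-weights x u)) (cap-weights x y) (cap-weights u v)
  (small-flip-rule (cap x) (cap u) (cap y) (cap v) (cap-step x<u) (cap-step u<y) (cap-step y<v)
    (lower x u y n₁) (lower x u v n₂) (lower x y v n₃) (lower u y v n₄))
  where
  lower : ∀ u v w → NonMono u v w → NonMono (toℕ (cap u)) (toℕ (cap v)) (toℕ (cap w))
  lower u v w = subst id (sym (cong₂ (λ P Q → ¬ (P × Q))
    (cong₂ _≡_ (cap-hue u) (cap-hue v)) (cong₂ _≡_ (cap-hue v) (cap-hue w))))
  transport : ∀ {x u y v x′ u′ y′ v′} → spoke x′ u′ ≡ spoke x u →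
    rung x′ y′ ≡ rung x y × spoke x′ y′ ≡ spoke x y →
    rung u′ v′ ≡ rung u v × spoke u′ v′ ≡ spoke u v → FlipRule x′ u′ y′ v′ → FlipRule x u y v
  transport s₀ (r , s) (r′ , s′) rule rewrite s₀ | r | s | r′ | s′ = rule

quad-rule : ∀ {t t′} → Triangles NonMono 0 t → Triangles NonMono 0 t′ → (Q : Quad 0 t t′) →
            let open Quad Q in FlipRule x u y v
quad-rule {t} {t′} T T′ Q = flip-rule x<u u<y y<v
  (triangles-elim t T xu uy xy) (triangles-elim t′ T′ xu′ uv xv′)
  (triangles-elim t T xy yv xv) (triangles-elim t′ T′ uy′ yv′ uv)
  where open Quad Q

-- plus − minus is the weight +1, −1 or 0 of the header.
odd : ℕ → ℕ
odd 0 = 0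
odd 1 = 1
odd (suc (suc n)) = odd n

plus : Code → ℕ
plus (cell x y i j) = odd (suc (level x y i j))
plus (hub _ _ _ _) = 0

minus : Code → ℕ
minus (cell x y i j) = odd (level x y i j)
minus (hub _ _ _ _) = 0

-- Nonnegativity of the sum of the two signed weights, in natural numbers: what is negative on one
-- end is made up for by the other.
Opposed : Code → Code → Set
Opposed c d = minus c ≤ plus d × minus d ≤ plus c

spoke-free : ∀ {t u v} → Spoke.weight 0 t ≡ 0 → Chord t 0 u v → spoke u v ≡ 0
spoke-free e c = n≤0⇒n≡0 (subst (_ ≤_) e (Spoke.chord-weight c))

spoke<5 : ∀ u v → spoke u v < 5
spoke<5 u v = subst (_< 5) (proj₂ (cap-weights u v)) (go (cap u) (cap v))
  where
  go : ∀ u v → spoke (toℕ u) (toℕ v) < 5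
  go = from-does (all? λ (u : Fin 6) → all? λ (v : Fin 6) → spoke (toℕ u) (toℕ v) <? 5) refl

odd-opposed : ∀ m n p q → p + q ≡ 1 → q + m ≡ p + n →
                 odd m ≡ odd (suc n) × odd n ≡ odd (suc m)
odd-opposed m n zero q refl refl = refl , refl
odd-opposed m n (suc zero) zero refl refl = refl , refl

module _ {a : ℕ} where

  rung-cell : ∀ {x y i j} → Valid a (cell x y i j) →
              Rung.weight 0 (tree a (cell x y i j)) ≡ level x y i j
  rung-cell {x} {y} {i} {j} v = trans (rung-weight {a} (cell x y i j) v) (rung-weight-cell x y i j)

  spoke-cell : ∀ {x y i j} → Valid a (cell x y i j) → Spoke.weight 0 (tree a (cell x y i j)) ≡ 0
  spoke-cell {x} {y} {i} {j} v = trans (spoke-weight {a} (cell x y i j) v) (spoke-weight-cell x y i j)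

  weight-hub : ∀ {s r k i} → Valid a (hub s r k i) → let t = tree a (hub s r k i) in
    5 ≤ Spoke.weight 0 t ⊎ (Spoke.weight 0 t ≡ 2 × Rung.weight 0 t ≡ 1)
  weight-hub {s} {r} {k} {i} v
    rewrite spoke-weight {a} (hub s r k i) v | rung-weight {a} (hub s r k i) v = spoke-weight-hub s r k i

  -- Between cells exactly one of the two exchanged diagonals is a rung, so the level changes
  -- parity. Between a cell and a hub a single diagonal carries the whole spoke weight of the hub,
  -- which is therefore below 5 and so equals 2. The flip then trades a rung for this spoke, and the
  -- one rung of the hub makes the level of the cell 2.
  quad-opposed : ∀ c d → Valid a c → Valid a d → Quad 0 (tree a c) (tree a d) → Opposed c d
  quad-opposed (hub _ _ _ _) (hub _ _ _ _) _ _ _ = z≤n , z≤n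
  quad-opposed c@(cell x₁ y₁ i j) d@(cell x₂ y₂ k l) c✓ d✓ Q = ≤-reflexive (proj₁ e) , ≤-reflexive (proj₂ e)
    where
    open Quad Q
    rungs : rung x y + rung u v ≡ 1
    rungs = proj₁ (quad-rule (tree-triangles c c✓) (tree-triangles d d✓) Q)
      (spoke-free (spoke-cell c✓) xu) (spoke-free (spoke-cell c✓) xy) (spoke-free (spoke-cell d✓) uv)
    e : minus c ≡ plus d × minus d ≡ plus c
    e = odd-opposed (level x₁ y₁ i j) (level x₂ y₂ k l) (rung x y) (rung u v) rungs
      (subst₂ (λ m n → rung u v + m ≡ rung x y + n)
      (rung-cell c✓) (rung-cell d✓) (Rung.exchange-weight Q))
  quad-opposed c@(cell x₁ y₁ i j) d@(hub s r k l) c✓ d✓ Q = go (weight-hub {s} {r} {k} d✓)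
    where
    open Quad Q
    xy-free : spoke x y ≡ 0
    xy-free = spoke-free (spoke-cell c✓) xy
    uv-spoke : spoke u v ≡ Spoke.weight 0 (tree a d)
    uv-spoke = trans (sym (+-identityʳ _)) (trans (cong (spoke u v +_) (sym (spoke-cell c✓)))
      (trans (Spoke.exchange-weight Q) (cong (_+ Spoke.weight 0 (tree a d)) xy-free)))
    go : 5 ≤ Spoke.weight 0 (tree a d) ⊎ (Spoke.weight 0 (tree a d) ≡ 2 × Rung.weight 0 (tree a d) ≡ 1) →
         Opposed c d
    go (inj₁ 5≤) = contradiction (subst (5 ≤_) (sym uv-spoke) 5≤) (<⇒≱ (spoke<5 u v))
    go (inj₂ (s≡2 , r≡1)) with proj₁ (proj₂ (quad-rule (tree-triangles c c✓) (tree-triangles d d✓) Q))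
                               xy-free (trans uv-spoke s≡2)
    ... | xy-rung , uv-rung = subst (λ n → odd n ≤ 0) (sym level≡2) z≤n , z≤n
      where
      level≡2 : level x₁ y₁ i j ≡ 2
      level≡2 = trans (cong₂ _+_ (sym uv-rung) (sym (rung-cell c✓)))
        (trans (Rung.exchange-weight Q) (cong₂ _+_ xy-rung r≡1))
  quad-opposed c@(hub s r k l) d@(cell x₁ y₁ i j) c✓ d✓ Q = go (weight-hub {s} {r} {k} c✓)
    where
    open Quad Q
    uv-free : spoke u v ≡ 0
    uv-free = spoke-free (spoke-cell d✓) uv
    xy-spoke : spoke x y ≡ Spoke.weight 0 (tree a c)
    xy-spoke = sym (trans (cong (_+ Spoke.weight 0 (tree a c)) (sym uv-free))
      (trans (Spoke.exchange-weight Q) (trans (cong (spoke x y +_) (spoke-cell d✓)) (+-identityʳ _))))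
    go : 5 ≤ Spoke.weight 0 (tree a c) ⊎ (Spoke.weight 0 (tree a c) ≡ 2 × Rung.weight 0 (tree a c) ≡ 1) →
         Opposed c d
    go (inj₁ 5≤) = contradiction (subst (5 ≤_) (sym xy-spoke) 5≤) (<⇒≱ (spoke<5 x y))
    go (inj₂ (s≡2 , r≡1)) with proj₂ (proj₂ (quad-rule (tree-triangles c c✓) (tree-triangles d d✓) Q))
                               (trans xy-spoke s≡2) uv-free
    ... | xy-rung , uv-rung = z≤n , subst (λ n → odd n ≤ 0) (sym level≡2) z≤n
      where
      level≡2 : level x₁ y₁ i j ≡ 2
      level≡2 = trans (cong₂ _+_ (sym xy-rung) (sym (rung-cell d✓)))
        (trans (sym (Rung.exchange-weight Q)) (cong₂ _+_ uv-rung r≡1))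

-- Balanced totals and closed walks

total : (Code → ℕ) → List Code → ℕ
total f cs = sum (map f cs)

total-++ : ∀ f cs ds → total f (cs ++ ds) ≡ total f cs + total f ds
total-++ f cs ds = trans (cong sum (map-++ f cs ds)) (sum-++ (map f cs) (map f ds))

Balanced : List Code → Set
Balanced cs = total plus cs ≡ total minus cs

balanced-++ : ∀ cs ds → Balanced cs → Balanced ds → Balanced (cs ++ ds)
balanced-++ cs ds b b′ =
  trans (total-++ plus cs ds) (trans (cong₂ _+_ b b′) (sym (total-++ minus cs ds)))

-- The four levels are `n`, `n + 1`, `n + 1`, `n + 2` with `n = suc (i ∸ j)`, two of each parity.
quartet-balanced : ∀ i j → Balanced (quartet i j)
quartet-balanced i j = exchange (odd (i ∸ j)) (odd (suc (i ∸ j)))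
  where
  exchange : ∀ p q → p + (q + (q + (p + 0))) ≡ q + (p + (p + (q + 0)))
  exchange = solve-∀

cells-balanced : ∀ i n → Balanced (cells i n)
cells-balanced i zero = refl
cells-balanced i (suc n) = balanced-++ (quartet i n) (cells i n) (quartet-balanced i n) (cells-balanced i n)

codes-balanced : ∀ a → Balanced (codes a)
codes-balanced zero = refl
codes-balanced (suc a) = balanced-++ (layer a) (codes a)
  (balanced-++ (cells a (suc a)) (hubs a) (cells-balanced a (suc a)) refl) (codes-balanced a)

module _ {A : Set} (f g : A → ℕ) where

  chain-≤ : ∀ {x xs z} → Linked (λ c d → f c ≤ g d) ((x ∷ xs) ∷ʳ z) →
            sum (map f (x ∷ xs)) ≤ sum (map g (xs ∷ʳ z))
  chain-≤ {xs = []} (p ∷ [-]) = +-monoˡ-≤ 0 p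
  chain-≤ {xs = y ∷ ys} (p ∷ ps) = +-mono-≤ p (chain-≤ ps)

  -- Each inequality compares an element with its successor, so the sums run over the list and over
  -- its shift by one. The reverse inequality between the totals leaves no slack in any summand.
  chain-≡ : ∀ {x xs z} → Linked (λ c d → f c ≤ g d) ((x ∷ xs) ∷ʳ z) →
            sum (map g (xs ∷ʳ z)) ≤ sum (map f (x ∷ xs)) →
            Linked (λ c d → f c ≡ g d) ((x ∷ xs) ∷ʳ z)
  chain-≡ {x} {[]} {z} (p ∷ [-]) s = ≤-antisym p (+-cancelʳ-≤ 0 (g z) (f x) s) ∷ [-]
  chain-≡ {x} {y ∷ ys} {z} (p ∷ ps) s = ≤-antisym p
      (+-cancelʳ-≤ (sum (map f (y ∷ ys))) (g y) (f x) (≤-trans (+-monoʳ-≤ (g y) (chain-≤ ps)) s))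
    ∷ chain-≡ ps (+-cancelˡ-≤ (f x) _ _ (≤-trans (+-monoˡ-≤ (sum (map g (ys ∷ʳ z))) p) s))

module _ {A : Set} {P : A → Set} where

  chain-closed : ∀ {x} ys {z} → Linked (λ c d → P c → P d) ((x ∷ ys) ∷ʳ z) → P x →
                 (∀ {y} → y ∈ x ∷ ys → P y) × P z
  chain-closed [] (p ∷ [-]) px = (λ { (here refl) → px }) , p px
  chain-closed (y ∷ ys) (p ∷ ps) px with chain-closed ys ps (p px)
  ... | all , pz = (λ { (here refl) → px ; (there y∈) → all y∈ }) , pz

  chain-reaches : ∀ {x} ys {z} → Linked (λ c d → P c → P d) ((x ∷ ys) ∷ʳ z) →
                  ∀ {y} → y ∈ x ∷ ys → P y → P z
  chain-reaches ys ps (here refl) py = proj₂ (chain-closed ys ps py)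
  chain-reaches (_ ∷ ys) (_ ∷ ps) (there y∈) py = chain-reaches ys ps y∈ py

data Hub : Code → Set where
  hub : ∀ {s r k i} → Hub (hub s r k i)

minus+plus : ∀ x y i j → minus (cell x y i j) + plus (cell x y i j) ≡ 1
minus+plus x y i j = go (level x y i j)
  where
  go : ∀ n → odd n + odd (suc n) ≡ 1
  go 0 = refl
  go 1 = refl
  go (suc (suc n)) = go n

-- The equation forces `plus d` to vanish and the second half of `Opposed` forces `minus d` to
-- vanish, whereas one of them is 1 for a cell.
hub-closed : ∀ {c d} → Opposed c d → minus c ≡ plus d → Hub c → Hub d
hub-closed {d = hub _ _ _ _} _ _ hub = hub
hub-closed {d = cell x y i j} (_ , m≤) p≡ hub = contradiction
  (trans (sym (minus+plus x y i j)) (cong₂ _+_ (n≤0⇒n≡0 m≤) (sym p≡))) λ ()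

linked-zip : ∀ {A : Set} {P : A → Set} {R S : A → A → Set} {xs} → (∀ {x} → x ∈ xs → P x) →
  (∀ {x y} → P x → P y → R x y → S x y) → Linked R xs → Linked S xs
linked-zip p f [] = []
linked-zip p f [-] = [-]
linked-zip p f (r ∷ rs) = f (p (here refl)) (p (there (here refl))) r ∷ linked-zip (p ∘ there) f rs

-- No Hamilton cycle

module NoCycle (a : ℕ) (1≤a : 1 ≤ a) where
  open Colorful a
  open Colouring a
  open Decoding a 1≤a

  flip-opposed : ∀ {c d} → Valid a c → Valid a d → Flip (decode c) (decode d) → Opposed c d
  flip-opposed {c} {d} c✓ d✓ F = go (flip-quad (size-tree c c✓) (size-tree d d✓) F)
    where
    go : Quad 0 (tree a c) (tree a d) ⊎ Quad 0 (tree a d) (tree a c) → Opposed c d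
    go (inj₁ Q) = quad-opposed c d c✓ d✓ Q
    go (inj₂ Q) = let (p , q) = quad-opposed d c d✓ c✓ Q in q , p

  decode-list : ∀ Ms → (∀ {M} → M ∈ Ms → Node M) →
                ∃ λ cs → Ms ≡ map decode cs × (∀ {c} → c ∈ cs → Valid a c)
  decode-list [] _ = [] , refl , λ ()
  decode-list (M ∷ Ms) nodes =
    let (c , c✓ , e) = node-decode (nodes (here refl))
        (cs , es , cs✓) = decode-list Ms (nodes ∘ there)
    in c ∷ cs , cong₂ _∷_ e es , λ { (here refl) → c✓ ; (there c∈) → cs✓ c∈ }

  no-code-cycle : ∀ c cs → (∀ {d} → d ∈ c ∷ cs → Valid a d) → (∀ {d} → Valid a d → d ∈ c ∷ cs) →
                  Unique (c ∷ cs) → ¬ Linked Opposed ((c ∷ cs) ∷ʳ c)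
  no-code-cycle c cs sound complete unique L =
    -- Some hub lies on the cycle, so its last entry, which is also its first, is a hub. Then every
    -- entry is one, including a member of the cell (0 , 0).
    case proj₁ (chain-closed cs closed (chain-reaches cs closed (complete {hub false false false 0} 1≤a) hub))
           (complete {cell false false 0 0} (z≤n , 1≤a)) of λ ()
    where
    σ : c ∷ cs ↭ codes a
    σ = unique-↭ unique (codes-unique a) (valid-codes a _ ∘ sound) (complete ∘ codes-valid a)
    balanced : total plus (cs ∷ʳ c) ≤ total minus (c ∷ cs)
    balanced = ≤-reflexive (trans (sum-↭ (map⁺ plus (↭-trans (↭-sym (∷↭∷ʳ c cs)) σ)))
      (trans (codes-balanced a) (sym (sum-↭ (map⁺ minus σ)))))
    opposed-closed : Linked Opposed ((c ∷ cs) ∷ʳ c) → Linked (λ c d → minus c ≡ plus d) ((c ∷ cs) ∷ʳ c) →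
                     Linked (λ c d → Hub c → Hub d) ((c ∷ cs) ∷ʳ c)
    opposed-closed L E = Linked.zipWith (λ (o , e) → hub-closed o e) (L , E)
    closed : Linked (λ c d → Hub c → Hub d) ((c ∷ cs) ∷ʳ c)
    closed = opposed-closed L (chain-≡ minus plus (Linked.map proj₁ L) balanced)

  decoded-cycle : ∀ {M Ms} cs → M ∷ Ms ≡ map decode cs → (∀ {c} → c ∈ cs → Valid a c) →
                  (∀ {M′} → Node M′ → M′ ∈ map decode cs) → Unique (map decode cs) →
                  ¬ Linked Flip ((M ∷ Ms) ∷ʳ M)
  decoded-cycle (c ∷ cs) refl valid nodes unique L =
    no-code-cycle c cs valid complete (Uniqueₚ.map⁻ unique)
      (linked-zip valid′ flip-opposed
        (Linkedₚ.map⁻ (subst (Linked Flip) (sym (map-++ decode (c ∷ cs) (c ∷ []))) L)))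
    where
    complete : ∀ {d} → Valid a d → d ∈ c ∷ cs
    complete {d} d✓ = let (d′ , d′∈ , e) = ∈-map⁻ decode (nodes (decode-node d✓)) in
      subst (_∈ c ∷ cs) (sym (decode-injective d✓ (valid d′∈) e)) d′∈
    valid′ : ∀ {d} → d ∈ (c ∷ cs) ∷ʳ c → Valid a d
    valid′ d∈ with ∈-++⁻ (c ∷ cs) d∈
    ... | inj₁ d∈cs = valid d∈cs
    ... | inj₂ (here refl) = valid (here refl)

  no-cycle : ¬ HasHamCycle
  no-cycle (M , Ms , L , unique , nodes , _) =
    let (cs , e , valid) = decode-list (M ∷ Ms) (λ {M′} → Equivalence.to (nodes M′))
    in decoded-cycle cs e valid
         (λ {M′} nd → subst (M′ ∈_) e (Equivalence.from (nodes M′) nd)) (subst Unique e unique) L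

-- Flips between codes

infix 4 _⟶_ _~_

-- The exchanges behind the less obvious names: `slide-p`, `slide-q` and `slide` move the foot of a
-- fan, from B to A, from C to B and from C to A; `exit-q` and `exit-p` trade B to `5 + i` for Aq
-- and for pC; `turn` removes AC; `switch` flips Aq to pC inside the quadrilateral A, p, q, C.
data _⟶_ : Code → Code → Set where
  open-BC : ∀ {y i j} → cell false y i j ⟶ cell true y i j
  open-AB : ∀ {x i j} → cell x false i j ⟶ cell x true i j
  slide-p : ∀ {x i j} → cell x false i j ⟶ cell x false i (suc j)
  slide-q : ∀ {y i j} → cell false y i j ⟶ cell false y (suc i) j
  exit-q  : ∀ {i} → cell true false i i ⟶ hub false true false i
  exit-p  : ∀ {i} → cell false true i i ⟶ hub true true true i
  turn    : ∀ {s k i} → hub s false k i ⟶ hub s true k i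
  inner   : ∀ {s r i} → hub s r false i ⟶ hub s r true i
  switch  : ∀ {i} → hub false false true i ⟶ hub true false false i
  slide   : ∀ {s k i} → hub s false k i ⟶ hub s false k (suc i)

data _~_ : Code → Code → Set where
  to   : ∀ {c d} → c ⟶ d → c ~ d
  from : ∀ {c d} → d ⟶ c → c ~ d

Turn : Tree → Tree → Set
Turn t t′ = Rot t t′ ⊎ Rot t′ t

turn-in : ∀ {t t′} (C : Tree → Tree) → (∀ {t t′} → Rot t t′ → Rot (C t) (C t′)) →
          Turn t t′ → Turn (C t) (C t′)
turn-in C f (inj₁ ρ) = inj₁ (f ρ)
turn-in C f (inj₂ ρ) = inj₂ (f ρ)

turn-comb : ∀ k {t t′} → Turn t t′ → Turn (comb k t) (comb k t′)
turn-comb k = turn-in (comb k) (go k)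
  where
  go : ∀ k {t t′} → Rot t t′ → Rot (comb k t) (comb k t′)
  go zero ρ = ρ
  go (suc k) ρ = left (go k ρ)

turn-ear : ∀ x {t t′} → Turn t t′ → Turn (ear x t) (ear x t′)
turn-ear false = turn-in (ear false) right
turn-ear true = turn-in (ear true) (right ∘ right)

comb-node : ∀ k t → comb k (node t leaf) ≡ comb (suc k) t
comb-node zero t = refl
comb-node (suc k) t = cong (λ s → node s leaf) (comb-node k t)

-- Common core of all slides: the innermost step of the comb over `node s r` is moved by one
-- rotation onto `r`, which gains a point.
turn-node-comb : ∀ k s r {n} → n ≡ suc k → Turn (comb n (node s r)) (comb k (node s (node r leaf)))
turn-node-comb k s r refl = subst (λ t → Turn t (comb k (node s (node r leaf))))
  (comb-node k (node s r)) (turn-comb k (inj₁ assoc))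

∸-suc : ∀ {m n} → n < m → m ∸ n ≡ suc (m ∸ suc n)
∸-suc n<m = +-∸-assoc 1 n<m

adjacent-turn : ∀ {a c d} → c ⟶ d → Valid a c → Valid a d → Turn (tree a c) (tree a d)
adjacent-turn {a} {cell _ y i j} open-BC _ _ = turn-comb (a ∸ suc i) (inj₁ assoc)
adjacent-turn {a} {cell x _ i j} open-AB _ _ =
  turn-comb (a ∸ suc i) (turn-ear x (turn-comb (i ∸ j) (inj₁ assoc)))
adjacent-turn {a} {cell x _ i j} slide-p _ (j<i , _) = turn-comb (a ∸ suc i) (turn-ear x
  (turn-node-comb (i ∸ suc j) (node leaf leaf) (fan j) (∸-suc j<i)))
adjacent-turn {a} {cell _ y i j} slide-q (j≤i , _) (_ , i<a) =
  subst (λ n → Turn (comb (a ∸ suc i) (ear false (comb (i ∸ j) (ear y (fan j)))))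
                    (comb (a ∸ suc (suc i)) (ear false (comb n (ear y (fan j))))))
    (sym (+-∸-assoc 1 j≤i))
    (turn-node-comb (a ∸ suc (suc i)) (node leaf leaf) (comb (i ∸ j) (ear y (fan j))) (∸-suc i<a))
adjacent-turn {a} {cell _ _ i _} exit-q _ _ rewrite n∸n≡0 i =
  turn-comb (a ∸ suc i) (inj₂ (right assoc))
adjacent-turn {a} {cell _ _ i _} exit-p _ _ rewrite n∸n≡0 i = turn-comb (a ∸ suc i) (inj₂ assoc)
adjacent-turn {a} {hub false _ k i} turn _ _ = turn-comb (a ∸ suc i) (inj₁ assoc)
adjacent-turn {a} {hub true _ k i} turn _ _ = turn-comb (a ∸ suc i) (inj₁ assoc)
adjacent-turn {a} {hub false false _ i} inner _ _ = turn-comb (a ∸ suc i) (inj₂ (left (right assoc)))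
adjacent-turn {a} {hub false true _ i} inner _ _ = turn-comb (a ∸ suc i) (inj₂ (right (left assoc)))
adjacent-turn {a} {hub true false _ i} inner _ _ = turn-comb (a ∸ suc i) (inj₂ (left (left assoc)))
adjacent-turn {a} {hub true true _ i} inner _ _ = turn-comb (a ∸ suc i) (inj₂ (left assoc))
adjacent-turn {a} {hub _ _ _ i} switch _ _ = turn-comb (a ∸ suc i) (inj₂ (left assoc))
adjacent-turn {a} {hub false _ k i} slide _ i<a =
  turn-node-comb (a ∸ suc (suc i)) (node leaf (tri k)) (fan i) (∸-suc i<a)
adjacent-turn {a} {hub true _ k i} slide _ i<a =
  turn-node-comb (a ∸ suc (suc i)) (node (tri k) leaf) (fan i) (∸-suc i<a)

module Paths (a : ℕ) (1≤a : 1 ≤ a) where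
  open Colorful a
  open Colouring a
  open Decoding a 1≤a

  turn-flips : ∀ {c d} → Valid a c → Valid a d → Turn (tree a c) (tree a d) →
               Flip (decode c) (decode d) × Flip (decode d) (decode c)
  turn-flips {c} {d} c✓ d✓ (inj₁ ρ) = quad-flips (size-tree c c✓) (size-tree d d✓) (rot-quad ρ)
  turn-flips {c} {d} c✓ d✓ (inj₂ ρ) =
    let (f , f′) = quad-flips (size-tree d d✓) (size-tree c c✓) (rot-quad ρ) in f′ , f

  adjacent-flip : ∀ {c d} → Valid a c → Valid a d → c ~ d → Flip (decode c) (decode d)
  adjacent-flip c✓ d✓ (to e) = proj₁ (turn-flips c✓ d✓ (adjacent-turn e c✓ d✓))
  adjacent-flip c✓ d✓ (from e) = proj₂ (turn-flips d✓ c✓ (adjacent-turn e d✓ c✓))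

  -- Covering and the length bound make `cs` a permutation of `codes a`; distinctness and validity
  -- of its entries are inherited from there.
  path : ∀ cs → Linked _~_ cs → (∀ {c} → c ∈ codes a → c ∈ cs) → length cs ≤ length (codes a) →
         HasHamPath
  path cs L complete len = map decode cs ,
    Linkedₚ.map⁺ (linked-zip valid adjacent-flip L) ,
    unique-map valid (Permₛ.Unique-resp-↭ (setoid Code) (↭⇒↭ₛ σ) (codes-unique a)) ,
    λ M → mk⇔ (nodes M) (λ nd → let (c , c✓ , M≡) = node-decode nd in
      subst (_∈ map decode cs) (sym M≡) (∈-map⁺ decode (complete (valid-codes a c c✓))))
    where
    σ : codes a ↭ cs
    σ = unique-⊆-↭ (codes-unique a) complete len
    valid : ∀ {c} → c ∈ cs → Valid a c
    valid c∈ = codes-valid a (∈-resp-↭ (↭-sym σ) c∈)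
    nodes : ∀ M → M ∈ map decode cs → Node M
    nodes M M∈ = let (c , c∈ , M≡) = ∈-map⁻ decode M∈ in subst Node (sym M≡) (decode-node (valid c∈))
    unique-map : ∀ {cs} → (∀ {c} → c ∈ cs → Valid a c) → Unique cs → Unique (map decode cs)
    unique-map v [] = []
    unique-map {c ∷ cs} v u@(_ ∷ us) = Allₚ.¬Any⇒All¬ _ fresh ∷ unique-map (v ∘ there) us
      where
      fresh : decode c ∉ map decode cs
      fresh c∈ = let (d , d∈ , e) = ∈-map⁻ decode c∈ in
        Uniqueₚ.Unique[x∷xs]⇒x∉xs u (subst (_∈ cs) (sym (decode-injective (v (here refl)) (v (there d∈)) e)) d∈)

-- A Hamilton path through the codes

-- In the 4-cycle T, U, W, V columns are changed at T or U and rows at T or V.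
pattern T i j = cell false false i j
pattern U i j = cell true false i j
pattern V i j = cell false true i j
pattern W i j = cell true true i j

-- O contains AC but not pq, I contains both, K only pq, L neither. O, L, K, I is a 4-cycle; rows
-- are changed at O or I, the value of `s` at I, and L is the gate to the cells.
O I K L : Bool → ℕ → Code
O s i = hub s false s i
I s i = hub s false (not s) i
K s i = hub s true (not s) i
L s i = hub s true s i

-- Indexing by the list of codes lets instance search find the flips, so that `it` proves any
-- explicitly listed walk.
data Walk : Code → Code → List Code → Set where
  instance
    stop : ∀ {c} → Walk c c (c ∷ [])
    step : ∀ {c d e cs} → ⦃ c ~ d ⦄ → ⦃ Walk d e (d ∷ cs) ⦄ → Walk c e (c ∷ d ∷ cs)

instance
  open-BC⁺ : ∀ {y i j} → cell false y i j ~ cell true y i j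
  open-BC⁺ = to open-BC
  open-BC⁻ : ∀ {y i j} → cell true y i j ~ cell false y i j
  open-BC⁻ = from open-BC
  open-AB⁺ : ∀ {x i j} → cell x false i j ~ cell x true i j
  open-AB⁺ = to open-AB
  open-AB⁻ : ∀ {x i j} → cell x true i j ~ cell x false i j
  open-AB⁻ = from open-AB
  slide-p⁺ : ∀ {x i j} → cell x false i j ~ cell x false i (suc j)
  slide-p⁺ = to slide-p
  slide-p⁻ : ∀ {x i j} → cell x false i (suc j) ~ cell x false i j
  slide-p⁻ = from slide-p
  slide-q⁺ : ∀ {y i j} → cell false y i j ~ cell false y (suc i) j
  slide-q⁺ = to slide-q
  slide-q⁻ : ∀ {y i j} → cell false y (suc i) j ~ cell false y i j
  slide-q⁻ = from slide-q
  exit-q⁻ : ∀ {i} → hub false true false i ~ cell true false i i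
  exit-q⁻ = from exit-q
  exit-p⁺ : ∀ {i} → cell false true i i ~ hub true true true i
  exit-p⁺ = to exit-p
  exit-p⁻ : ∀ {i} → hub true true true i ~ cell false true i i
  exit-p⁻ = from exit-p
  turn⁺ : ∀ {s k i} → hub s false k i ~ hub s true k i
  turn⁺ = to turn
  turn⁻ : ∀ {s k i} → hub s true k i ~ hub s false k i
  turn⁻ = from turn
  inner⁺ : ∀ {s r i} → hub s r false i ~ hub s r true i
  inner⁺ = to inner
  inner⁻ : ∀ {s r i} → hub s r true i ~ hub s r false i
  inner⁻ = from inner
  switch⁺ : ∀ {i} → hub false false true i ~ hub true false false i
  switch⁺ = to switch
  switch⁻ : ∀ {i} → hub true false false i ~ hub false false true i
  switch⁻ = from switch
  slide⁺ : ∀ {s k i} → hub s false k i ~ hub s false k (suc i)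
  slide⁺ = to slide
  slide⁻ : ∀ {s k i} → hub s false k (suc i) ~ hub s false k i
  slide⁻ = from slide

walk-linked : ∀ {c d cs} → Walk c d cs → Linked _~_ cs
walk-linked stop = [-]
walk-linked (step ⦃ e ⦄ ⦃ w ⦄) = e ∷ walk-linked w

infixr 5 _▹_

_▹_ : ∀ {c d e f cs ds} → Walk c d cs → ⦃ d ~ e ⦄ → Walk e f ds → Walk c f (cs ++ ds)
_▹_ stop ⦃ e ⦄ stop = step
_▹_ stop ⦃ e ⦄ w@step = step ⦃ e ⦄ ⦃ w ⦄
_▹_ (step ⦃ e ⦄ ⦃ w ⦄) w′ = step ⦃ e ⦄ ⦃ w ▹ w′ ⦄

dbl : ℕ → ℕ
dbl zero = zero
dbl (suc n) = suc (suc (dbl n))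

fwd bwd : Bool → ℕ → List Code
fwd s i = O s i ∷ L s i ∷ K s i ∷ I s i ∷ []
bwd s i = I s i ∷ K s i ∷ L s i ∷ O s i ∷ []

fwd-walk : ∀ s i → Walk (O s i) (I s i) (fwd s i)
fwd-walk false i = it
fwd-walk true i = it

bwd-walk : ∀ s i → Walk (I s i) (O s i) (bwd s i)
bwd-walk false i = it
bwd-walk true i = it

-- Out with `s`, back with `not s`. A row is crossed from O to I or from I to O in turn, and the
-- change of `s` at the far end happens at I, so the number of rows is odd: `1 + dbl n`.
strip : Bool → ℕ → ℕ → List Code
strip s i zero = fwd s i ++ bwd (not s) i
strip s i (suc n) = fwd s i ++ bwd s (1 + i) ++ strip s (2 + i) n ++ fwd (not s) (1 + i) ++ bwd (not s) i

strip-walk : ∀ s i n → Walk (O s i) (O (not s) i) (strip s i n)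
strip-walk false i zero = it
strip-walk true i zero = it
strip-walk false i (suc n) = fwd-walk false i ▹ bwd-walk false (1 + i) ▹ strip-walk false (2 + i) n
  ▹ fwd-walk true (1 + i) ▹ bwd-walk true i
strip-walk true i (suc n) = fwd-walk true i ▹ bwd-walk true (1 + i) ▹ strip-walk true (2 + i) n
  ▹ fwd-walk false (1 + i) ▹ bwd-walk false i

nest-start : ℕ → ℕ → List Code
nest-start r j = U r j ∷ W r j ∷ V r j ∷ V (1 + r) j ∷ W (1 + r) j ∷ U (1 + r) j ∷
  U (1 + r) (1 + j) ∷ W (1 + r) (1 + j) ∷ V (1 + r) (1 + j) ∷ V r (1 + j) ∷ W r (1 + j) ∷ U r (1 + j) ∷ []

nest-end : ℕ → ℕ → List Code
nest-end r j = T r (1 + j) ∷ T (1 + r) (1 + j) ∷ T (1 + r) j ∷ T r j ∷ []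

-- Two columns per level. The way out takes U, W, V of the four cells in a U-shaped tour, changing
-- rows at V and columns at U; the four T remain for the way back. The lower row is one cell longer,
-- and the innermost level turns around there.
nest : ℕ → ℕ → ℕ → List Code
nest r j zero =
  U r j ∷ W r j ∷ V r j ∷ V (1 + r) j ∷ W (1 + r) j ∷ U (1 + r) j ∷
  T (1 + r) j ∷ T (1 + r) (1 + j) ∷ T (1 + r) (2 + j) ∷
  V (1 + r) (2 + j) ∷ W (1 + r) (2 + j) ∷ U (1 + r) (2 + j) ∷
  U (1 + r) (1 + j) ∷ W (1 + r) (1 + j) ∷ V (1 + r) (1 + j) ∷
  V r (1 + j) ∷ W r (1 + j) ∷ U r (1 + j) ∷ T r (1 + j) ∷ T r j ∷ []
nest r j (suc m) = nest-start r j ++ nest r (2 + j) m ++ nest-end r j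

nest-walk : ∀ r j m → Walk (U r j) (T r j) (nest r j m)
nest-walk r j zero = it
nest-walk r j (suc m) = start ▹ nest-walk r (2 + j) m ▹ end′
  where
  start : Walk (U r j) (U r (1 + j)) (nest-start r j)
  start = it
  end′ : Walk (T r (1 + j)) (T r j) (nest-end r j)
  end′ = it

block-start block-end : ℕ → List Code
block-start r = V r 0 ∷ W r 0 ∷ U r 0 ∷ []
block-end r = T r 0 ∷ T (1 + r) 0 ∷ U (1 + r) 0 ∷ W (1 + r) 0 ∷ V (1 + r) 0 ∷ []

-- Column 0 is kept out of the nest so that the two rows are entered and left at a V of column 0,
-- from which the next row is one `slide-q` away.
block : ℕ → ℕ → List Code
block r m = block-start r ++ nest r 1 m ++ block-end r

block-walk : ∀ r m → Walk (V r 0) (V (1 + r) 0) (block r m)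
block-walk r m = start ▹ nest-walk r 1 m ▹ end′
  where
  start : Walk (V r 0) (U r 0) (block-start r)
  start = it
  end′ : Walk (T r 0) (V (1 + r) 0) (block-end r)
  end′ = it

-- It starts at the cell member adjacent to the gate `L true 1` and ends where a block starting in
-- row 4 can be attached.
base : List Code
base =
  V 1 1 ∷ W 1 1 ∷ U 1 1 ∷ U 1 0 ∷ W 1 0 ∷ V 1 0 ∷ V 0 0 ∷ W 0 0 ∷ U 0 0 ∷ T 0 0 ∷
  T 1 0 ∷ T 1 1 ∷ T 2 1 ∷ T 2 2 ∷ U 2 2 ∷ W 2 2 ∷ V 2 2 ∷ V 3 2 ∷ W 3 2 ∷ U 3 2 ∷
  U 3 3 ∷ W 3 3 ∷ V 3 3 ∷ T 3 3 ∷ T 3 2 ∷ T 3 1 ∷ T 3 0 ∷ T 2 0 ∷ V 2 0 ∷ W 2 0 ∷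
  U 2 0 ∷ U 2 1 ∷ W 2 1 ∷ V 2 1 ∷ V 3 1 ∷ W 3 1 ∷ U 3 1 ∷ U 3 0 ∷ W 3 0 ∷ V 3 0 ∷
  []

corePath : ℕ → List Code
corePath zero = base
-- A block with parameter `m` reaches column `2 + dbl m` in its upper row, which is `4 + dbl n` for
-- `m = 1 + n`.
corePath (suc n) = corePath n ++ block (4 + dbl n) (1 + n)

corePath-walk : ∀ n → Walk (V 1 1) (V (3 + dbl n) 0) (corePath n)
corePath-walk zero = it
corePath-walk (suc n) = corePath-walk n ▹ block-walk (4 + dbl n) (1 + n)

-- Within one row columns change only at T or U, so cells are crossed from T to U and from U to T in
-- turn.
pair : ℕ → ℕ → List Code
pair r j = T r j ∷ V r j ∷ W r j ∷ U r j ∷ U r (1 + j) ∷ W r (1 + j) ∷ V r (1 + j) ∷ T r (1 + j) ∷ []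

pairs : ℕ → ℕ → ℕ → List Code
pairs r j zero = pair r j
pairs r j (suc m) = pair r j ++ pairs r (2 + j) m

pairs-walk : ∀ r j m → ∃ λ c → Walk (T r j) c (pairs r j m)
pairs-walk r j zero = _ , it
pairs-walk r j (suc m) = let (c , w) = pairs-walk r (2 + j) m in c , first ▹ w
  where
  first : Walk (T r j) (T r (1 + j)) (pair r j)
  first = it

row-start : ℕ → List Code
row-start r = V r 0 ∷ W r 0 ∷ U r 0 ∷ T r 0 ∷ []

row : ℕ → ℕ → List Code
row r m = row-start r ++ pairs r 1 m

row-walk : ∀ r m → ∃ λ c → Walk (V r 0) c (row r m)
row-walk r m = let (c , w) = pairs-walk r 1 m in c , start ▹ w
  where
  start : Walk (V r 0) (T r 0) (row-start r)
  start = it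

-- Rows 0 and 1 are arranged so that the hubs end at the gate `L true 1`. As a strip has an odd
-- number of rows, it starts in row 2 for odd `a`; for even `a` it starts in row 3, and row 2 is
-- crossed once for each `s`.
oddStart oddEnd evenStart evenEnd : List Code
oddStart = L false 1 ∷ K false 1 ∷ I false 1 ∷ I false 0 ∷ K false 0 ∷ L false 0 ∷ O false 0 ∷ O false 1 ∷ []
oddEnd = O true 1 ∷ O true 0 ∷ L true 0 ∷ K true 0 ∷ I true 0 ∷ I true 1 ∷ K true 1 ∷ L true 1 ∷ []
evenStart = K true 1 ∷ I true 1 ∷ []
evenEnd = I false 1 ∷ K false 1 ∷ L false 1 ∷ O false 1 ∷ O false 0 ∷ L false 0 ∷ K false 0 ∷ I false 0 ∷
  I true 0 ∷ K true 0 ∷ L true 0 ∷ O true 0 ∷ O true 1 ∷ L true 1 ∷ []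

oddHubs evenHubs : ℕ → List Code
oddHubs n = oddStart ++ strip false 2 (1 + n) ++ oddEnd
evenHubs n = evenStart ++ bwd true 2 ++ strip true 3 n ++ fwd false 2 ++ evenEnd

oddPath evenPath : ℕ → List Code
oddPath n = oddHubs n ++ corePath n ++ row (4 + dbl n) (1 + n)
evenPath n = evenHubs n ++ corePath n

oddPath-walk : ∀ n → ∃ λ c → Walk (L false 1) c (oddPath n)
oddPath-walk n = let (c , w) = row-walk (4 + dbl n) (1 + n) in
  c , ((start ▹ strip-walk false 2 (1 + n) ▹ end′) ▹ corePath-walk n ▹ w)
  where
  start : Walk (L false 1) (O false 1) oddStart
  start = it
  end′ : Walk (O true 1) (L true 1) oddEnd
  end′ = it

evenPath-walk : ∀ n → Walk (K true 1) (V (3 + dbl n) 0) (evenPath n)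
evenPath-walk n = (start ▹ bwd-walk true 2 ▹ strip-walk true 3 n ▹ fwd-walk false 2 ▹ end′) ▹ corePath-walk n
  where
  start : Walk (K true 1) (I true 1) evenStart
  start = it
  end′ : Walk (I false 1) (L true 1) evenEnd
  end′ = it

-- Unlike in the general path, the hubs are a detour inside the cell (1 , 1): entered from its V
-- through `L true 1` and left through `L false 1` to its U.
path₂ : List Code
path₂ =
  T 0 0 ∷ U 0 0 ∷ W 0 0 ∷ V 0 0 ∷ V 1 0 ∷ W 1 0 ∷ U 1 0 ∷ T 1 0 ∷ T 1 1 ∷ V 1 1 ∷
  L true 1 ∷ K true 1 ∷ I true 1 ∷ O true 1 ∷ O true 0 ∷ L true 0 ∷ K true 0 ∷ I true 0 ∷ I false 0 ∷ K false 0 ∷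
  L false 0 ∷ O false 0 ∷ O false 1 ∷ I false 1 ∷ K false 1 ∷ L false 1 ∷ U 1 1 ∷ W 1 1 ∷ []

path₂-walk : Walk (T 0 0) (W 1 1) path₂
path₂-walk = it

_≟ᵖ_ : (c d : Code) → Dec (c ≡ d)
cell x y i j ≟ᵖ cell x′ y′ i′ j′ =
  map′ (λ { (refl , refl , refl , refl) → refl }) (λ { refl → refl , refl , refl , refl })
    (x ≟ᵇ x′ ×-dec y ≟ᵇ y′ ×-dec i ≟ i′ ×-dec j ≟ j′)
hub s r k i ≟ᵖ hub s′ r′ k′ i′ =
  map′ (λ { (refl , refl , refl , refl) → refl }) (λ { refl → refl , refl , refl , refl })
    (s ≟ᵇ s′ ×-dec r ≟ᵇ r′ ×-dec k ≟ᵇ k′ ×-dec i ≟ i′)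
cell _ _ _ _ ≟ᵖ hub _ _ _ _ = no λ ()
hub _ _ _ _ ≟ᵖ cell _ _ _ _ = no λ ()

open DecMembership _≟ᵖ_ using (_∈?_)

sublist? : (cs ds : List Code) → Dec (All (_∈ ds) cs)
sublist? cs ds = All.all? (_∈? ds) cs

-- The paths visit all codes

HubsIn : ℕ → List Code → Set
HubsIn i cs = ∀ s r k → hub s r k i ∈ cs

CellsIn : ℕ → ℕ → List Code → Set
CellsIn i j cs = ∀ x y → cell x y i j ∈ cs

∈-fwd : ∀ s r k i → hub s r k i ∈ fwd s i
∈-fwd false false false i = here refl
∈-fwd false false true i = there (there (there (here refl)))
∈-fwd false true false i = there (here refl)
∈-fwd false true true i = there (there (here refl))
∈-fwd true false true i = here refl
∈-fwd true false false i = there (there (there (here refl)))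
∈-fwd true true true i = there (here refl)
∈-fwd true true false i = there (there (here refl))

∈-bwd : ∀ s r k i → hub s r k i ∈ bwd s i
∈-bwd s r k i = ∈-resp-↭ (rotate-fwd s i) (∈-fwd s r k i)
  where
  rotate-fwd : ∀ s i → fwd s i ↭ bwd s i
  rotate-fwd s i = ↭-sym (↭-reverse (fwd s i))

same-or-not : ∀ s s′ → s′ ≡ s ⊎ s′ ≡ not s
same-or-not false false = inj₁ refl
same-or-not false true = inj₂ refl
same-or-not true true = inj₁ refl
same-or-not true false = inj₂ refl

shift-2 : ∀ d i → d + (2 + i) ≡ 2 + (d + i)
shift-2 d i = trans (+-suc d (suc i)) (cong suc (+-suc d i))

strip-hubs : ∀ s i n d → d ≤ dbl n → HubsIn (d + i) (strip s i n)
strip-hubs s i zero zero _ s′ r k with same-or-not s s′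
... | inj₁ refl = ∈-++⁺ˡ (∈-fwd s r k i)
... | inj₂ refl = ∈-++⁺ʳ (fwd s i) (∈-bwd (not s) r k i)
strip-hubs s i (suc n) zero _ s′ r k with same-or-not s s′
... | inj₁ refl = ∈-++⁺ˡ (∈-fwd s r k i)
... | inj₂ refl = ∈-++⁺ʳ (fwd s i) (∈-++⁺ʳ (bwd s (1 + i)) (∈-++⁺ʳ (strip s (2 + i) n)
                    (∈-++⁺ʳ (fwd (not s) (1 + i)) (∈-bwd (not s) r k i))))
strip-hubs s i (suc n) (suc zero) _ s′ r k with same-or-not s s′
... | inj₁ refl = ∈-++⁺ʳ (fwd s i) (∈-++⁺ˡ (∈-bwd s r k (1 + i)))
... | inj₂ refl = ∈-++⁺ʳ (fwd s i) (∈-++⁺ʳ (bwd s (1 + i)) (∈-++⁺ʳ (strip s (2 + i) n)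
                    (∈-++⁺ˡ (∈-fwd (not s) r k (1 + i)))))
strip-hubs s i (suc n) (suc (suc d)) (s≤s (s≤s d≤)) s′ r k =
  ∈-++⁺ʳ (fwd s i) (∈-++⁺ʳ (bwd s (1 + i)) (∈-++⁺ˡ
    (subst (λ m → hub s′ r k m ∈ strip s (2 + i) n) (shift-2 d i) (strip-hubs s (2 + i) n d d≤ s′ r k))))

-- The numerals are indices into the explicit stretch of the list; for the T of an outer level they
-- count within `nest-end`.
nest-upper : ∀ r j m d → d ≤ 1 + dbl m → CellsIn r (d + j) (nest r j m)
nest-upper r j zero zero _ false false = ∈-lookup (# 19)
nest-upper r j zero zero _ true false = ∈-lookup (# 0)
nest-upper r j zero zero _ false true = ∈-lookup (# 2)
nest-upper r j zero zero _ true true = ∈-lookup (# 1)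
nest-upper r j zero (suc zero) _ false false = ∈-lookup (# 18)
nest-upper r j zero (suc zero) _ true false = ∈-lookup (# 17)
nest-upper r j zero (suc zero) _ false true = ∈-lookup (# 15)
nest-upper r j zero (suc zero) _ true true = ∈-lookup (# 16)
nest-upper r j zero (suc (suc d)) (s≤s ())
nest-upper r j (suc m) zero _ false false = ∈-++⁺ʳ (nest-start r j) (∈-++⁺ʳ (nest r (2 + j) m) (∈-lookup (# 3)))
nest-upper r j (suc m) zero _ true false = ∈-lookup (# 0)
nest-upper r j (suc m) zero _ false true = ∈-lookup (# 2)
nest-upper r j (suc m) zero _ true true = ∈-lookup (# 1)
nest-upper r j (suc m) (suc zero) _ false false = ∈-++⁺ʳ (nest-start r j) (∈-++⁺ʳ (nest r (2 + j) m) (∈-lookup (# 0)))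
nest-upper r j (suc m) (suc zero) _ true false = ∈-lookup (# 11)
nest-upper r j (suc m) (suc zero) _ false true = ∈-lookup (# 9)
nest-upper r j (suc m) (suc zero) _ true true = ∈-lookup (# 10)
nest-upper r j (suc m) (suc (suc d)) (s≤s (s≤s d≤)) x y = ∈-++⁺ʳ (nest-start r j)
  (∈-++⁺ˡ (subst (λ k → cell x y r k ∈ nest r (2 + j) m) (shift-2 d j) (nest-upper r (2 + j) m d d≤ x y)))

nest-lower : ∀ r j m d → d ≤ 2 + dbl m → CellsIn (1 + r) (d + j) (nest r j m)
nest-lower r j zero zero _ false false = ∈-lookup (# 6)
nest-lower r j zero zero _ true false = ∈-lookup (# 5)
nest-lower r j zero zero _ false true = ∈-lookup (# 3)
nest-lower r j zero zero _ true true = ∈-lookup (# 4)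
nest-lower r j zero (suc zero) _ false false = ∈-lookup (# 7)
nest-lower r j zero (suc zero) _ true false = ∈-lookup (# 12)
nest-lower r j zero (suc zero) _ false true = ∈-lookup (# 14)
nest-lower r j zero (suc zero) _ true true = ∈-lookup (# 13)
nest-lower r j zero (suc (suc zero)) _ false false = ∈-lookup (# 8)
nest-lower r j zero (suc (suc zero)) _ true false = ∈-lookup (# 11)
nest-lower r j zero (suc (suc zero)) _ false true = ∈-lookup (# 9)
nest-lower r j zero (suc (suc zero)) _ true true = ∈-lookup (# 10)
nest-lower r j zero (suc (suc (suc d))) (s≤s (s≤s ()))
nest-lower r j (suc m) zero _ false false = ∈-++⁺ʳ (nest-start r j) (∈-++⁺ʳ (nest r (2 + j) m) (∈-lookup (# 2)))
nest-lower r j (suc m) zero _ true false = ∈-lookup (# 5)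
nest-lower r j (suc m) zero _ false true = ∈-lookup (# 3)
nest-lower r j (suc m) zero _ true true = ∈-lookup (# 4)
nest-lower r j (suc m) (suc zero) _ false false = ∈-++⁺ʳ (nest-start r j) (∈-++⁺ʳ (nest r (2 + j) m) (∈-lookup (# 1)))
nest-lower r j (suc m) (suc zero) _ true false = ∈-lookup (# 6)
nest-lower r j (suc m) (suc zero) _ false true = ∈-lookup (# 8)
nest-lower r j (suc m) (suc zero) _ true true = ∈-lookup (# 7)
nest-lower r j (suc m) (suc (suc d)) (s≤s (s≤s d≤)) x y = ∈-++⁺ʳ (nest-start r j)
  (∈-++⁺ˡ (subst (λ k → cell x y (1 + r) k ∈ nest r (2 + j) m) (shift-2 d j) (nest-lower r (2 + j) m d d≤ x y)))

block-upper : ∀ r m j → j ≤ 2 + dbl m → CellsIn r j (block r m)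
block-upper r m zero _ false false = ∈-++⁺ʳ (block-start r) (∈-++⁺ʳ (nest r 1 m) (∈-lookup (# 0)))
block-upper r m zero _ true false = ∈-lookup (# 2)
block-upper r m zero _ false true = ∈-lookup (# 0)
block-upper r m zero _ true true = ∈-lookup (# 1)
block-upper r m (suc d) (s≤s d≤) x y = ∈-++⁺ʳ (block-start r)
  (∈-++⁺ˡ (subst (λ k → cell x y r k ∈ nest r 1 m) (+-comm d 1) (nest-upper r 1 m d d≤ x y)))

block-lower : ∀ r m j → j ≤ 3 + dbl m → CellsIn (1 + r) j (block r m)
block-lower r m zero _ false false = ∈-++⁺ʳ (block-start r) (∈-++⁺ʳ (nest r 1 m) (∈-lookup (# 1)))
block-lower r m zero _ true false = ∈-++⁺ʳ (block-start r) (∈-++⁺ʳ (nest r 1 m) (∈-lookup (# 2)))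
block-lower r m zero _ false true = ∈-++⁺ʳ (block-start r) (∈-++⁺ʳ (nest r 1 m) (∈-lookup (# 4)))
block-lower r m zero _ true true = ∈-++⁺ʳ (block-start r) (∈-++⁺ʳ (nest r 1 m) (∈-lookup (# 3)))
block-lower r m (suc d) (s≤s d≤) x y = ∈-++⁺ʳ (block-start r)
  (∈-++⁺ˡ (subst (λ k → cell x y (1 + r) k ∈ nest r 1 m) (+-comm d 1) (nest-lower r 1 m d d≤ x y)))

pairs-cells : ∀ r j m d → d ≤ 1 + dbl m → CellsIn r (d + j) (pairs r j m)
pairs-cells r j zero zero _ false false = ∈-lookup (# 0)
pairs-cells r j (suc m) zero _ false false = ∈-lookup (# 0)
pairs-cells r j zero zero _ true false = ∈-lookup (# 3)
pairs-cells r j (suc m) zero _ true false = ∈-lookup (# 3)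
pairs-cells r j zero zero _ false true = ∈-lookup (# 1)
pairs-cells r j (suc m) zero _ false true = ∈-lookup (# 1)
pairs-cells r j zero zero _ true true = ∈-lookup (# 2)
pairs-cells r j (suc m) zero _ true true = ∈-lookup (# 2)
pairs-cells r j zero (suc zero) _ false false = ∈-lookup (# 7)
pairs-cells r j (suc m) (suc zero) _ false false = ∈-lookup (# 7)
pairs-cells r j zero (suc zero) _ true false = ∈-lookup (# 4)
pairs-cells r j (suc m) (suc zero) _ true false = ∈-lookup (# 4)
pairs-cells r j zero (suc zero) _ false true = ∈-lookup (# 6)
pairs-cells r j (suc m) (suc zero) _ false true = ∈-lookup (# 6)
pairs-cells r j zero (suc zero) _ true true = ∈-lookup (# 5)
pairs-cells r j (suc m) (suc zero) _ true true = ∈-lookup (# 5)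
pairs-cells r j zero (suc (suc d)) (s≤s ())
pairs-cells r j (suc m) (suc (suc d)) (s≤s (s≤s d≤)) x y = ∈-++⁺ʳ (pair r j)
  (subst (λ k → cell x y r k ∈ pairs r (2 + j) m) (shift-2 d j) (pairs-cells r (2 + j) m d d≤ x y))

row-cells : ∀ r m j → j ≤ 2 + dbl m → CellsIn r j (row r m)
row-cells r m zero _ false false = ∈-lookup (# 3)
row-cells r m zero _ true false = ∈-lookup (# 2)
row-cells r m zero _ false true = ∈-lookup (# 0)
row-cells r m zero _ true true = ∈-lookup (# 1)
row-cells r m (suc d) (s≤s d≤) x y = ∈-++⁺ʳ (row-start r)
  (subst (λ k → cell x y r k ∈ pairs r 1 m) (+-comm d 1) (pairs-cells r 1 m d d≤ x y))

base-cells : ∀ i j → i < 4 → j ≤ i → CellsIn i j base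
base-cells i j i<4 j≤i x y = All.lookup included (cells∈ i i<4 (∈-cells x y i (s≤s j≤i)))
  where
  included : All (_∈ base) (cells 0 1 ++ cells 1 2 ++ cells 2 3 ++ cells 3 4)
  included = from-does (sublist? (cells 0 1 ++ cells 1 2 ++ cells 2 3 ++ cells 3 4) base) refl
  cells∈ : ∀ {c} i → i < 4 → c ∈ cells i (suc i) → c ∈ cells 0 1 ++ cells 1 2 ++ cells 2 3 ++ cells 3 4
  cells∈ 0 _ c∈ = ∈-++⁺ˡ c∈
  cells∈ 1 _ c∈ = ∈-++⁺ʳ (cells 0 1) (∈-++⁺ˡ c∈)
  cells∈ 2 _ c∈ = ∈-++⁺ʳ (cells 0 1) (∈-++⁺ʳ (cells 1 2) (∈-++⁺ˡ c∈))
  cells∈ 3 _ c∈ = ∈-++⁺ʳ (cells 0 1) (∈-++⁺ʳ (cells 1 2) (∈-++⁺ʳ (cells 2 3) c∈))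
  cells∈ (suc (suc (suc (suc i)))) (s≤s (s≤s (s≤s (s≤s ())))) _

corePath-cells : ∀ n i j → i < 4 + dbl n → j ≤ i → CellsIn i j (corePath n)
corePath-cells zero i j i< j≤i = base-cells i j i< j≤i
corePath-cells (suc n) i j i< j≤i x y with m≤n⇒m<n∨m≡n (s≤s⁻¹ i<)
... | inj₂ refl = ∈-++⁺ʳ (corePath n) (block-lower (4 + dbl n) (1 + n) j j≤i x y)
... | inj₁ i<′ with m≤n⇒m<n∨m≡n (s≤s⁻¹ i<′)
...   | inj₂ refl = ∈-++⁺ʳ (corePath n) (block-upper (4 + dbl n) (1 + n) j j≤i x y)
...   | inj₁ i<″ = ∈-++⁺ˡ (corePath-cells n i j i<″ j≤i x y)

around : ∀ {c : Code} as bs cs → c ∈ as ++ cs → c ∈ as ++ bs ++ cs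
around as bs cs c∈ with ∈-++⁻ as c∈
... | inj₁ c∈as = ∈-++⁺ˡ c∈as
... | inj₂ c∈cs = ∈-++⁺ʳ as (∈-++⁺ʳ bs c∈cs)

oddHubs-hubs : ∀ n i → i < 5 + dbl n → HubsIn i (oddHubs n)
oddHubs-hubs n (suc (suc d)) (s≤s (s≤s (s≤s d≤))) s r k = ∈-++⁺ʳ oddStart (∈-++⁺ˡ
  (subst (λ i → hub s r k i ∈ strip false 2 (1 + n)) (+-comm d 2) (strip-hubs false 2 (1 + n) d d≤ s r k)))
oddHubs-hubs n 0 _ s r k = around oddStart (strip false 2 (1 + n)) oddEnd (All.lookup included (∈-hubs s r k 0))
  where
  included : All (_∈ oddStart ++ oddEnd) (hubs 0)
  included = from-does (sublist? (hubs 0) (oddStart ++ oddEnd)) refl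
oddHubs-hubs n 1 _ s r k = around oddStart (strip false 2 (1 + n)) oddEnd (All.lookup included (∈-hubs s r k 1))
  where
  included : All (_∈ oddStart ++ oddEnd) (hubs 1)
  included = from-does (sublist? (hubs 1) (oddStart ++ oddEnd)) refl

even-ends : ∀ n {c} → c ∈ evenStart ++ evenEnd → c ∈ evenHubs n
even-ends n c∈ with ∈-++⁻ evenStart c∈
... | inj₁ c∈s = ∈-++⁺ˡ c∈s
... | inj₂ c∈e = ∈-++⁺ʳ evenStart (∈-++⁺ʳ (bwd true 2) (∈-++⁺ʳ (strip true 3 n) (∈-++⁺ʳ (fwd false 2) c∈e)))

evenHubs-hubs : ∀ n i → i < 4 + dbl n → HubsIn i (evenHubs n)
evenHubs-hubs n 0 _ s r k = even-ends n (All.lookup included (∈-hubs s r k 0))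
  where
  included : All (_∈ evenStart ++ evenEnd) (hubs 0)
  included = from-does (sublist? (hubs 0) (evenStart ++ evenEnd)) refl
evenHubs-hubs n 1 _ s r k = even-ends n (All.lookup included (∈-hubs s r k 1))
  where
  included : All (_∈ evenStart ++ evenEnd) (hubs 1)
  included = from-does (sublist? (hubs 1) (evenStart ++ evenEnd)) refl
evenHubs-hubs n 2 _ true r k = ∈-++⁺ʳ evenStart (∈-++⁺ˡ (∈-bwd true r k 2))
evenHubs-hubs n 2 _ false r k = ∈-++⁺ʳ evenStart (∈-++⁺ʳ (bwd true 2) (∈-++⁺ʳ (strip true 3 n)
  (∈-++⁺ˡ (∈-fwd false r k 2))))
evenHubs-hubs n (suc (suc (suc d))) (s≤s (s≤s (s≤s (s≤s d≤)))) s r k =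
  ∈-++⁺ʳ evenStart (∈-++⁺ʳ (bwd true 2) (∈-++⁺ˡ
    (subst (λ i → hub s r k i ∈ strip true 3 n) (+-comm d 3) (strip-hubs true 3 n d d≤ s r k))))

oddPath-complete : ∀ n {c} → Valid (5 + dbl n) c → c ∈ oddPath n
oddPath-complete n {hub s r k i} i< = ∈-++⁺ˡ (oddHubs-hubs n i i< s r k)
oddPath-complete n {cell x y i j} (j≤i , i<) with m≤n⇒m<n∨m≡n (s≤s⁻¹ i<)
... | inj₁ i<′ = ∈-++⁺ʳ (oddHubs n) (∈-++⁺ˡ (corePath-cells n i j i<′ j≤i x y))
... | inj₂ refl = ∈-++⁺ʳ (oddHubs n) (∈-++⁺ʳ (corePath n) (row-cells (4 + dbl n) (1 + n) j j≤i x y))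

evenPath-complete : ∀ n {c} → Valid (4 + dbl n) c → c ∈ evenPath n
evenPath-complete n {hub s r k i} i< = ∈-++⁺ˡ (evenHubs-hubs n i i< s r k)
evenPath-complete n {cell x y i j} (j≤i , i<) = ∈-++⁺ʳ (evenHubs n) (corePath-cells n i j i< j≤i x y)

-- The paths are as long as the enumeration

length-strip : ∀ s i n → length (strip s i n) ≡ 8 + n * 16
length-strip s i zero = refl
length-strip s i (suc n) = cong (8 +_) (trans (length-++ (strip s (2 + i) n))
  (trans (cong (_+ 8) (length-strip s (2 + i) n)) (+-comm (8 + n * 16) 8)))

length-nest : ∀ r j m → length (nest r j m) ≡ 20 + m * 16
length-nest r j zero = refl
length-nest r j (suc m) = cong (12 +_) (trans (length-++ (nest r (2 + j) m))
  (trans (cong (_+ 4) (length-nest r (2 + j) m)) (+-comm (20 + m * 16) 4)))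

length-block : ∀ r m → length (block r m) ≡ 28 + m * 16
length-block r m = cong (3 +_) (trans (length-++ (nest r 1 m))
  (trans (cong (_+ 5) (length-nest r 1 m)) (+-comm (20 + m * 16) 5)))

length-pairs : ∀ r j m → length (pairs r j m) ≡ 8 + m * 8
length-pairs r j zero = refl
length-pairs r j (suc m) = cong (8 +_) (length-pairs r (2 + j) m)

length-oddHubs : ∀ n → length (oddHubs n) ≡ 40 + n * 16
length-oddHubs n = cong (8 +_) (trans (length-++ (strip false 2 (1 + n)))
  (trans (cong (_+ 8) (length-strip false 2 (1 + n))) (+-comm (24 + n * 16) 8)))

length-evenHubs : ∀ n → length (evenHubs n) ≡ 32 + n * 16
length-evenHubs n = cong (6 +_) (trans (length-++ (strip true 3 n))
  (trans (cong (_+ 18) (length-strip true 3 n)) (+-comm (8 + n * 16) 18)))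

length-cells : ∀ i n → length (cells i n) ≡ n * 4
length-cells i zero = refl
length-cells i (suc n) = cong (4 +_) (length-cells i n)

length-layer : ∀ i → length (layer i) ≡ suc i * 4 + 8
length-layer i = trans (length-++ (cells i (suc i))) (cong (_+ 8) (length-cells i (suc i)))

length-codes-suc : ∀ i → length (codes (suc i)) ≡ suc i * 4 + 8 + length (codes i)
length-codes-suc i = trans (length-++ (layer i)) (cong (_+ length (codes i)) (length-layer i))

dbl≡ : ∀ n → dbl n ≡ n * 2
dbl≡ zero = refl
dbl≡ (suc n) = cong (2 +_) (dbl≡ n)

-- Passing from `n` to `suc n` adds 16 hubs and a block of `44 + n * 16` cell members, which
-- together make up the layers `4 + dbl n` and `5 + dbl n`.
length-evenPath : ∀ n → length (evenPath n) ≡ length (codes (4 + dbl n))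
length-evenPath n = trans (length-++ (evenHubs n))
  (trans (cong (_+ length (corePath n)) (length-evenHubs n)) (go n))
  where
  step-≡ : ∀ n c → 48 + n * 16 + (c + (44 + n * 16)) ≡
                   (6 + n * 2) * 4 + 8 + ((5 + n * 2) * 4 + 8 + (32 + n * 16 + c))
  step-≡ = solve-∀
  go : ∀ n → 32 + n * 16 + length (corePath n) ≡ length (codes (4 + dbl n))
  go zero = refl
  go (suc n) = trans
    (cong (48 + n * 16 +_) (trans (length-++ (corePath n))
      (cong (length (corePath n) +_) (length-block (4 + dbl n) (1 + n)))))
    (trans (step-≡ n (length (corePath n)))
      (trans (cong₂ (λ d ℓ → (6 + d) * 4 + 8 + ((5 + d) * 4 + 8 + ℓ)) (sym (dbl≡ n)) (go n))
        (sym (trans (length-codes-suc (5 + dbl n))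
          (cong ((6 + dbl n) * 4 + 8 +_) (length-codes-suc (4 + dbl n)))))))

-- Compared with the even path for the same `n` there is one more layer: 8 hubs and a row of
-- `20 + n * 8` cell members.
length-oddPath : ∀ n → length (oddPath n) ≡ length (codes (5 + dbl n))
length-oddPath n = trans (length-++ (oddHubs n))
  (trans (cong₂ _+_ (length-oddHubs n)
    (trans (length-++ (corePath n)) (cong (length (corePath n) +_) (cong (4 +_) (length-pairs (4 + dbl n) 1 (1 + n))))))
    (trans (rearrange n (length (corePath n)))
      (trans (cong₂ (λ d ℓ → (5 + d) * 4 + 8 + ℓ) (sym (dbl≡ n)) even)
        (sym (length-codes-suc (4 + dbl n))))))
  where
  rearrange : ∀ n c → 40 + n * 16 + (c + (20 + n * 8)) ≡ (5 + n * 2) * 4 + 8 + (32 + n * 16 + c)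
  rearrange = solve-∀
  even : 32 + n * 16 + length (corePath n) ≡ length (codes (4 + dbl n))
  even = trans (cong (_+ length (corePath n)) (sym (length-evenHubs n)))
    (trans (sym (length-++ (evenHubs n))) (length-evenPath n))

path₂-complete : ∀ {c} → c ∈ codes 2 → c ∈ path₂
path₂-complete = All.lookup included
  where
  included : All (_∈ path₂) (codes 2)
  included = from-does (sublist? (codes 2) path₂) refl

-- Assembly by the parity of `a`

even-or-odd : ∀ n → (∃ λ m → n ≡ dbl m) ⊎ (∃ λ m → n ≡ 1 + dbl m)
even-or-odd zero = inj₁ (0 , refl)
even-or-odd (suc n) with even-or-odd n
... | inj₁ (m , refl) = inj₂ (m , refl)
... | inj₂ (m , refl) = inj₁ (suc m , refl)

ham-path₂ : Colorful.HasHamPath 2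
ham-path₂ = Paths.path 2 (s≤s z≤n) path₂ (walk-linked path₂-walk) path₂-complete ≤-refl

ham-path : ∀ a → 4 ≤ a → Colorful.HasHamPath a
ham-path (suc (suc (suc (suc k)))) (s≤s (s≤s (s≤s (s≤s z≤n)))) with even-or-odd k
... | inj₁ (n , refl) = Paths.path (4 + dbl n) (s≤s z≤n) (evenPath n) (walk-linked (evenPath-walk n))
  (evenPath-complete n ∘ codes-valid (4 + dbl n)) (≤-reflexive (length-evenPath n))
... | inj₂ (n , refl) = Paths.path (5 + dbl n) (s≤s z≤n) (oddPath n) (walk-linked (proj₂ (oddPath-walk n)))
  (oddPath-complete n ∘ codes-valid (5 + dbl n)) (≤-reflexive (length-oddPath n))

theorem5 : ((a : ℕ) → 1 ≤ a → ¬ Colorful.HasHamCycle a)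
    × Colorful.HasHamPath 2
    × ((a : ℕ) → 4 ≤ a → Colorful.HasHamPath a)
theorem5 = NoCycle.no-cycle , ham-path₂ , ham-path
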